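{- Let $H$ be a fixed graph. There exist positive functions $f$ and $g$ (depending only on $\varepsilon$ and $H$) such that for every $\varepsilon>0$ and every $H$-minor-free graph $G=(V,E)$ the following holds for the algorithm Random-Bipartiteness-Exploration$(G,\varepsilon)$ described in the context: (1) if $G$ is bipartite, then the algorithm accepts $G$; (2) if $G$ is $\varepsilon$-far from bipartite, then the algorithm rejects $G$ with probability at least $0.99$.
   Context: A graph $G$ is $H$-minor-free if $H$ cannot be obtained from $G$ by a sequence of vertex deletions, edge deletions and edge contractions. A graph $G=(V,E)$ is $\varepsilon$-far from bipartite if one has to delete more than $\varepsilon|V|$ edges from $G$ to obtain a bipartite graph. The graph is accessed through degree queries and neighbor queries (the $i$-th neighbor of a vertex, or a uniformly random neighbor). A random walk of length $t$ from $v$ starts at $v$ and $t$ times moves from the current vertex to a uniformly random neighbor (independently in each step). The walk finds an odd-length cycle if the subgraph formed by the edges it traverses contains an odd-length cycle. Algorithm Random-Bipartiteness-Exploration$(G,\varepsilon)$: repeat $f(\varepsilon)$ times: pick a uniformly random vertex $v\in V$ and perform a random walk of length $g(\varepsilon)$ from $v$; if the walk found an odd-length cycle, reject. If no walk found an odd-length cycle, accept. -}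

module Defs where

open import Data.Nat as ℕ using (ℕ; zero; suc; _∸_)
open import Data.Fin using (Fin; zero; suc; punchIn; toℕ; _≟_)
open import Data.Bool using (Bool; true; false; _∧_; _∨_; not; if_then_else_)
open import Data.List using (List; []; _∷_; allFin; filterᵇ; length; foldr; map; concatMap; upTo)
open import Data.Bool.ListAction using (any; all)
open import Data.Nat.ListAction using (sum)
import Data.Vec
open import Data.Vec using (Vec; []; _∷_; lookup)
open import Data.Product using (Σ; _×_; _,_; ∃)
open import Data.Integer using (+_)
open import Data.Rational using (ℚ; 0ℚ; 1ℚ; _+_; _*_; _-_; _/_; _<_)
open import Relation.Nullary using (¬_)
open import Relation.Nullary.Decidable using (⌊_⌋)
open import Relation.Binary.PropositionalEquality using (_≡_; _≢_)

Graph : ℕ → Set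
Graph n = Fin n → Fin n → Bool

Simple : ∀ {n} → Graph n → Set
Simple {n} G = (∀ i j → G i j ≡ G j i) × (∀ i → G i i ≡ false)

_==_ : ∀ {n} → Fin n → Fin n → Bool
i == j = ⌊ i ≟ j ⌋

deleteEdge : ∀ {n} → Graph n → Fin n → Fin n → Graph n
deleteEdge G u v i j = G i j ∧ not ((i == u ∧ j == v) ∨ (i == v ∧ j == u))

deleteVertex : ∀ {n} → Graph (suc n) → Fin (suc n) → Graph n
deleteVertex G v i j = G (punchIn v i) (punchIn v j)

-- contract the edge uv: v is removed and merged into u
contract : ∀ {n} → Graph (suc n) → Fin (suc n) → Fin (suc n) → Graph n
contract G u v i j =
  not (i == j) ∧
  (G (punchIn v i) (punchIn v j)
   ∨ (punchIn v i == u ∧ G v (punchIn v j))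
   ∨ (punchIn v j == u ∧ G (punchIn v i) v))

record _≅_ {n m} (G : Graph n) (H : Graph m) : Set where
  field
    to      : Fin n → Fin m
    from    : Fin m → Fin n
    from∘to : ∀ i → from (to i) ≡ i
    to∘from : ∀ j → to (from j) ≡ j
    preserves : ∀ i j → H (to i) (to j) ≡ G i j

data IsMinor {k} (H : Graph k) : ∀ {n} → Graph n → Set where
  done   : ∀ {n} {G : Graph n} → G ≅ H → IsMinor H G
  delE   : ∀ {n} {G : Graph n} (u v : Fin n) →
           IsMinor H (deleteEdge G u v) → IsMinor H G
  delV   : ∀ {n} {G : Graph (suc n)} (v : Fin (suc n)) →
           IsMinor H (deleteVertex G v) → IsMinor H G
  contr  : ∀ {n} {G : Graph (suc n)} (u v : Fin (suc n)) → G u v ≡ true →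
           IsMinor H (contract G u v) → IsMinor H G

MinorFree : ∀ {k n} → Graph k → Graph n → Set
MinorFree H G = ¬ IsMinor H G

Bipartite : ∀ {n} → Graph n → Set
Bipartite {n} G = Σ (Fin n → Bool) λ c → ∀ i j → G i j ≡ true → c i ≢ c j

count : ∀ {A : Set} → (A → Bool) → List A → ℕ
count p xs = length (filterᵇ p xs)

edgeCount : ∀ {n} → Graph n → ℕ
edgeCount {n} G =
  sum (map (λ i → count (λ j → G i j ∧ ⌊ toℕ i ℕ.<? toℕ j ⌋) (allFin n)) (allFin n))

SpanningSubgraph : ∀ {n} → Graph n → Graph n → Set
SpanningSubgraph G' G =
  (∀ i j → G' i j ≡ G' j i) × (∀ i j → G' i j ≡ true → G i j ≡ true)

FarFromBipartite : ∀ {n} → ℚ → Graph n → Set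
FarFromBipartite {n} ε G =
  ∀ (G' : Graph n) → SpanningSubgraph G' G → Bipartite G' →
  ε * (+ n / 1) < (+ (edgeCount G ∸ edgeCount G') / 1)

EdgeList : ℕ → Set
EdgeList n = List (Fin n × Fin n)

inE : ∀ {n} → EdgeList n → Fin n → Fin n → Bool
inE E x y = any (λ { (a , b) → (a == x ∧ b == y) ∨ (a == y ∧ b == x) }) E

allVecs : ∀ n k → List (Vec (Fin n) k)
allVecs n zero    = [] ∷ []
allVecs n (suc k) = concatMap (λ x → map (x ∷_) (allVecs n k)) (allFin n)

distinctV : ∀ {n k} → Vec (Fin n) k → Bool
distinctV [] = true
distinctV (x ∷ xs) = all (λ y → not (x == y)) (Data.Vec.toList xs) ∧ distinctV xs

pathEdges : ∀ {n k} → EdgeList n → Fin n → Vec (Fin n) k → Bool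
pathEdges E x [] = true
pathEdges E x (y ∷ ys) = inE E x y ∧ pathEdges E y ys

lastV : ∀ {n k} → Fin n → Vec (Fin n) k → Fin n
lastV x [] = x
lastV x (y ∷ ys) = lastV y ys

isCycle : ∀ {n k} → EdgeList n → Vec (Fin n) k → Bool
isCycle E [] = false
isCycle E (x ∷ xs) = distinctV (x ∷ xs) ∧ pathEdges E x xs ∧ inE E (lastV x xs) x

odd : ℕ → Bool
odd zero = false
odd (suc k) = not (odd k)

-- the edge set contains a cycle of odd length k ≥ 3 (a cycle has at most n vertices)
hasOddCycle : ∀ {n} → EdgeList n → Bool
hasOddCycle {n} E =
  any (λ k → odd k ∧ ⌊ 3 ℕ.≤? k ⌋ ∧ any (isCycle E) (allVecs n k)) (upTo (suc n))

neighbours : ∀ {n} → Graph n → Fin n → List (Fin n)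
neighbours {n} G v = filterᵇ (G v) (allFin n)

sumℚ : List ℚ → ℚ
sumℚ = foldr _+_ 0ℚ

-- probability that a random walk of t further steps from `cur`, having
-- already traversed the edges E, ends with a set of traversed edges that
-- contains an odd cycle.  Convention: at an isolated vertex the walk stays put.
walkProb : ∀ {n} → Graph n → ℕ → Fin n → EdgeList n → ℚ
walkProb G zero cur E = if hasOddCycle E then 1ℚ else 0ℚ
walkProb G (suc t) cur E with neighbours G cur
... | [] = walkProb G t cur E
... | ns@(_ ∷ _) =
  (+ 1 / length ns) * sumℚ (map (λ w → walkProb G t w ((cur , w) ∷ E)) ns)

trialProb : ∀ {n} → Graph n → ℕ → ℚ
trialProb {zero} G t = 0ℚ
trialProb {suc n} G t =
  (+ 1 / suc n) * sumℚ (map (λ v → walkProb G t v []) (allFin (suc n)))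

powℚ : ℚ → ℕ → ℚ
powℚ q zero = 1ℚ
powℚ q (suc m) = q * powℚ q m

-- probability that Random-Bipartiteness-Exploration with r repetitions of
-- walks of length t rejects G (the repetitions are independent)
rejectProb : ∀ {n} → Graph n → ℕ → ℕ → ℚ
rejectProb G r t = 1ℚ - powℚ (1ℚ - trialProb G t) r

{-# OPTIONS --safe #-}
-- Partition the vertices into clusters, each with a centre that the random walk from every
-- vertex of the cluster reaches with constant probability after a prescribed constant number
-- of steps.  Singletons are such clusters.  As H-minor-free graphs and their contractions are
-- sparse (Mader), a constant fraction of the arcs between clusters runs from a cluster A to its
-- favourite neighbour B; discarding the pairs with few arcs compared to the degree of the centre
-- of A and choosing a directed cut, we may merge all these A into their B at once.  The walk from
-- the centre of A reaches that of B with constant probability: by reversibility it can descend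
-- in A as well as ascend, so it crosses to B along an almost uniform arc of A.  After constantly
-- many rounds only ε n / 2 arcs between clusters are left.
--
-- If G is far from bipartite, then deleting these arcs is not enough: many arcs inside clusters
-- join vertices whose prescribed numbers of steps have the same parity.  From the centres of the
-- clusters in which such arcs are frequent (they contain a constant fraction of the vertices, by
-- sparsity) the walk returns with constant probability after descending, crossing such an arc
-- and ascending.  This is a closed walk of odd length, so its edges contain an odd cycle.

module Submission where

open import Defs
open import Data.Bool using (Bool; true; false; _∧_; _∨_; _xor_; not; if_then_else_; T; T?)
import Data.Bool as Bool
import Data.Bool.Properties as Bool
open import Data.Bool.ListAction using (any; all)
open import Data.Bool.Properties using (not-involutive; ¬-not)
open import Data.Fin using (Fin; zero; suc; toℕ; fromℕ<; punchIn; punchOut)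
import Data.Fin as Fin
import Data.Fin.Properties as Fin
open import Data.List using (List; []; _∷_; _++_; allFin; cartesianProduct; filterᵇ; length; map; tabulate; upTo)
import Data.List as List
open import Data.List.Membership.Propositional using (_∈_)
open import Data.List.Membership.Propositional.Properties using (∈-allFin; ∈-cartesianProduct⁺; ∈-concatMap⁺; ∈-filter⁺; ∈-filter⁻; ∈-lookup; ∈-map⁺; ∈-upTo⁺)
open import Data.List.Properties using (length-++)
import Data.List.Properties as List
open import Data.List.Relation.Unary.All using (All; []; _∷_)
import Data.List.Relation.Unary.All as All
open import Data.List.Relation.Unary.AllPairs using ([]; _∷_)
open import Data.List.Relation.Unary.Any using (here; there)
import Data.List.Relation.Unary.Any as Any
open import Data.List.Relation.Unary.Unique.Propositional using (Unique)
open import Data.Maybe using (Maybe; just; nothing)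
import Data.Maybe as Maybe
import Data.Maybe.Properties as Maybe
open import Data.Nat using (ℕ; zero; suc; _+_; _*_; _∸_; z≤n; s≤s; z<s; s≤s⁻¹; _≤?_; >-nonZero)
import Data.Nat
import Data.Nat as ℕ
import Data.Nat.ListAction as ListAction
open import Data.Nat.Properties
import Data.Nat.Properties as ℕ
open import Data.Nat.Tactic.RingSolver using (solve-∀)
open import Data.Product using (Σ; ∃; ∃₂; _×_; _,_; proj₁; proj₂; map₁; map₂)
open import Data.Rational using (ℚ; 0ℚ; 1ℚ; _/_; toℚᵘ)
import Data.Rational as ℚ
import Data.Rational.Properties as ℚ
open import Data.Rational.Solver using (module +-*-Solver)
import Data.Rational.Unnormalised as ℚᵘ
import Data.Rational.Unnormalised.Properties as ℚᵘ
open import Data.Sum using (_⊎_; inj₁; inj₂)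
open import Data.Vec using (Vec; []; _∷_)
import Data.Vec as Vec
open import Function using (_∘_)
import Relation.Binary.Construct.Closure.ReflexiveTransitive as Star
open import Relation.Binary.PropositionalEquality
open import Relation.Nullary using (¬_; Dec; yes; no; contradiction)
open import Relation.Nullary.Decidable using (_×-dec_; ¬?; ⌊_⌋)
open import Algebra.Bundles using (CommutativeRing)
import Algebra.Properties.Semiring.Sum
module ∑ℕ-Properties = Algebra.Properties.Semiring.Sum +-*-semiring
module ∑ℚ-Properties = Algebra.Properties.Semiring.Sum (CommutativeRing.semiring ℚ.+-*-commutativeRing)

-- The obstacle is that degrees are unbounded: a walk need not find a given edge with constant
-- probability, however close it is. What helps is that a step is self-adjoint for the degree
-- measure. Let m arcs lead from vertices that reach the centre of A in i steps to vertices that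
-- reach the centre of B in j steps, each with probability at least 1/N. Then the walk from the
-- centre of A is at the centre of B after i + 1 + j steps with probability at least m / (N² d),
-- where d is the degree of the centre of A. So m has to be compared with the degree of a single
-- vertex. Different clusters have different centres, hence these degrees sum to at most the number
-- of arcs of G, which is linear in n; therefore little is lost with the clusters where m is too
-- small. Ascents have an exact length, not a bounded one, because lengths must add up and because
-- their parities are the candidate 2-colouring. Constants are natural numbers throughout, and p ≥
-- 1/N is expressed as 1 ≤ N p.

module Lemmas where
  open import Data.Nat using (_<_; _≤_; _<ᵇ_; _≤ᵇ_)
  open import Relation.Binary.Construct.Closure.ReflexiveTransitive using (Star; ε; _◅_; _◅◅_)

  -- Sums over finite sets

  ⟦_⟧ : Bool → ℕ
  ⟦ true ⟧  = 1
  ⟦ false ⟧ = 0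

  opaque
    ∑ : ∀ {n} → (Fin n → ℕ) → ℕ
    ∑ = ∑ℕ-Properties.sum

  ==-refl : ∀ {n} (i : Fin n) → (i == i) ≡ true
  ==-refl i with i Fin.≟ i
  ... | yes _ = refl
  ... | no i≢i = contradiction refl i≢i

  ==⇒≡ : ∀ {n} {i j : Fin n} → (i == j) ≡ true → i ≡ j
  ==⇒≡ {i = i} {j} eq with i Fin.≟ j
  ... | yes i≡j = i≡j

  ≢⇒==-false : ∀ {n} {i j : Fin n} → i ≢ j → (i == j) ≡ false
  ≢⇒==-false {i = i} {j} i≢j with i Fin.≟ j
  ... | yes i≡j = contradiction i≡j i≢j
  ... | no _ = refl

  ==-sym : ∀ {n} (i j : Fin n) → (i == j) ≡ (j == i)
  ==-sym i j with i Fin.≟ j | j Fin.≟ i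
  ... | yes _ | yes _ = refl
  ... | no _ | no _ = refl
  ... | yes i≡j | no j≢i = contradiction (sym i≡j) j≢i
  ... | no i≢j | yes j≡i = contradiction (sym j≡i) i≢j

  ==-suc : ∀ {n} (i j : Fin n) → (Fin.suc i == suc j) ≡ (i == j)
  ==-suc i j with i Fin.≟ j
  ... | yes _ = refl
  ... | no _ = refl

  opaque
    unfolding ∑

    ∑-suc : ∀ {n} (f : Fin (suc n) → ℕ) → ∑ f ≡ f zero + ∑ (f ∘ suc)
    ∑-suc f = refl

    ∑-empty : (f : Fin 0 → ℕ) → ∑ f ≡ 0
    ∑-empty f = refl

    ∑-swap : ∀ {m n} (f : Fin m → Fin n → ℕ) →
             ∑ (λ x → ∑ (λ y → f x y)) ≡ ∑ (λ y → ∑ (λ x → f x y))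
    ∑-swap = ∑ℕ-Properties.∑-comm

    ∑-cong : ∀ {n} {f g : Fin n → ℕ} → (∀ i → f i ≡ g i) → ∑ f ≡ ∑ g
    ∑-cong = ∑ℕ-Properties.sum-cong-≗

    ∑-mono : ∀ {n} {f g : Fin n → ℕ} → (∀ i → f i ≤ g i) → ∑ f ≤ ∑ g
    ∑-mono {zero}  f≤g = z≤n
    ∑-mono {suc n} f≤g = +-mono-≤ (f≤g zero) (∑-mono (f≤g ∘ suc))

    ∑-const : ∀ n c → ∑ {n} (λ _ → c) ≡ n * c
    ∑-const zero    c = refl
    ∑-const (suc n) c = cong (c +_) (∑-const n c)

    ∑-zero : ∀ {n} {f : Fin n → ℕ} → (∀ i → f i ≡ 0) → ∑ f ≡ 0
    ∑-zero {n} f≡0 = trans (∑-cong f≡0) (trans (∑-const n 0) (*-zeroʳ n))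

    ∑-member : ∀ {n} (f : Fin n → ℕ) i → f i ≤ ∑ f
    ∑-member f zero    = m≤m+n _ _
    ∑-member f (suc i) = ≤-trans (∑-member (f ∘ suc) i) (m≤n+m _ _)

    ∑-pos : ∀ {n} {f : Fin n → ℕ} → 0 < ∑ f → ∃ λ i → 0 < f i
    ∑-pos {suc n} {f} 0<∑ with f zero in eq
    ... | suc _ = zero , subst (0 <_) (sym eq) z<s
    ... | zero with ∑-pos {n} {f ∘ suc} 0<∑
    ...   | i , 0<fi = suc i , 0<fi

    ∑-δ : ∀ {n} (i : Fin n) (f : Fin n → ℕ) → ∑ (λ j → ⟦ i == j ⟧ * f j) ≡ f i
    ∑-δ {suc n} zero f = trans (cong₂ _+_ (*-identityˡ _) (∑-zero {n} (λ _ → refl))) (+-identityʳ _)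
    ∑-δ {suc n} (suc i) f =
      trans (∑-cong {n} (λ j → cong (λ b → ⟦ b ⟧ * f (suc j)) (==-suc i j))) (∑-δ i (f ∘ suc))

    ∑-*ˡ : ∀ {n} c (f : Fin n → ℕ) → ∑ (λ i → c * f i) ≡ c * ∑ f
    ∑-*ˡ c f = sym (∑ℕ-Properties.*-distribˡ-sum c f)

    ∑-+ : ∀ {n} (f g : Fin n → ℕ) → ∑ (λ i → f i + g i) ≡ ∑ f + ∑ g
    ∑-+ = ∑ℕ-Properties.∑-distrib-+

  ∑-fibre : ∀ {m n} (h : Fin m → Fin n) (v : Fin m → Fin n → ℕ) →
            ∑ (λ a → ∑ (λ x → ⟦ h x == a ⟧ * v x a)) ≡ ∑ (λ x → v x (h x))
  ∑-fibre h v = trans (∑-swap (λ a x → ⟦ h x == a ⟧ * v x a)) (∑-cong (λ x → ∑-δ (h x) (v x)))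

  opaque
    argmax : ∀ {n} (f : Fin (suc n) → ℕ) → ∃ λ i → ∀ j → f j ≤ f i
    argmax {zero}  f = zero , λ { zero → ≤-refl }
    argmax {suc n} f with argmax (f ∘ suc)
    ... | i , max with ≤-total (f zero) (f (suc i))
    ...   | inj₁ p = suc i , λ { zero → p ; (suc j) → max j }
    ...   | inj₂ p = zero , λ { zero → ≤-refl ; (suc j) → ≤-trans (max j) p }

  heaviest-fibre : ∀ {m n} (h : Fin m → Fin (suc n)) (v : Fin m → ℕ) →
                   ∃ λ a → ∑ v ≤ suc n * ∑ (λ x → ⟦ h x == a ⟧ * v x)
  heaviest-fibre {n = n} h v with argmax (λ a → ∑ (λ x → ⟦ h x == a ⟧ * v x))
  ... | a , max = a , (begin
    ∑ v                                           ≡⟨ ∑-fibre h (λ x _ → v x) ⟨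
    ∑ (λ b → ∑ (λ x → ⟦ h x == b ⟧ * v x))        ≤⟨ ∑-mono max ⟩
    ∑ {suc n} (λ _ → ∑ (λ x → ⟦ h x == a ⟧ * v x)) ≡⟨ ∑-const (suc n) _ ⟩
    suc n * ∑ (λ x → ⟦ h x == a ⟧ * v x)          ∎)
    where open ≤-Reasoning

  *-flip : ∀ a b c → a * (b * c) ≡ b * (a * c)
  *-flip = solve-∀

  ⟦∧⟧ : ∀ a b → ⟦ a ∧ b ⟧ ≡ ⟦ a ⟧ * ⟦ b ⟧
  ⟦∧⟧ true  b = sym (*-identityˡ _)
  ⟦∧⟧ false b = refl

  ⟦⟧*-pos : ∀ b {m} → 0 < ⟦ b ⟧ * m → b ≡ true × 0 < m
  ⟦⟧*-pos true {m} p = refl , subst (0 <_) (*-identityˡ m) p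

  ⟦⟧-pos : ∀ b → 0 < ⟦ b ⟧ → b ≡ true
  ⟦⟧-pos true p = refl

  ⟦⟧*-≤ : ∀ b m → ⟦ b ⟧ * m ≤ m
  ⟦⟧*-≤ true  m = ≤-reflexive (*-identityˡ m)
  ⟦⟧*-≤ false m = z≤n

  card : ∀ {n} → (Fin n → Bool) → ℕ
  card α = ∑ (λ x → ⟦ α x ⟧)

  -- Ordered adjacent pairs: for a symmetric graph this is twice the number of edges.
  arcs : ∀ {n} → Graph n → ℕ
  arcs R = ∑ (λ x → ∑ (λ y → ⟦ R x y ⟧))

  -- Clique minors in dense graphs

  ∧-true : ∀ {a b} → a ∧ b ≡ true → a ≡ true × b ≡ true
  ∧-true {true} {true} _ = refl , refl

  ∧-intro : ∀ {a b} → a ≡ true → b ≡ true → a ∧ b ≡ true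
  ∧-intro refl refl = refl

  ∨-true : ∀ {a b} → a ∨ b ≡ true → a ≡ true ⊎ b ≡ true
  ∨-true {true}  _ = inj₁ refl
  ∨-true {false} p = inj₂ p

  ∨-introʳ : ∀ a {b} → b ≡ true → a ∨ b ≡ true
  ∨-introʳ true  _ = refl
  ∨-introʳ false p = p

  ∨-introˡ : ∀ {a b} → a ≡ true → a ∨ b ≡ true
  ∨-introˡ refl = refl

  not-true : ∀ {a} → not a ≡ true → a ≢ true
  not-true {false} _ ()

  not-==⇒≢ : ∀ {n} {i j : Fin n} → not (i == j) ≡ true → i ≢ j
  not-==⇒≢ {i = i} p refl = not-true p (==-refl i)

  ≢⇒not-== : ∀ {n} {i j : Fin n} → i ≢ j → not (i == j) ≡ true
  ≢⇒not-== i≢j = cong not (≢⇒==-false i≢j)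

  ⟦⟧-mono : ∀ {a b} → (a ≡ true → b ≡ true) → ⟦ a ⟧ ≤ ⟦ b ⟧
  ⟦⟧-mono {false} _ = z≤n
  ⟦⟧-mono {true} {b} a⇒b rewrite a⇒b refl = ≤-refl

  ⟦⟧-true : ∀ {a} → a ≡ true → 1 ≤ ⟦ a ⟧
  ⟦⟧-true refl = ≤-refl

  ⟦⟧-≤1 : ∀ a → ⟦ a ⟧ ≤ 1
  ⟦⟧-≤1 true  = ≤-refl
  ⟦⟧-≤1 false = z≤n

  -- Pooling the values at `u` and `v` in `u` makes the inequality pointwise. To avoid a subtraction
  -- at `v`, that entry is raised to `f v + g v` on both sides.
  ∑-≤-twoPoints : ∀ {n} {u v : Fin n} (f g : Fin n → ℕ) k → u ≢ v →
                  (∀ a → a ≢ u → a ≢ v → f a ≤ g a) → f u + f v ≤ g u + g v + k →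
                  ∑ f ≤ ∑ g + k
  ∑-≤-twoPoints {u = u} {v} f g k u≢v off on =
    +-cancelʳ-≤ (f v + g v) _ _ (begin
      ∑ f + (f v + g v)                                            ≡⟨ at-uv f (f v) (g v) ⟨
      ∑ (λ a → f a + (⟦ u == a ⟧ * f v + ⟦ v == a ⟧ * g v))        ≤⟨ ∑-mono pointwise ⟩
      ∑ (λ a → g a + (⟦ u == a ⟧ * (g v + k) + ⟦ v == a ⟧ * f v))  ≡⟨ at-uv g (g v + k) (f v) ⟩
      ∑ g + (g v + k + f v)                                        ≡⟨ rearrange (∑ g) (g v) k (f v) ⟩
      ∑ g + k + (f v + g v)                                        ∎)
    where
    open ≤-Reasoning
    rearrange : ∀ a b c d → a + (b + c + d) ≡ a + c + (d + b)
    rearrange = solve-∀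
    at-uv : ∀ h p q → ∑ (λ a → h a + (⟦ u == a ⟧ * p + ⟦ v == a ⟧ * q)) ≡ ∑ h + (p + q)
    at-uv h p q = trans (∑-+ h _) (cong (∑ h +_)
      (trans (∑-+ (λ a → ⟦ u == a ⟧ * p) _) (cong₂ _+_ (∑-δ u (λ _ → p)) (∑-δ v (λ _ → q)))))
    pointwise : ∀ a → f a + (⟦ u == a ⟧ * f v + ⟦ v == a ⟧ * g v)
                    ≤ g a + (⟦ u == a ⟧ * (g v + k) + ⟦ v == a ⟧ * f v)
    pointwise a with u Fin.≟ a | v Fin.≟ a
    ... | yes refl | yes v≡u = contradiction (sym v≡u) u≢v
    ... | yes refl | no _ = subst₂ _≤_ (l (f u) (f v)) (r (g u) (g v) k) on
      where l : ∀ x y → x + y ≡ x + (y + 0 + 0)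
            l = solve-∀
            r : ∀ x y z → x + y + z ≡ x + (y + z + 0 + 0)
            r = solve-∀
    ... | no _ | yes refl = ≤-reflexive (l (f v) (g v))
      where l : ∀ x y → x + (y + 0) ≡ y + (x + 0)
            l = solve-∀
    ... | no u≢a | no v≢a = +-monoˡ-≤ 0 (off a (u≢a ∘ sym) (v≢a ∘ sym))

  IsSymmetric Loopless : ∀ {n} → Graph n → Set
  IsSymmetric R   = ∀ {x y} → R x y ≡ true → R y x ≡ true
  Loopless R = ∀ {x y} → R x y ≡ true → x ≢ y

  -- A path along which `φ` never changes. Demanded for all pairs in a fibre of `φ`, it says that
  -- the fibre is connected in `R`.
  Joined : ∀ {n} {A : Set} → Graph n → (Fin n → A) → Fin n → Fin n → Set
  Joined R φ = Star (λ x y → R x y ≡ true × φ x ≡ φ y)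

  -- A minor model of the complete graph on `t` vertices. The colour classes are the branch sets and
  -- `nothing` marks the vertices outside all of them. `α` confines the model, so that one can be
  -- sought inside a neighbourhood.
  record CliqueModel {n} (R : Graph n) (α : Fin n → Bool) (t : ℕ) : Set where
    field
      colour   : Fin n → Maybe (Fin t)
      live     : ∀ {x c} → colour x ≡ just c → α x ≡ true
      nonempty : ∀ c → ∃ λ x → colour x ≡ just c
      joined   : ∀ {x y c} → colour x ≡ just c → colour y ≡ just c → Joined R colour x y
      edge     : ∀ {c d} → c ≢ d →
                 ∃₂ λ x y → colour x ≡ just c × colour y ≡ just d × R x y ≡ true

  enlarge : ∀ {n} {R : Graph n} {α β t} → (∀ {x} → α x ≡ true → β x ≡ true) →
            CliqueModel R α t → CliqueModel R β t
  enlarge α⊆β M = record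
    { colour = colour ; live = α⊆β ∘ live ; nonempty = nonempty ; joined = joined ; edge = edge }
    where open CliqueModel M

  subgraph : ∀ {n} {R S : Graph n} {α t} → (∀ {x y} → R x y ≡ true → S x y ≡ true) →
             CliqueModel R α t → CliqueModel S α t
  subgraph R⊆S M = record
    { colour = colour ; live = live ; nonempty = nonempty
    ; joined = λ p q → Star.map (map₁ R⊆S) (joined p q)
    ; edge = λ c≢d → let x , y , p , q , r = edge c≢d in x , y , p , q , R⊆S r }
    where open CliqueModel M

  module _ {m n} {G : Graph m} {R : Graph n} (ρ : Fin m → Fin n)
           (fibres : ∀ {x y} → ρ x ≡ ρ y → Joined G ρ x y)
           (lift : ∀ {a b} → R a b ≡ true → ∃₂ λ x y → ρ x ≡ a × ρ y ≡ b × G x y ≡ true) where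

    -- Each edge of the path is lifted to some edge of `G`; the gap between consecutive lifts lies
    -- in a fibre of `ρ` and is bridged there.
    lift-joined : ∀ {A : Set} (φ : Fin n → A) {a b} → Joined R φ a b →
                  ∀ {x y} → ρ x ≡ a → ρ y ≡ b → Joined G (φ ∘ ρ) x y
    lift-joined φ ε refl ρy≡a = Star.map (map₂ (cong φ)) (fibres (sym ρy≡a))
    lift-joined φ ((r , φa≡φb) ◅ path) refl ρy with lift r
    ... | x′ , z , ρx′ , refl , g =
      Star.map (map₂ (cong φ)) (fibres (sym ρx′)) ◅◅
      ((g , trans (cong φ ρx′) φa≡φb) ◅ lift-joined φ path refl ρy)

    pullback : ∀ {α t} → (∀ {a} → α a ≡ true → ∃ λ x → ρ x ≡ a) →
               CliqueModel R α t → CliqueModel G (α ∘ ρ) t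
    pullback inhabited M = record
      { colour   = colour ∘ ρ
      ; live     = live
      ; nonempty = λ c → let a , p = nonempty c
                             x , ρx≡a = inhabited (live p)
                         in x , trans (cong colour ρx≡a) p
      ; joined   = λ p q → lift-joined colour (joined p q) refl refl
      ; edge     = λ c≢d → let a , b , p , q , r = edge c≢d
                               x , y , ρx , ρy , g = lift r
                           in x , y , trans (cong colour ρx) p , trans (cong colour ρy) q , g
      }
      where open CliqueModel M

  -- Contraction of v into u on the unchanged vertex set: v becomes isolated.
  merge : ∀ {n} → Graph n → Fin n → Fin n → Graph n
  merge R u v a b = not (a == b) ∧ not (a == v) ∧ not (b == v) ∧
    (R a b ∨ (a == u ∧ R v b) ∨ (b == u ∧ R a v))

  module _ {n} (R : Graph n) (u v : Fin n) where

    merge-intro : ∀ {a b} → a ≢ b → a ≢ v → b ≢ v →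
      R a b ≡ true ⊎ (a ≡ u × R v b ≡ true) ⊎ (b ≡ u × R a v ≡ true) → merge R u v a b ≡ true
    merge-intro {a} {b} a≢b a≢v b≢v cases =
      ∧-intro (≢⇒not-== a≢b) (∧-intro (≢⇒not-== a≢v) (∧-intro (≢⇒not-== b≢v) (by cases)))
      where
      by : R a b ≡ true ⊎ (a ≡ u × R v b ≡ true) ⊎ (b ≡ u × R a v ≡ true) →
           R a b ∨ (a == u ∧ R v b) ∨ (b == u ∧ R a v) ≡ true
      by (inj₁ r) rewrite r = refl
      by (inj₂ (inj₁ (refl , r))) = ∨-introʳ (R u b) (∨-introˡ (∧-intro (==-refl u) r))
      by (inj₂ (inj₂ (refl , r))) =
        ∨-introʳ (R a u) (∨-introʳ (a == u ∧ R v u) (∧-intro (==-refl u) r))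

    merge-elim : ∀ {a b} → merge R u v a b ≡ true →
      a ≢ b × a ≢ v × b ≢ v × (R a b ≡ true ⊎ (a ≡ u × R v b ≡ true) ⊎ (b ≡ u × R a v ≡ true))
    merge-elim {a} {b} p with ∧-true {not (a == b)} p
    ... | a≢b , q with ∧-true {not (a == v)} q
    ... | a≢v , r with ∧-true {not (b == v)} r
    ... | b≢v , s = not-==⇒≢ a≢b , not-==⇒≢ a≢v , not-==⇒≢ b≢v , by (∨-true s)
      where
      by : R a b ≡ true ⊎ (a == u ∧ R v b) ∨ (b == u ∧ R a v) ≡ true →
           R a b ≡ true ⊎ (a ≡ u × R v b ≡ true) ⊎ (b ≡ u × R a v ≡ true)
      by (inj₁ x) = inj₁ x
      by (inj₂ y) with ∨-true {a == u ∧ R v b} y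
      ... | inj₁ z = inj₂ (inj₁ (map₁ ==⇒≡ (∧-true z)))
      ... | inj₂ z = inj₂ (inj₂ (map₁ ==⇒≡ (∧-true z)))

  common : ∀ {n} → Graph n → Fin n → Fin n → ℕ
  common R u v = ∑ (λ b → ⟦ R u b ∧ R v b ⟧)

  degree : ∀ {n} → Graph n → Fin n → ℕ
  degree R a = ∑ (λ b → ⟦ R a b ⟧)

  ⟦⟧-∨-∧ : ∀ {a b c} → (a ≡ true → c ≡ true) → (b ≡ true → c ≡ true) →
           ⟦ a ⟧ + ⟦ b ⟧ ≤ ⟦ c ⟧ + ⟦ a ∧ b ⟧
  ⟦⟧-∨-∧ {true}  {true}  a⇒c b⇒c rewrite a⇒c refl = ≤-refl
  ⟦⟧-∨-∧ {true}  {false} a⇒c b⇒c rewrite a⇒c refl = ≤-refl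
  ⟦⟧-∨-∧ {false} {true}  a⇒c b⇒c rewrite b⇒c refl = ≤-refl
  ⟦⟧-∨-∧ {false} {false} a⇒c b⇒c = z≤n

  -- Merging along an edge loses that edge and one edge per common neighbour.
  arcs-merge : ∀ {n} {R : Graph n} {u v} → IsSymmetric R → Loopless R → R u v ≡ true →
               arcs R ≤ arcs (merge R u v) + (2 + 2 * common R u v)
  arcs-merge {n} {R} {u} {v} sy ir uv = begin
    arcs R                                                          ≤⟨ ∑-≤-twoPoints
                                                                         (degree R) (λ a → degree R′ a + ⟦ R u a ∧ R v a ⟧)
                                                                         (2 + c) u≢v off on ⟩
    ∑ (λ a → degree R′ a + ⟦ R u a ∧ R v a ⟧) + (2 + c)             ≡⟨ cong (_+ (2 + c)) (∑-+ (degree R′) _) ⟩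
    arcs R′ + c + (2 + c)                                           ≡⟨ rearrange (arcs R′) c ⟩
    arcs R′ + (2 + 2 * c)                                           ∎
    where
    open ≤-Reasoning
    R′ = merge R u v
    c = common R u v
    u≢v = ir uv
    rearrange : ∀ x y → x + y + (2 + y) ≡ x + (2 + 2 * y)
    rearrange = solve-∀
    off : ∀ a → a ≢ u → a ≢ v → degree R a ≤ degree R′ a + ⟦ R u a ∧ R v a ⟧
    off a a≢u a≢v = ∑-≤-twoPoints _ _ _ u≢v
      (λ b b≢u b≢v → ⟦⟧-mono (λ r → merge-intro R u v (ir r) a≢v b≢v (inj₁ r)))
      (begin
        ⟦ R a u ⟧ + ⟦ R a v ⟧                                ≤⟨ ⟦⟧-∨-∧ {R a u} {R a v}
                                                                 (λ r → merge-intro R u v a≢u a≢v u≢v (inj₁ r))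
                                                                 (λ r → merge-intro R u v a≢u a≢v u≢v (inj₂ (inj₂ (refl , r)))) ⟩
        ⟦ R′ a u ⟧ + ⟦ R a u ∧ R a v ⟧                       ≤⟨ +-mono-≤ (m≤m+n _ ⟦ R′ a v ⟧)
                                                                 (⟦⟧-mono (λ p → let q , r = ∧-true {R a u} p in ∧-intro (sy q) (sy r))) ⟩
        ⟦ R′ a u ⟧ + ⟦ R′ a v ⟧ + ⟦ R u a ∧ R v a ⟧          ∎)
    -- The columns `u` and `v` are not compared. Without loops each of them contributes at most one,
    -- and together they account for the two orientations of the edge `uv`.
    row : ∀ b x → (u ≢ b → v ≢ b → ⟦ R u b ⟧ + ⟦ R v b ⟧ ≤ x + ⟦ R u b ∧ R v b ⟧) →
          ⟦ R u b ⟧ + ⟦ R v b ⟧ ≤ x + ⟦ R u b ∧ R v b ⟧ + (⟦ u == b ⟧ * 1 + ⟦ v == b ⟧ * 1)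
    row b x generic with u Fin.≟ b | v Fin.≟ b
    ... | yes refl | yes v≡u = contradiction (sym v≡u) u≢v
    ... | no u≢b | no v≢b = ≤-trans (generic u≢b v≢b) (m≤m+n _ 0)
    ... | yes refl | no _ with R u u in uu
    ...   | true  = contradiction refl (ir uu)
    ...   | false = ≤-trans (⟦⟧-≤1 (R v u)) (m≤n+m 1 _)
    row b x generic | no _ | yes refl with R v v in vv
    ...   | true  = contradiction refl (ir vv)
    ...   | false = ≤-trans (≤-reflexive (+-identityʳ _)) (≤-trans (⟦⟧-≤1 (R u v)) (m≤n+m 1 _))
    row-merged : ∀ b → u ≢ b → v ≢ b → ⟦ R u b ⟧ + ⟦ R v b ⟧ ≤ ⟦ R′ u b ⟧ + ⟦ R u b ∧ R v b ⟧
    row-merged b u≢b v≢b =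
      ⟦⟧-∨-∧ {R u b} {R v b} (λ r → merge-intro R u v u≢b u≢v (v≢b ∘ sym) (inj₁ r))
                             (λ r → merge-intro R u v u≢b u≢v (v≢b ∘ sym) (inj₂ (inj₁ (refl , r))))
    on : degree R u + degree R v
       ≤ degree R′ u + ⟦ R u u ∧ R v u ⟧ + (degree R′ v + ⟦ R u v ∧ R v v ⟧) + (2 + c)
    on = begin
      degree R u + degree R v                                                         ≡⟨ ∑-+ (λ b → ⟦ R u b ⟧) _ ⟨
      ∑ (λ b → ⟦ R u b ⟧ + ⟦ R v b ⟧)                                                 ≤⟨ ∑-mono (λ b → row b ⟦ R′ u b ⟧ (row-merged b)) ⟩
      ∑ (λ b → ⟦ R′ u b ⟧ + ⟦ R u b ∧ R v b ⟧ + (⟦ u == b ⟧ * 1 + ⟦ v == b ⟧ * 1))    ≡⟨ ∑-+ (λ b → ⟦ R′ u b ⟧ + ⟦ R u b ∧ R v b ⟧) _ ⟩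
      ∑ (λ b → ⟦ R′ u b ⟧ + ⟦ R u b ∧ R v b ⟧) + ∑ (λ b → ⟦ u == b ⟧ * 1 + ⟦ v == b ⟧ * 1)
        ≡⟨ cong₂ _+_ (∑-+ (λ b → ⟦ R′ u b ⟧) _)
             (trans (∑-+ (λ b → ⟦ u == b ⟧ * 1) _) (cong₂ _+_ (∑-δ u (λ _ → 1)) (∑-δ v (λ _ → 1)))) ⟩
      degree R′ u + c + 2                                                             ≤⟨ slack (degree R′ u) _ _ c ⟩
      degree R′ u + ⟦ R u u ∧ R v u ⟧ + (degree R′ v + ⟦ R u v ∧ R v v ⟧) + (2 + c)   ∎
      where
      slack : ∀ x y z c → x + c + 2 ≤ x + y + z + (2 + c)
      slack x y z c = subst₂ _≤_ (eq₁ x c) (eq₂ x y z c) (m≤m+n (x + (2 + c)) (y + z))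
        where eq₁ : ∀ x c → x + (2 + c) ≡ x + c + 2
              eq₁ = solve-∀
              eq₂ : ∀ x y z c → x + (2 + c) + (y + z) ≡ x + y + z + (2 + c)
              eq₂ = solve-∀

  -- In closed form `2 ^ (t + 1) - 2`, counted in arcs per vertex. The recursion is the loss of one
  -- merge whose ends have `density t` common neighbours.
  density : ℕ → ℕ
  density zero    = 0
  density (suc t) = 2 + 2 * density t

  -- `v` alone is the new branch set. As there are no loops, `v` is not among its own neighbours and
  -- so not in the given model.
  add-apex : ∀ {n} {R : Graph n} {t} (v : Fin n) → IsSymmetric R → Loopless R →
             CliqueModel R (R v) t → CliqueModel R (λ x → R v x ∨ (x == v)) (suc t)
  add-apex {n} {R} {t} v sy ir M = record
    { colour = colour′ ; live = live′ ; nonempty = nonempty′ ; joined = joined′ ; edge = edge′ }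
    where
    open CliqueModel M
    colour′ : Fin n → Maybe (Fin (suc t))
    colour′ x with x Fin.≟ v
    ... | yes _ = just zero
    ... | no _  = Maybe.map suc (colour x)
    v-colour : colour′ v ≡ just zero
    v-colour with v Fin.≟ v
    ... | yes _ = refl
    ... | no v≢v = contradiction refl v≢v
    lift-colour : ∀ {x c} → colour x ≡ just c → colour′ x ≡ just (suc c)
    lift-colour {x} p with x Fin.≟ v
    ... | yes refl = contradiction refl (ir (live p))
    ... | no _ rewrite p = refl
    lower-colour : ∀ {x c} → colour′ x ≡ just (suc c) → colour x ≡ just c
    lower-colour {x} p with x Fin.≟ v
    lower-colour {x} () | yes _
    lower-colour {x} p  | no _ with colour x
    lower-colour {x} refl | no _ | just _ = refl
    zero-colour : ∀ {x} → colour′ x ≡ just zero → x ≡ v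
    zero-colour {x} p with x Fin.≟ v
    ... | yes x≡v = x≡v
    ... | no _ with colour x
    zero-colour {x} () | no _ | just _
    zero-colour {x} () | no _ | nothing
    live′ : ∀ {x c} → colour′ x ≡ just c → R v x ∨ (x == v) ≡ true
    live′ {x} {zero}  p with refl ← zero-colour {x} p = ∨-introʳ (R v v) (==-refl v)
    live′ {x} {suc c} p rewrite live (lower-colour {x} p) = refl
    nonempty′ : ∀ c → ∃ λ x → colour′ x ≡ just c
    nonempty′ zero    = v , v-colour
    nonempty′ (suc c) = map₂ lift-colour (nonempty c)
    joined-lift : ∀ {x y c} → colour x ≡ just c → Joined R colour x y → Joined R colour′ x y
    joined-lift p ε = ε
    joined-lift p ((r , same) ◅ path) =
      (r , trans (lift-colour p) (sym (lift-colour (trans (sym same) p)))) ◅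
      joined-lift (trans (sym same) p) path
    joined′ : ∀ {x y c} → colour′ x ≡ just c → colour′ y ≡ just c → Joined R colour′ x y
    joined′ {x} {y} {zero}  p q with refl ← zero-colour {x} p | refl ← zero-colour {y} q = ε
    joined′ {x} {y} {suc c} p q =
      joined-lift (lower-colour {x} p) (joined (lower-colour {x} p) (lower-colour {y} q))
    edge′ : ∀ {c d} → c ≢ d → ∃₂ λ x y → colour′ x ≡ just c × colour′ y ≡ just d × R x y ≡ true
    edge′ {zero}  {zero}  c≢d = contradiction refl c≢d
    edge′ {zero}  {suc d} c≢d = let y , q = nonempty d in v , y , v-colour , lift-colour q , live q
    edge′ {suc c} {zero}  c≢d = let x , p = nonempty c in x , v , lift-colour p , v-colour , sy (live p)
    edge′ {suc c} {suc d} c≢d =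
      let x , y , p , q , r = edge (c≢d ∘ cong suc) in x , y , lift-colour p , lift-colour q , r

  -- Mader: contract edges with few common neighbours; when there are none left, every
  -- neighbourhood is dense and contains a smaller clique model by induction.
  Mader : ℕ → Set
  Mader t = ∀ {n} (R : Graph n) (α : Fin n → Bool) → IsSymmetric R → Loopless R →
            (∀ {x y} → R x y ≡ true → α x ≡ true) →
            density t * card α < arcs R → CliqueModel R α t

  mader-suc : ∀ t → Mader t → ∀ m {n} (R : Graph n) (α : Fin n → Bool) →
              IsSymmetric R → Loopless R → (∀ {x y} → R x y ≡ true → α x ≡ true) →
              card α ≤ m → density (suc t) * card α < arcs R → CliqueModel R α (suc t)
  mader-suc t smaller m {n} R α sy ir live small dense
    with Fin.any? (λ u → Fin.any? (λ v →
           (R u v Bool.≟ true) ×-dec (2 + 2 * common R u v ≤? density (suc t))))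
  -- `m` bounds the number of live vertices and makes the contractions terminate; at zero no edge
  -- can be left.
  mader-suc t smaller zero {n} R α sy ir live small dense | yes (u , v , uv , few) =
    contradiction (≤-trans (⟦⟧-true (live uv)) (≤-trans (∑-member (⟦_⟧ ∘ α) u) small)) λ ()
  mader-suc t smaller (suc m) {n} R α sy ir live small dense | yes (u , v , uv , few) =
    enlarge drop-live (pullback {R = R′} ρ fibres (λ {a} {b} → lift {a} {b}) inhabited
      (mader-suc t smaller m R′ α′ (λ {x} {y} → sy′ {x} {y}) (λ {x} {y} → ir′ {x} {y})
        (λ {x} {y} → live′ {x} {y}) (s≤s⁻¹ (≤-trans card-α small)) dense′))
    where
    R′ = merge R u v
    α′ : Fin n → Bool
    α′ x = α x ∧ not (x == v)
    u≢v = ir uv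
    ρ : Fin n → Fin n
    ρ x with x Fin.≟ v
    ... | yes _ = u
    ... | no _  = x
    ρv : ρ v ≡ u
    ρv with v Fin.≟ v
    ... | yes _ = refl
    ... | no v≢v = contradiction refl v≢v
    ρ-id : ∀ {x} → x ≢ v → ρ x ≡ x
    ρ-id {x} x≢v with x Fin.≟ v
    ... | yes x≡v = contradiction x≡v x≢v
    ... | no _ = refl
    fibres : ∀ {x y} → ρ x ≡ ρ y → Joined R ρ x y
    fibres {x} {y} eq with x Fin.≟ v | y Fin.≟ v
    ... | yes refl | yes refl = ε
    ... | yes refl | no y≢v rewrite sym eq = (sy uv , trans ρv (sym (ρ-id u≢v))) ◅ ε
    ... | no x≢v | yes refl rewrite eq = (uv , trans (ρ-id u≢v) (sym ρv)) ◅ ε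
    ... | no _ | no _ rewrite eq = ε
    lift : ∀ {a b} → R′ a b ≡ true → ∃₂ λ x y → ρ x ≡ a × ρ y ≡ b × R x y ≡ true
    lift {a} {b} r with merge-elim R u v r
    ... | _ , a≢v , b≢v , inj₁ ab = a , b , ρ-id a≢v , ρ-id b≢v , ab
    ... | _ , a≢v , b≢v , inj₂ (inj₁ (refl , vb)) = v , b , ρv , ρ-id b≢v , vb
    ... | _ , a≢v , b≢v , inj₂ (inj₂ (refl , av)) = a , v , ρ-id a≢v , ρv , av
    sy′ : IsSymmetric R′
    sy′ {a} {b} r with merge-elim R u v r
    ... | a≢b , a≢v , b≢v , cases = merge-intro R u v (a≢b ∘ sym) b≢v a≢v (flip-case {a} {b} cases)
      where
      flip-case : ∀ {a b} → R a b ≡ true ⊎ (a ≡ u × R v b ≡ true) ⊎ (b ≡ u × R a v ≡ true) →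
                  R b a ≡ true ⊎ (b ≡ u × R v a ≡ true) ⊎ (a ≡ u × R b v ≡ true)
      flip-case (inj₁ ab) = inj₁ (sy ab)
      flip-case (inj₂ (inj₁ (e , vb))) = inj₂ (inj₂ (e , sy vb))
      flip-case (inj₂ (inj₂ (e , av))) = inj₂ (inj₁ (e , sy av))
    ir′ : Loopless R′
    ir′ r = proj₁ (merge-elim R u v r)
    live′ : ∀ {x y} → R′ x y ≡ true → α′ x ≡ true
    live′ r with merge-elim R u v r
    ... | _ , a≢v , _ , inj₁ ab = ∧-intro (live ab) (≢⇒not-== a≢v)
    ... | _ , a≢v , _ , inj₂ (inj₁ (refl , _)) = ∧-intro (live uv) (≢⇒not-== a≢v)
    ... | _ , a≢v , _ , inj₂ (inj₂ (_ , av)) = ∧-intro (live av) (≢⇒not-== a≢v)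
    inhabited : ∀ {a} → α′ a ≡ true → ∃ λ x → ρ x ≡ a
    inhabited {a} p = a , ρ-id (not-==⇒≢ (proj₂ (∧-true {α a} p)))
    drop-live : ∀ {x} → α′ (ρ x) ≡ true → α x ≡ true
    drop-live {x} p with x Fin.≟ v
    ... | yes refl = live (sy uv)
    ... | no _ = proj₁ (∧-true p)
    card-α : suc (card α′) ≤ card α
    card-α = begin
      suc (card α′)                            ≡⟨ +-comm 1 (card α′) ⟩
      card α′ + 1                              ≡⟨ cong (card α′ +_) (∑-δ v (λ _ → 1)) ⟨
      card α′ + ∑ (λ x → ⟦ v == x ⟧ * 1)       ≡⟨ ∑-+ (⟦_⟧ ∘ α′) _ ⟨
      ∑ (λ x → ⟦ α′ x ⟧ + ⟦ v == x ⟧ * 1)      ≤⟨ ∑-mono pointwise ⟩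
      card α                                   ∎
      where
      open ≤-Reasoning
      pointwise : ∀ x → ⟦ α′ x ⟧ + ⟦ v == x ⟧ * 1 ≤ ⟦ α x ⟧
      pointwise x with v Fin.≟ x
      ... | yes refl rewrite live (sy uv) | ==-refl v = ≤-refl
      ... | no v≢x rewrite ≢⇒==-false (v≢x ∘ sym) with α x
      ...   | true  = ≤-refl
      ...   | false = ≤-refl
    -- The merge costs one live vertex and, by `few`, at most `density (suc t)` arcs, so the density
    -- bound is still exceeded.
    dense′ : density (suc t) * card α′ < arcs R′
    dense′ = +-cancelʳ-< d _ _ (begin-strict
      d * card α′ + d                          ≡⟨ trans (+-comm _ d) (sym (*-suc d (card α′))) ⟩
      d * suc (card α′)                        ≤⟨ *-monoʳ-≤ d card-α ⟩
      d * card α                               <⟨ dense ⟩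
      arcs R                                   ≤⟨ arcs-merge sy ir uv ⟩
      arcs R′ + (2 + 2 * common R u v)         ≤⟨ +-monoʳ-≤ (arcs R′) few ⟩
      arcs R′ + d                              ∎)
      where open ≤-Reasoning
            d = density (suc t)
  mader-suc t smaller m {n} R α sy ir live small dense | no none =
    enlarge (λ {x} → near {x}) (add-apex v sy ir (subgraph {R = N} (λ {x} {y} r → proj₁ (∧-true {R x y} r))
      (smaller N (R v) N-sy (λ {x} {y} r → ir (proj₁ (∧-true {R x y} r))) N-live N-dense)))
    where
    -- Any vertex with a neighbour serves as the apex; one exists because `dense` is strict.
    has-edge : ∃₂ λ v w → R v w ≡ true
    has-edge with ∑-pos (≤-<-trans z≤n dense)
    ... | v , p with ∑-pos p
    ... | w , q = v , w , ⟦⟧-pos _ q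
    v = proj₁ has-edge
    w = proj₁ (proj₂ has-edge)
    vw = proj₂ (proj₂ has-edge)
    N : Graph n
    N x y = R x y ∧ R v x ∧ R v y
    N-sy : IsSymmetric N
    N-sy {x} {y} r = let a , b = ∧-true {R x y} r ; c , d = ∧-true {R v x} b in ∧-intro (sy a) (∧-intro d c)
    N-live : ∀ {x y} → N x y ≡ true → R v x ≡ true
    N-live {x} {y} r = proj₁ (∧-true (proj₂ (∧-true {R x y} r)))
    near : ∀ {x} → R v x ∨ (x == v) ≡ true → α x ≡ true
    near {x} p with ∨-true {R v x} p
    ... | inj₁ vx = live (sy vx)
    ... | inj₂ x≡v with refl ← ==⇒≡ {i = x} x≡v = live vw
    -- As `few` fails at every edge, each edge at `v` has more than `density t` common neighbours.
    -- These counts are the degrees inside the neighbourhood of `v`.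
    many : ∀ {x} → R v x ≡ true → suc (density t) ≤ common R v x
    many {x} vx with suc (density t) ≤? common R v x
    ... | yes p = p
    ... | no ¬p = contradiction
      (v , x , vx , +-monoʳ-≤ 2 (*-monoʳ-≤ 2 (s≤s⁻¹ (≰⇒> ¬p)))) none
    row : ∀ x b → R v x ≡ b → suc (density t) * ⟦ b ⟧ ≤ degree N x
    row x false vx = subst (_≤ degree N x) (sym (*-zeroʳ (suc (density t)))) z≤n
    row x true  vx = begin
      suc (density t) * 1   ≡⟨ *-identityʳ _ ⟩
      suc (density t)       ≤⟨ many vx ⟩
      common R v x          ≤⟨ ∑-mono (λ y → ⟦⟧-mono (λ p → let vy , xy = ∧-true {R v y} p
                                                            in ∧-intro xy (∧-intro vx vy))) ⟩
      degree N x            ∎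
      where open ≤-Reasoning
    N-dense : density t * card (R v) < arcs N
    N-dense = begin-strict
      density t * card (R v)                        <⟨ +-monoˡ-< _ (≤-trans (⟦⟧-true vw) (∑-member (λ x → ⟦ R v x ⟧) w)) ⟩
      suc (density t) * card (R v)                  ≡⟨ ∑-*ˡ (suc (density t)) (λ x → ⟦ R v x ⟧) ⟨
      ∑ (λ x → suc (density t) * ⟦ R v x ⟧)         ≤⟨ ∑-mono (λ x → row x _ refl) ⟩
      arcs N                                        ∎
      where open ≤-Reasoning

  mader : ∀ t → Mader t
  mader zero R α sy ir live dense = record
    { colour = λ _ → nothing ; live = λ () ; nonempty = λ () ; joined = λ () ; edge = λ {} }
  mader (suc t) R α sy ir live dense =
    mader-suc t (mader t) (card α) R α sy ir live ≤-refl dense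

  -- From minor models to sequences of deletions and contractions

  record MinorModel {k n} (H : Graph k) (G : Graph n) : Set where
    field
      colour   : Fin n → Maybe (Fin k)
      nonempty : ∀ c → ∃ λ x → colour x ≡ just c
      joined   : ∀ {x y c} → colour x ≡ just c → colour y ≡ just c → Joined G colour x y
      edge     : ∀ {c d} → H c d ≡ true →
                 ∃₂ λ x y → colour x ≡ just c × colour y ≡ just d × G x y ≡ true

  delete-uncoloured : ∀ {k n} {H : Graph k} {G : Graph (suc n)} (M : MinorModel H G) v →
                      MinorModel.colour M v ≡ nothing → MinorModel H (deleteVertex G v)
  delete-uncoloured {n = n} {H} {G} M v v-nothing = record
    { colour = colour ∘ punchIn v
    ; nonempty = λ c → let x , p = nonempty c in punchOut (≢v p) , trans (cong colour (back p)) p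
    ; joined = λ p q → transport (joined p q) p refl refl
    ; edge = λ h → let x , y , p , q , g = edge h in
        punchOut (≢v p) , punchOut (≢v q) ,
        trans (cong colour (back p)) p , trans (cong colour (back q)) q ,
        trans (cong₂ G (back p) (back q)) g
    }
    where
    open MinorModel M
    ≢v : ∀ {x c} → colour x ≡ just c → v ≢ x
    ≢v p refl with trans (sym v-nothing) p
    ... | ()
    back : ∀ {x c} (p : colour x ≡ just c) → punchIn v (punchOut (≢v p)) ≡ x
    back p = Fin.punchIn-punchOut (≢v p)
    transport : ∀ {x y c a b} → Joined G colour x y → colour x ≡ just c →
                punchIn v a ≡ x → punchIn v b ≡ y →
                Joined (deleteVertex G v) (colour ∘ punchIn v) a b
    transport {a = a} {b} ε p refl eq with refl ← Fin.punchIn-injective v b a eq = ε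
    transport {c = c} ((g , same) ◅ path) p refl eq =
      (trans (cong (G _) (back z)) g , trans same (sym (cong colour (back z)))) ◅
      transport path z (back z) eq
      where z = trans (sym same) p

  module _ {k n} {H : Graph k} {G : Graph (suc n)} (irH : Loopless H) (irG : Loopless G)
           (M : MinorModel H G) {u v : Fin (suc n)} (uv : G u v ≡ true)
           (same-colour : MinorModel.colour M u ≡ MinorModel.colour M v) where
    open MinorModel M

    private
      v≢u : v ≢ u
      v≢u = irG uv ∘ sym

      -- `q` is the contraction map: it sends `v` where it sends `u`.
      q : Fin (suc n) → Fin n
      q x with v Fin.≟ x
      ... | yes _ = punchOut v≢u
      ... | no v≢x = punchOut v≢x

      colour-q : ∀ x → colour (punchIn v (q x)) ≡ colour x
      colour-q x with v Fin.≟ x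
      ... | yes refl = trans (cong colour (Fin.punchIn-punchOut v≢u)) same-colour
      ... | no v≢x = cong colour (Fin.punchIn-punchOut v≢x)

      q-punchIn : ∀ a → q (punchIn v a) ≡ a
      q-punchIn a with v Fin.≟ punchIn v a
      ... | yes v≡ = contradiction (sym v≡) (Fin.punchInᵢ≢i v a)
      ... | no v≢ = trans (Fin.punchOut-cong v refl) (Fin.punchOut-punchIn v)

      contract-edge : ∀ {x y} → G x y ≡ true → q x ≢ q y → contract G u v (q x) (q y) ≡ true
      contract-edge {x} {y} g qx≢qy = ∧-intro (≢⇒not-== qx≢qy) by
        where
        by : G (punchIn v (q x)) (punchIn v (q y))
             ∨ (punchIn v (q x) == u ∧ G v (punchIn v (q y)))
             ∨ (punchIn v (q y) == u ∧ G (punchIn v (q x)) v) ≡ true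
        by with v Fin.≟ x | v Fin.≟ y
        ... | yes refl | yes refl = contradiction refl (irG g)
        ... | yes refl | no v≢y
              rewrite Fin.punchIn-punchOut v≢u | Fin.punchIn-punchOut v≢y | ==-refl u =
          ∨-introʳ (G u y) (∨-introˡ g)
        ... | no v≢x | yes refl
              rewrite Fin.punchIn-punchOut v≢u | Fin.punchIn-punchOut v≢x | ==-refl u =
          ∨-introʳ (G x u) (∨-introʳ (x == u ∧ G v u) g)
        ... | no v≢x | no v≢y
              rewrite Fin.punchIn-punchOut v≢x | Fin.punchIn-punchOut v≢y = ∨-introˡ g

      transport : ∀ {x y} → Joined G colour x y →
                  Joined (contract G u v) (colour ∘ punchIn v) (q x) (q y)
      transport ε = ε
      transport {x} ((_◅_) {j = z} (g , same) path) with q x Fin.≟ q z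
      ... | yes eq rewrite eq = transport path
      ... | no qx≢qz =
        (contract-edge g qx≢qz , trans (colour-q x) (trans same (sym (colour-q z)))) ◅ transport path

    contract-monochromatic : MinorModel H (contract G u v)
    contract-monochromatic = record
      { colour = colour ∘ punchIn v
      ; nonempty = λ c → let x , p = nonempty c in q x , trans (colour-q x) p
      ; joined = λ {a} {b} p r →
          subst₂ (Joined _ _) (q-punchIn a) (q-punchIn b) (transport (joined p r))
      -- An edge of `H` joins two different colours and `q` respects colours, so the edge realising
      -- it is not contracted to a point.
      ; edge = λ {c} {d} h → let x , y , p , r , g = edge h in
          q x , q y , trans (colour-q x) p , trans (colour-q y) r ,
          contract-edge g (λ eq → irH h (Maybe.just-injective
            (trans (sym p) (trans (sym (colour-q x))
              (trans (cong (colour ∘ punchIn v) eq) (trans (colour-q y) r))))))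
      }

  contract-irreflexive : ∀ {n} (G : Graph (suc n)) u v → Loopless (contract G u v)
  contract-irreflexive G u v {a} {b} p = not-==⇒≢ (proj₁ (∧-true p))

  deleteEdges : ∀ {n} → List (Fin n × Fin n) → Graph n → Graph n
  deleteEdges []            G = G
  deleteEdges ((u , v) ∷ L) G = deleteEdges L (deleteEdge G u v)

  deleteEdges-minor : ∀ {k n} {H : Graph k} (L : List (Fin n × Fin n)) {G : Graph n} →
                      IsMinor H (deleteEdges L G) → IsMinor H G
  deleteEdges-minor []            m = m
  deleteEdges-minor ((u , v) ∷ L) m = delE u v (deleteEdges-minor L m)

  deleteEdges-sub : ∀ {n} (L : List (Fin n × Fin n)) {G : Graph n} {i j} →
                    deleteEdges L G i j ≡ true → G i j ≡ true
  deleteEdges-sub []            p = p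
  deleteEdges-sub ((u , v) ∷ L) p = proj₁ (∧-true (deleteEdges-sub L p))

  deleteEdges-∉ : ∀ {n} (L : List (Fin n × Fin n)) {G : Graph n} {i j} →
                  deleteEdges L G i j ≡ true → ¬ (i , j) ∈ L
  deleteEdges-∉ ((u , v) ∷ L) {G} {i} {j} p (here refl) =
    not-true (proj₂ (∧-true {G i j} (deleteEdges-sub L p)))
             (∨-introˡ (∧-intro (==-refl i) (==-refl j)))
  deleteEdges-∉ ((u , v) ∷ L) p (there e) = deleteEdges-∉ L p e

  deleteEdges-keep : ∀ {n} (L : List (Fin n × Fin n)) {G : Graph n} {i j} → G i j ≡ true →
                     ¬ (i , j) ∈ L → ¬ (j , i) ∈ L → deleteEdges L G i j ≡ true
  deleteEdges-keep [] g _ _ = g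
  deleteEdges-keep ((u , v) ∷ L) {G} {i} {j} g ij∉ ji∉ =
    deleteEdges-keep L (∧-intro g kept) (ij∉ ∘ there) (ji∉ ∘ there)
    where
    kept : not ((i == u ∧ j == v) ∨ (i == v ∧ j == u)) ≡ true
    kept with (i == u ∧ j == v) ∨ (i == v ∧ j == u) in eq
    ... | false = refl
    ... | true with ∨-true {i == u ∧ j == v} eq
    ...   | inj₁ e = let a , b = ∧-true {i == u} e
                     in contradiction (here (cong₂ _,_ (==⇒≡ a) (==⇒≡ b))) ij∉
    ...   | inj₂ e = let a , b = ∧-true {i == v} e
                     in contradiction (here (cong₂ _,_ (==⇒≡ b) (==⇒≡ a))) ji∉

  module _ {k n} {H : Graph k} {G : Graph n} (syH : IsSymmetric H) (M : MinorModel H G)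
           (all-coloured : ¬ ∃ λ x → MinorModel.colour M x ≡ nothing)
           (injective : ∀ {x y} → MinorModel.colour M x ≡ MinorModel.colour M y → x ≡ y) where
    open MinorModel M

    private
      coloured : ∀ x → ∃ λ c → colour x ≡ just c
      coloured x with colour x in eq
      ... | just c  = c , refl
      ... | nothing = contradiction (x , eq) all-coloured

      to : Fin n → Fin k
      to x = proj₁ (coloured x)

      surplus : Fin n × Fin n → Bool
      surplus (i , j) = not (H (to i) (to j))

      L : List (Fin n × Fin n)
      L = filterᵇ surplus (cartesianProduct (allFin n) (allFin n))

      ∉L : ∀ {i j} → H (to i) (to j) ≡ true → ¬ (i , j) ∈ L
      ∉L {i} {j} h e = go (proj₂ (∈-filter⁻ (λ p → Bool.T? (surplus p)) {xs = cartesianProduct (allFin n) (allFin n)} e))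
        where
        go : ¬ Bool.T (surplus (i , j))
        go rewrite h = λ ()

      ∈L : ∀ {i j} → H (to i) (to j) ≡ false → (i , j) ∈ L
      ∈L {i} {j} h = ∈-filter⁺ (λ p → Bool.T? (surplus p))
        (∈-cartesianProduct⁺ (∈-allFin i) (∈-allFin j)) go
        where
        go : Bool.T (surplus (i , j))
        go rewrite h = _

      preserves : ∀ i j → H (to i) (to j) ≡ deleteEdges L G i j
      preserves i j with H (to i) (to j) in h
      ... | true with edge h
      ...   | x , y , p , q , g
              with refl ← injective (trans p (sym (proj₂ (coloured i))))
                 | refl ← injective (trans q (sym (proj₂ (coloured j)))) =
        sym (deleteEdges-keep L g (∉L h) (∉L (syH h)))
      preserves i j | false with deleteEdges L G i j in eq
      ...   | false = refl
      ...   | true  = contradiction (∈L h) (deleteEdges-∉ L eq)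

    bijective-minor : IsMinor H G
    bijective-minor = deleteEdges-minor L (done (record
      { to = to
      ; from = proj₁ ∘ nonempty
      ; from∘to = λ i → injective (trans (proj₂ (nonempty (to i))) (sym (proj₂ (coloured i))))
      ; to∘from = λ c → Maybe.just-injective
          (trans (sym (proj₂ (coloured (proj₁ (nonempty c))))) (proj₂ (nonempty c)))
      ; preserves = preserves
      }))

  -- Induction on the number of vertices. Uncoloured vertices are deleted; if two vertices share a
  -- colour, the first edge of a path joining them in their class is contracted. Once the colouring
  -- is a bijection, only surplus edges remain to be deleted.
  minorModel⇒minor : ∀ {k} {H : Graph k} → IsSymmetric H → Loopless H →
                     ∀ {n} {G : Graph n} → Loopless G → MinorModel H G → IsMinor H G
  minorModel⇒minor syH irH {n} {G} irG M
    with Fin.any? (λ x → Maybe.≡-dec Fin._≟_ (MinorModel.colour M x) nothing)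
  minorModel⇒minor syH irH {suc n} {G} irG M | yes (v , p) =
    delV v (minorModel⇒minor syH irH (λ g eq → irG g (cong (punchIn v) eq)) (delete-uncoloured M v p))
  ... | no all-coloured
    with Fin.any? (λ x → Fin.any? (λ y →
           ¬? (x Fin.≟ y) ×-dec Maybe.≡-dec Fin._≟_ (MinorModel.colour M x) (MinorModel.colour M y)))
  minorModel⇒minor syH irH {n} {G} irG M | no all-coloured | no none =
    bijective-minor syH M all-coloured injective
    where
    injective : ∀ {x y} → MinorModel.colour M x ≡ MinorModel.colour M y → x ≡ y
    injective {x} {y} eq with x Fin.≟ y
    ... | yes x≡y = x≡y
    ... | no x≢y = contradiction (x , y , x≢y , eq) none
  minorModel⇒minor syH irH {suc n} {G} irG M | no all-coloured | yes (x , y , x≢y , eq)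
    with MinorModel.colour M x in cx
  ... | nothing = contradiction (x , cx) all-coloured
  ... | just c with MinorModel.joined M cx (sym eq)
  ...   | ε = contradiction refl x≢y
  ...   | (g , same) ◅ _ =
    contr x _ g (minorModel⇒minor syH irH (contract-irreflexive G x _)
      (contract-monochromatic irH irG M g same))

  cliqueModel⇒minor : ∀ {k n} {H : Graph k} {G : Graph n} {α} → IsSymmetric H → Loopless H →
                      Loopless G → CliqueModel G α k → IsMinor H G
  cliqueModel⇒minor syH irH irG M = minorModel⇒minor syH irH irG (record
    { colour = colour ; nonempty = nonempty ; joined = joined ; edge = edge ∘ irH })
    where open CliqueModel M

  -- Clustering by contraction along heavy pairs

  ∑∑-cong : ∀ {m n} {f g : Fin m → Fin n → ℕ} → (∀ x y → f x y ≡ g x y) →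
            ∑ (λ x → ∑ (f x)) ≡ ∑ (λ x → ∑ (g x))
  ∑∑-cong f≡g = ∑-cong (λ x → ∑-cong (f≡g x))

  ∑∑-mono : ∀ {m n} {f g : Fin m → Fin n → ℕ} → (∀ x y → f x y ≤ g x y) →
            ∑ (λ x → ∑ (f x)) ≤ ∑ (λ x → ∑ (g x))
  ∑∑-mono f≤g = ∑-mono (λ x → ∑-mono (f≤g x))

  ∑∑-+ : ∀ {m n} (f g : Fin m → Fin n → ℕ) →
         ∑ (λ x → ∑ (λ y → f x y + g x y)) ≡ ∑ (λ x → ∑ (f x)) + ∑ (λ x → ∑ (g x))
  ∑∑-+ f g = trans (∑-cong (λ x → ∑-+ (f x) (g x))) (∑-+ (∑ ∘ f) (∑ ∘ g))

  ∑∑-*ˡ : ∀ {m n} c (f : Fin m → Fin n → ℕ) →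
          ∑ (λ x → ∑ (λ y → c * f x y)) ≡ c * ∑ (λ x → ∑ (f x))
  ∑∑-*ˡ c f = trans (∑-cong (λ x → ∑-*ˡ c (f x))) (∑-*ˡ c (∑ ∘ f))

  ∑∑-pos : ∀ {m n} {f : Fin m → Fin n → ℕ} → 0 < ∑ (λ x → ∑ (f x)) → ∃₂ λ x y → 0 < f x y
  ∑∑-pos {f = f} p with ∑-pos p
  ... | x , q = x , ∑-pos q

  ∑∑-fibre : ∀ {m n} (ρ : Fin m → Fin n) (v : Fin m → Fin m → Fin n → Fin n → ℕ) →
    ∑ (λ A → ∑ (λ B → ∑ (λ x → ∑ (λ y → ⟦ ρ x == A ⟧ * (⟦ ρ y == B ⟧ * v x y A B)))))
    ≡ ∑ (λ x → ∑ (λ y → v x y (ρ x) (ρ y)))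
  ∑∑-fibre ρ v = begin
    ∑ (λ A → ∑ (λ B → ∑ (λ x → ∑ (λ y → ⟦ ρ x == A ⟧ * (⟦ ρ y == B ⟧ * v x y A B)))))
      ≡⟨ ∑∑-cong (λ A B → ∑-cong (λ x → ∑-*ˡ ⟦ ρ x == A ⟧ (λ y → ⟦ ρ y == B ⟧ * v x y A B))) ⟩
    ∑ (λ A → ∑ (λ B → ∑ (λ x → ⟦ ρ x == A ⟧ * ∑ (λ y → ⟦ ρ y == B ⟧ * v x y A B))))
      ≡⟨ ∑-swap _ ⟩
    ∑ (λ B → ∑ (λ A → ∑ (λ x → ⟦ ρ x == A ⟧ * ∑ (λ y → ⟦ ρ y == B ⟧ * v x y A B))))
      ≡⟨ ∑-cong (λ B → ∑-fibre ρ (λ x A → ∑ (λ y → ⟦ ρ y == B ⟧ * v x y A B))) ⟩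
    ∑ (λ B → ∑ (λ x → ∑ (λ y → ⟦ ρ y == B ⟧ * v x y (ρ x) B)))
      ≡⟨ ∑-swap _ ⟩
    ∑ (λ x → ∑ (λ B → ∑ (λ y → ⟦ ρ y == B ⟧ * v x y (ρ x) B)))
      ≡⟨ ∑-cong (λ x → ∑-fibre ρ (λ y B → v x y (ρ x) B)) ⟩
    ∑ (λ x → ∑ (λ y → v x y (ρ x) (ρ y))) ∎
    where open ≡-Reasoning

  layers : ∀ M a → a ≤ M → ∑ {M} (λ θ → ⟦ toℕ θ <ᵇ a ⟧) ≡ a
  layers M       zero    _         = ∑-zero {M} (λ _ → refl)
  layers (suc M) (suc a) (s≤s a≤M) = trans (∑-suc _) (cong suc (layers M a a≤M))

  -- Integrating the bound on the superlevel sets over all levels.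
  layer-cake : ∀ {n} D (w : Fin n → Fin n → ℕ) (m : Fin n → ℕ) → (∀ A B → w A B ≤ m A) →
    (∀ θ → arcs (λ A B → θ <ᵇ w A B) ≤ D * card (λ A → θ <ᵇ m A)) →
    ∑ (λ A → ∑ (w A)) ≤ D * ∑ m
  layer-cake D w m w≤m levels = begin
    ∑ (λ A → ∑ (w A))
      ≡⟨ ∑∑-cong (λ A B → sym (layers M (w A B) (≤-trans (w≤m A B) (∑-member m A)))) ⟩
    ∑ (λ A → ∑ (λ B → ∑ {M} (λ θ → ⟦ toℕ θ <ᵇ w A B ⟧)))
      ≡⟨ ∑-cong (λ A → ∑-swap (λ B (θ : Fin M) → ⟦ toℕ θ <ᵇ w A B ⟧)) ⟩
    ∑ (λ A → ∑ {M} (λ θ → ∑ (λ B → ⟦ toℕ θ <ᵇ w A B ⟧)))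
      ≡⟨ ∑-swap (λ A (θ : Fin M) → ∑ (λ B → ⟦ toℕ θ <ᵇ w A B ⟧)) ⟩
    ∑ {M} (λ θ → arcs (λ A B → toℕ θ <ᵇ w A B))
      ≤⟨ ∑-mono {M} (levels ∘ toℕ) ⟩
    ∑ {M} (λ θ → D * card (λ A → toℕ θ <ᵇ m A))
      ≡⟨ ∑-*ˡ {M} D _ ⟩
    D * ∑ {M} (λ θ → card (λ A → toℕ θ <ᵇ m A))
      ≡⟨ cong (D *_) (∑-swap {M} (λ θ A → ⟦ toℕ θ <ᵇ m A ⟧)) ⟩
    D * ∑ (λ A → ∑ {M} (λ θ → ⟦ toℕ θ <ᵇ m A ⟧))
      ≡⟨ cong (D *_) (∑-cong (λ A → layers M (m A) (∑-member m A))) ⟩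
    D * ∑ m ∎
    where open ≤-Reasoning
          M = ∑ m

  either-half : ∀ a b {t} → t ≡ a + b → t ≤ 2 * a ⊎ t ≤ 2 * b
  either-half a b refl with ≤-total b a
  ... | inj₁ b≤a = inj₁ (subst (a + b ≤_) (cong (a +_) (sym (+-identityʳ a))) (+-monoʳ-≤ a b≤a))
  ... | inj₂ a≤b = inj₂ (subst (a + b ≤_) (cong (b +_) (sym (+-identityʳ b))) (+-monoˡ-≤ b a≤b))

  -- Induction on the vertices: vertex `zero` is put on whichever side cuts at least half of the
  -- weight between it and the rest.
  maxcut : ∀ {n} (w : Fin n → Fin n → ℕ) → (∀ i → w i i ≡ 0) →
           ∃ λ (χ : Fin n → Bool) →
             ∑ (λ i → ∑ (w i)) ≤ 2 * ∑ (λ i → ∑ (λ j → ⟦ χ i xor χ j ⟧ * w i j))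
  maxcut {zero}  w w₀ = (λ ()) , ≤-trans (≤-reflexive (∑-empty _)) z≤n
  maxcut {suc n} w w₀ with maxcut (λ i j → w (suc i) (suc j)) (w₀ ∘ suc)
  ... | χ , IH = extend (either-half (toward true) (toward false) split)
    where
    new : Fin n → ℕ
    new j = w zero (suc j) + w (suc j) zero
    toward : Bool → ℕ
    toward b = ∑ (λ j → ⟦ b xor χ j ⟧ * new j)
    split : ∑ new ≡ toward true + toward false
    split = trans (∑-cong by) (∑-+ _ _)
      where
      by : ∀ j → new j ≡ ⟦ not (χ j) ⟧ * new j + ⟦ χ j ⟧ * new j
      by j with χ j
      ... | true  = sym (+-identityʳ _)
      ... | false = sym (trans (+-identityʳ _) (+-identityʳ _))
    χ′ : Bool → Fin (suc n) → Bool
    χ′ b zero    = b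
    χ′ b (suc i) = χ i
    total′ = ∑ (λ i → ∑ (λ j → w (suc i) (suc j)))
    cut′ = ∑ (λ i → ∑ (λ j → ⟦ χ i xor χ j ⟧ * w (suc i) (suc j)))
    xor-comm : ∀ a b → a xor b ≡ b xor a
    xor-comm true  true  = refl
    xor-comm true  false = refl
    xor-comm false true  = refl
    xor-comm false false = refl
    rearrange : ∀ a b c → a + (b + c) ≡ (a + b) + c
    rearrange = solve-∀
    total-eq : ∑ (λ i → ∑ (w i)) ≡ ∑ new + total′
    total-eq = begin
      ∑ (λ i → ∑ (w i))
        ≡⟨ trans (∑-suc _) (cong₂ _+_ (∑-suc (w zero)) (∑-cong (λ i → ∑-suc (w (suc i))))) ⟩
      w zero zero + ∑ (λ j → w zero (suc j)) + ∑ (λ i → w (suc i) zero + ∑ (λ j → w (suc i) (suc j)))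
        ≡⟨ cong₂ _+_ (cong (_+ ∑ (λ j → w zero (suc j))) (w₀ zero)) (∑-+ (λ i → w (suc i) zero) _) ⟩
      ∑ (λ j → w zero (suc j)) + (∑ (λ i → w (suc i) zero) + total′)
        ≡⟨ rearrange (∑ (λ j → w zero (suc j))) _ _ ⟩
      ∑ (λ j → w zero (suc j)) + ∑ (λ i → w (suc i) zero) + total′
        ≡⟨ cong (_+ total′) (∑-+ (λ j → w zero (suc j)) _) ⟨
      ∑ new + total′ ∎
      where open ≡-Reasoning
    cut-eq : ∀ b → toward b + cut′ ≤ ∑ (λ i → ∑ (λ j → ⟦ χ′ b i xor χ′ b j ⟧ * w i j))
    cut-eq b = begin
      toward b + cut′
        ≡⟨ cong (_+ cut′) (trans (∑-cong (λ j → *-distribˡ-+ ⟦ b xor χ j ⟧ (w zero (suc j)) (w (suc j) zero))) (∑-+ _ _)) ⟩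
      ∑ (λ j → ⟦ b xor χ j ⟧ * w zero (suc j)) + ∑ (λ j → ⟦ b xor χ j ⟧ * w (suc j) zero) + cut′
        ≡⟨ rearrange (∑ (λ j → ⟦ b xor χ j ⟧ * w zero (suc j))) _ _ ⟨
      ∑ (λ j → ⟦ b xor χ j ⟧ * w zero (suc j)) + (∑ (λ j → ⟦ b xor χ j ⟧ * w (suc j) zero) + cut′)
        ≡⟨ cong (λ s → ∑ (λ j → ⟦ b xor χ j ⟧ * w zero (suc j)) + (s + cut′))
             (∑-cong (λ j → cong (λ c → ⟦ c ⟧ * w (suc j) zero) (xor-comm b (χ j)))) ⟩
      ∑ (λ j → ⟦ b xor χ j ⟧ * w zero (suc j)) + (∑ (λ j → ⟦ χ j xor b ⟧ * w (suc j) zero) + cut′)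
        ≤⟨ +-mono-≤ (m≤n+m _ (⟦ b xor b ⟧ * w zero zero)) (≤-reflexive (sym (∑-+ _ _))) ⟩
      ⟦ b xor b ⟧ * w zero zero + ∑ (λ j → ⟦ b xor χ j ⟧ * w zero (suc j)) +
        ∑ (λ i → ⟦ χ i xor b ⟧ * w (suc i) zero + ∑ (λ j → ⟦ χ i xor χ j ⟧ * w (suc i) (suc j)))
        ≡⟨ trans (∑-suc _) (cong₂ _+_ (∑-suc _) (∑-cong (λ i → ∑-suc _))) ⟨
      ∑ (λ i → ∑ (λ j → ⟦ χ′ b i xor χ′ b j ⟧ * w i j)) ∎
      where open ≤-Reasoning
    finish : ∀ b → ∑ new ≤ 2 * toward b →
             ∑ (λ i → ∑ (w i)) ≤ 2 * ∑ (λ i → ∑ (λ j → ⟦ χ′ b i xor χ′ b j ⟧ * w i j))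
    finish b p = begin
      ∑ (λ i → ∑ (w i))            ≡⟨ total-eq ⟩
      ∑ new + total′               ≤⟨ +-mono-≤ p IH ⟩
      2 * toward b + 2 * cut′      ≡⟨ *-distribˡ-+ 2 (toward b) cut′ ⟨
      2 * (toward b + cut′)        ≤⟨ *-monoʳ-≤ 2 (cut-eq b) ⟩
      2 * ∑ (λ i → ∑ (λ j → ⟦ χ′ b i xor χ′ b j ⟧ * w i j)) ∎
      where open ≤-Reasoning
    extend : ∑ new ≤ 2 * toward true ⊎ ∑ new ≤ 2 * toward false →
             ∃ λ χ″ → ∑ (λ i → ∑ (w i)) ≤ 2 * ∑ (λ i → ∑ (λ j → ⟦ χ″ i xor χ″ j ⟧ * w i j))
    extend (inj₁ p) = χ′ true , finish true p
    extend (inj₂ p) = χ′ false , finish false p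

  opaque
    -- Of the two orientations of a cut that carries half of the weight, one carries half of that.
    directed-cut : ∀ {n} (w : Fin n → Fin n → ℕ) → (∀ i → w i i ≡ 0) →
                   ∃ λ (χ : Fin n → Bool) →
                     ∑ (λ i → ∑ (w i)) ≤ 4 * ∑ (λ i → ∑ (λ j → ⟦ χ i ∧ not (χ j) ⟧ * w i j))
    directed-cut {n} w w₀ with maxcut w w₀
    ... | χ , p = choose (either-half (from χ) (from (not ∘ χ)) split)
      where
      from : (Fin n → Bool) → ℕ
      from ψ = ∑ (λ i → ∑ (λ j → ⟦ ψ i ∧ not (ψ j) ⟧ * w i j))
      cut : ℕ
      cut = ∑ (λ i → ∑ (λ j → ⟦ χ i xor χ j ⟧ * w i j))
      split : cut ≡ from χ + from (not ∘ χ)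
      split = trans (∑∑-cong by) (∑∑-+ (λ i j → ⟦ χ i ∧ not (χ j) ⟧ * w i j) _)
        where
        by : ∀ i j → ⟦ χ i xor χ j ⟧ * w i j
                   ≡ ⟦ χ i ∧ not (χ j) ⟧ * w i j + ⟦ not (χ i) ∧ not (not (χ j)) ⟧ * w i j
        by i j with χ i | χ j
        ... | true  | true  = refl
        ... | true  | false = sym (+-identityʳ _)
        ... | false | true  = refl
        ... | false | false = refl
      four : ∀ x → 2 * (2 * x) ≡ 4 * x
      four = solve-∀
      choose : cut ≤ 2 * from χ ⊎ cut ≤ 2 * from (not ∘ χ) → ∃ λ ψ → ∑ (λ i → ∑ (w i)) ≤ 4 * from ψ
      choose (inj₁ q) = χ , ≤-trans p (≤-trans (*-monoʳ-≤ 2 q) (≤-reflexive (four (from χ))))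
      choose (inj₂ q) = not ∘ χ , ≤-trans p (≤-trans (*-monoʳ-≤ 2 q) (≤-reflexive (four (from (not ∘ χ)))))

  -- Sparsity of contractions

  ConnectedFibres : ∀ {m n} → Graph m → (Fin m → Fin n) → Set
  ConnectedFibres G ρ = ∀ {x y} → ρ x ≡ ρ y → Joined G ρ x y

  -- Every (possibly further thinned out) contraction of G has at most D arcs per vertex.
  HereditarilySparse : ∀ {m} → ℕ → Graph m → Set
  HereditarilySparse {m} D G =
    ∀ {n} (R : Graph n) (α : Fin n → Bool) (ρ : Fin m → Fin n) → ConnectedFibres G ρ →
    (∀ x y → R x y ≡ R y x) → Loopless R →
    (∀ {a b} → R a b ≡ true → ∃₂ λ x y → ρ x ≡ a × ρ y ≡ b × G x y ≡ true) →
    (∀ {a} → α a ≡ true → ∃ λ x → ρ x ≡ a) →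
    (∀ {a b} → R a b ≡ true → α a ≡ true) →
    arcs R ≤ D * card α

  simple⇒symmetric : ∀ {n} {G : Graph n} → Simple G → IsSymmetric G
  simple⇒symmetric (sy , _) {x} {y} r = trans (sy y x) r

  simple⇒irreflexive : ∀ {n} {G : Graph n} → Simple G → Loopless G
  simple⇒irreflexive (_ , ir) {x} r refl with trans (sym (ir x)) r
  ... | ()

  minorFree⇒sparse : ∀ {k n} {H : Graph k} {G : Graph n} → Simple H → Simple G → MinorFree H G →
                     HereditarilySparse (density k) G
  minorFree⇒sparse {k} simpleH simpleG free R α ρ fibres sy ir lift inhabited live =
    ≮⇒≥ λ dense → free (cliqueModel⇒minor (simple⇒symmetric simpleH) (simple⇒irreflexive simpleH)
      (simple⇒irreflexive simpleG)
      (pullback ρ fibres lift inhabited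
        (mader k R α (λ {x} {y} r → trans (sy y x) r) ir live dense)))

  -- Merging clusters along stars

  redirect : ∀ {m n} → (Fin n → Bool) → (Fin n → Fin n) → (Fin m → Fin n) → Fin m → Fin n
  redirect S f ρ x = if S (ρ x) then f (ρ x) else ρ x

  -- No arc is charged twice: `o` says that it crosses before the merge, `p` that it still does, and
  -- `q`, `s`, `r` together that it runs from a merged cluster to its target. The latter excludes
  -- `p`.
  at-most-once : ∀ p q s r o {g} → (p ≡ true → o ≡ true) →
                 (q ≡ true → s ≡ true → r ≡ true → o ≡ true × p ≡ false) →
                 ⟦ p ⟧ * g + ⟦ q ⟧ * (⟦ s ⟧ * (⟦ r ⟧ * g)) ≤ ⟦ o ⟧ * g
  at-most-once true  true  true  true  o p⇒o qsr⇒o with qsr⇒o refl refl refl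
  ... | _ , ()
  at-most-once false true  true  true  o {g} p⇒o qsr⇒o with qsr⇒o refl refl refl
  ... | refl , _ = ≤-reflexive (trans (+-identityʳ _) (+-identityʳ _))
  at-most-once p false s r o {g} p⇒o _ =
    subst (_≤ ⟦ o ⟧ * g) (sym (+-identityʳ _)) (*-monoˡ-≤ g (⟦⟧-mono p⇒o))
  at-most-once p true false r o {g} p⇒o _ =
    subst (_≤ ⟦ o ⟧ * g) (sym (+-identityʳ _)) (*-monoˡ-≤ g (⟦⟧-mono p⇒o))
  at-most-once p true true false o {g} p⇒o _ =
    subst (_≤ ⟦ o ⟧ * g) (sym (+-identityʳ _)) (*-monoˡ-≤ g (⟦⟧-mono p⇒o))

  module Clusters {n} (G : Graph (suc n)) (simpleG : Simple G) where
    V : Set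
    V = Fin (suc n)

    -- Clusters are the fibres of `ρ` and are named by vertices; a vertex that is no value of `ρ`
    -- names an empty cluster.
    link : (V → V) → V → V → ℕ
    link ρ A B = ∑ (λ x → ∑ (λ y → ⟦ ρ x == A ⟧ * (⟦ ρ y == B ⟧ * ⟦ G x y ⟧)))

    weight : (V → V) → V → V → ℕ
    weight ρ A B = ⟦ not (A == B) ⟧ * link ρ A B

    cross : (V → V) → ℕ
    cross ρ = ∑ (λ x → ∑ (λ y → ⟦ not (ρ x == ρ y) ⟧ * ⟦ G x y ⟧))

    link-sym : ∀ ρ A B → link ρ A B ≡ link ρ B A
    link-sym ρ A B = trans (∑-swap _) (∑∑-cong λ y x →
      trans (*-flip ⟦ ρ x == A ⟧ ⟦ ρ y == B ⟧ ⟦ G x y ⟧)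
            (cong (λ b → ⟦ ρ y == B ⟧ * (⟦ ρ x == A ⟧ * ⟦ b ⟧)) (proj₁ simpleG x y)))

    weight-sym : ∀ ρ A B → weight ρ A B ≡ weight ρ B A
    weight-sym ρ A B = cong₂ (λ b l → ⟦ not b ⟧ * l) (==-sym A B) (link-sym ρ A B)

    weight-diag : ∀ ρ A → weight ρ A A ≡ 0
    weight-diag ρ A rewrite ==-refl A = refl

    link-pos : ∀ {ρ A B} → 0 < link ρ A B → ∃₂ λ x y → ρ x ≡ A × ρ y ≡ B × G x y ≡ true
    link-pos {ρ} {A} {B} p with ∑∑-pos p
    ... | x , y , q with ⟦⟧*-pos (ρ x == A) q
    ... | xA , r with ⟦⟧*-pos (ρ y == B) r
    ... | yB , s = x , y , ==⇒≡ xA , ==⇒≡ yB , ⟦⟧-pos _ s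

    weight-pos : ∀ {ρ A B} → 0 < weight ρ A B → ∃₂ λ x y → ρ x ≡ A × ρ y ≡ B × G x y ≡ true
    weight-pos {ρ} {A} {B} p = link-pos (proj₂ (⟦⟧*-pos (not (A == B)) p))

    total-weight : ∀ ρ → ∑ (λ A → ∑ (weight ρ A)) ≡ cross ρ
    total-weight ρ = trans (∑∑-cong (λ A B →
        trans (sym (∑∑-*ˡ ⟦ not (A == B) ⟧ (λ x y → ⟦ ρ x == A ⟧ * (⟦ ρ y == B ⟧ * ⟦ G x y ⟧))))
              (∑∑-cong (λ x y → shift ⟦ not (A == B) ⟧ ⟦ ρ x == A ⟧ ⟦ ρ y == B ⟧ ⟦ G x y ⟧))))
      (∑∑-fibre ρ (λ x y A B → ⟦ not (A == B) ⟧ * ⟦ G x y ⟧))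
      where
      shift : ∀ a b c d → a * (b * (c * d)) ≡ b * (c * (a * d))
      shift = solve-∀

    module _ (S : V → Bool) (f : V → V) (ρ : V → V) (fibres : ConnectedFibres G ρ)
             (star : ∀ A → S A ≡ true → S (f A) ≡ false)
             (adjacent : ∀ A → S A ≡ true → 0 < weight ρ A (f A)) where
      private
        ρ′ : V → V
        ρ′ = redirect S f ρ

        kept : ∀ {x} → S (ρ x) ≡ false → ρ′ x ≡ ρ x
        kept p rewrite p = refl

        moved : ∀ {x} → S (ρ x) ≡ true → ρ′ x ≡ f (ρ x)
        moved p rewrite p = refl

        coarsen : ∀ {x y} → ρ x ≡ ρ y → Joined G ρ′ x y
        coarsen eq = Star.map (λ (g , e) → g , cong (λ A → if S A then f A else A) e) (fibres eq)

        centre : ∀ x → S (ρ′ x) ≡ false × ∃ λ z → ρ z ≡ ρ′ x × Joined G ρ′ x z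
        centre x = by (S (ρ x)) refl
          where
          by : ∀ b → S (ρ x) ≡ b → S (ρ′ x) ≡ false × ∃ λ z → ρ z ≡ ρ′ x × Joined G ρ′ x z
          by false p = subst (λ A → S A ≡ false) (sym (kept p)) p , x , sym (kept p) , ε
          by true  p with weight-pos {ρ} (adjacent (ρ x) p)
          ... | y , z , ρy , ρz , yz =
            subst (λ A → S A ≡ false) (sym (moved p)) (star (ρ x) p) , z , trans ρz (sym (moved p)) ,
            coarsen (sym ρy) ◅◅ ((yz , same) ◅ ε)
            where
            same : ρ′ y ≡ ρ′ z
            same = begin
              ρ′ y     ≡⟨ moved (trans (cong S ρy) p) ⟩
              f (ρ y)  ≡⟨ cong f ρy ⟩
              f (ρ x)  ≡⟨ ρz ⟨
              ρ z      ≡⟨ kept (trans (cong S ρz) (star (ρ x) p)) ⟨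
              ρ′ z     ∎
              where open ≡-Reasoning

      -- By `star` no target is itself redirected. So a new cluster is an old one with others
      -- attached directly to it, each by at least one edge, and every vertex is joined to the old
      -- cluster in the middle.
      redirect-connected : ConnectedFibres G ρ′
      redirect-connected {x} {y} eq with centre x | centre y
      ... | _ , a , ρa , xa | _ , b , ρb , yb =
        xa ◅◅ coarsen (trans ρa (trans eq (sym ρb))) ◅◅
        Star.reverse (λ (g , e) → simple⇒symmetric simpleG g , sym e) yb

      -- The arcs from a merged cluster to its target come to lie inside one cluster. More arcs
      -- vanish than are counted, for instance the opposite ones.
      redirect-gain : cross ρ′ + ∑ (λ A → ⟦ S A ⟧ * weight ρ A (f A)) ≤ cross ρ
      redirect-gain = begin
        cross ρ′ + ∑ (λ A → ⟦ S A ⟧ * weight ρ A (f A))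
          ≡⟨ cong (cross ρ′ +_) collected ⟩
        cross ρ′ + ∑ (λ x → ∑ (λ y → ⟦ ρ y == f (ρ x) ⟧ * (⟦ S (ρ x) ⟧ * (⟦ not (ρ x == f (ρ x)) ⟧ * ⟦ G x y ⟧))))
          ≡⟨ ∑∑-+ (λ x y → ⟦ not (ρ′ x == ρ′ y) ⟧ * ⟦ G x y ⟧) _ ⟨
        ∑ (λ x → ∑ (λ y → ⟦ not (ρ′ x == ρ′ y) ⟧ * ⟦ G x y ⟧ +
                          ⟦ ρ y == f (ρ x) ⟧ * (⟦ S (ρ x) ⟧ * (⟦ not (ρ x == f (ρ x)) ⟧ * ⟦ G x y ⟧))))
          ≤⟨ ∑∑-mono pointwise ⟩
        cross ρ ∎
        where
        open ≤-Reasoning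
        shift : ∀ s a b c d → s * (a * (b * (c * d))) ≡ b * (c * (s * (a * d)))
        shift = solve-∀
        collected : ∑ (λ A → ⟦ S A ⟧ * weight ρ A (f A))
                  ≡ ∑ (λ x → ∑ (λ y → ⟦ ρ y == f (ρ x) ⟧ * (⟦ S (ρ x) ⟧ * (⟦ not (ρ x == f (ρ x)) ⟧ * ⟦ G x y ⟧))))
        collected = trans (∑-cong (λ A →
            trans (cong (⟦ S A ⟧ *_) (sym (∑∑-*ˡ ⟦ not (A == f A) ⟧
                    (λ x y → ⟦ ρ x == A ⟧ * (⟦ ρ y == f A ⟧ * ⟦ G x y ⟧)))))
            (trans (sym (∑∑-*ˡ ⟦ S A ⟧
                    (λ x y → ⟦ not (A == f A) ⟧ * (⟦ ρ x == A ⟧ * (⟦ ρ y == f A ⟧ * ⟦ G x y ⟧)))))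
            (trans (∑∑-cong (λ x y → shift ⟦ S A ⟧ ⟦ not (A == f A) ⟧ ⟦ ρ x == A ⟧ ⟦ ρ y == f A ⟧ ⟦ G x y ⟧))
                   (∑-cong (λ x → ∑-*ˡ ⟦ ρ x == A ⟧
                    (λ y → ⟦ ρ y == f A ⟧ * (⟦ S A ⟧ * (⟦ not (A == f A) ⟧ * ⟦ G x y ⟧)))))))))
          (∑-fibre ρ (λ x A → ∑ (λ y → ⟦ ρ y == f A ⟧ * (⟦ S A ⟧ * (⟦ not (A == f A) ⟧ * ⟦ G x y ⟧)))))
        pointwise : ∀ x y → ⟦ not (ρ′ x == ρ′ y) ⟧ * ⟦ G x y ⟧ +
                      ⟦ ρ y == f (ρ x) ⟧ * (⟦ S (ρ x) ⟧ * (⟦ not (ρ x == f (ρ x)) ⟧ * ⟦ G x y ⟧))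
                    ≤ ⟦ not (ρ x == ρ y) ⟧ * ⟦ G x y ⟧
        pointwise x y = at-most-once
          (not (ρ′ x == ρ′ y)) (ρ y == f (ρ x)) (S (ρ x)) (not (ρ x == f (ρ x))) _
          (λ p → ≢⇒not-== λ e → not-==⇒≢ p (cong (λ A → if S A then f A else A) e))
          (λ q s r → ≢⇒not-== (λ e → not-==⇒≢ r (trans e (==⇒≡ q))) , cong not (merged q s))
          where
          merged : (ρ y == f (ρ x)) ≡ true → S (ρ x) ≡ true → (ρ′ x == ρ′ y) ≡ true
          merged q s = subst (λ A → (ρ′ x == A) ≡ true) same (==-refl (ρ′ x))
            where
            same : ρ′ x ≡ ρ′ y
            same = trans (moved s) (trans (sym (==⇒≡ q))
                     (sym (kept (trans (cong S (==⇒≡ q)) (star (ρ x) s)))))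

    heavy : ℕ → (V → ℕ) → V → Bool
    heavy K m A = (0 <ᵇ m A) ∧ (degree G A ≤ᵇ K * m A)

    heavy-sound : ∀ K m {A} → heavy K m A ≡ true → 0 < m A × degree G A ≤ K * m A
    heavy-sound K m {A} p with ∧-true p
    ... | q , r = <ᵇ⇒< 0 (m A) (subst T (sym q) _) , ≤ᵇ⇒≤ _ _ (subst T (sym r) _)

    -- If `A` is not heavy, then `K * m A` is at most the degree of the vertex `A`, and these
    -- degrees sum to at most `arcs G`.
    heavy-part : ∀ K m → K * ∑ m ≤ K * ∑ (λ A → ⟦ heavy K m A ⟧ * m A) + arcs G
    heavy-part K m = begin
      K * ∑ m
        ≡⟨ ∑-*ˡ K m ⟨
      ∑ (λ A → K * m A)
        ≤⟨ ∑-mono pointwise ⟩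
      ∑ (λ A → K * (⟦ heavy K m A ⟧ * m A) + degree G A)
        ≡⟨ ∑-+ (λ A → K * (⟦ heavy K m A ⟧ * m A)) (degree G) ⟩
      ∑ (λ A → K * (⟦ heavy K m A ⟧ * m A)) + arcs G
        ≡⟨ cong (_+ arcs G) (∑-*ˡ K (λ A → ⟦ heavy K m A ⟧ * m A)) ⟩
      K * ∑ (λ A → ⟦ heavy K m A ⟧ * m A) + arcs G ∎
      where
      open ≤-Reasoning
      pointwise : ∀ A → K * m A ≤ K * (⟦ heavy K m A ⟧ * m A) + degree G A
      pointwise A with m A
      ... | zero rewrite *-zeroʳ K = z≤n
      ... | suc a with degree G A ≤ᵇ K * suc a in eq
      ...   | true = ≤-trans (≤-reflexive (cong (K *_) (sym (*-identityˡ (suc a))))) (m≤m+n _ _)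
      ...   | false = ≤-trans (<⇒≤ (≰⇒> λ p → subst T eq (≤⇒≤ᵇ p))) (m≤n+m _ (K * 0))

    sparse-subgraph : ∀ D → HereditarilySparse D G → (R : Graph (suc n)) (α : V → Bool) →
      (∀ x y → R x y ≡ R y x) → (∀ {x y} → R x y ≡ true → G x y ≡ true) →
      (∀ {x y} → R x y ≡ true → α x ≡ true) → arcs R ≤ D * card α
    sparse-subgraph D sparse R α sy R⊆G live = sparse R α (λ x → x) (λ { refl → ε }) sy
      (λ r → simple⇒irreflexive simpleG (R⊆G r)) (λ {a} {b} r → a , b , refl , refl , R⊆G r)
      (λ {a} _ → a , refl) live

    arcs≤ : ∀ D → HereditarilySparse D G → arcs G ≤ D * suc n
    arcs≤ D sparse = subst (λ c → arcs G ≤ D * c) (trans (∑-const (suc n) 1) (*-identityʳ (suc n)))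
      (sparse-subgraph D sparse G (λ _ → true) (proj₁ simpleG) (λ r → r) (λ _ → refl))

    -- One round of merging

    module Round {D E : ℕ} (sparse : HereditarilySparse D G) (0<D : 0 < D)
                 (ρ : V → V) (fibres : ConnectedFibres G ρ) where

      favourite : V → V
      favourite A = proj₁ (argmax (weight ρ A))

      m : V → ℕ
      m A = weight ρ A (favourite A)

      weight≤m : ∀ A B → weight ρ A B ≤ m A
      weight≤m A = proj₂ (argmax (weight ρ A))

      -- At every level the pairs of larger weight form a thinned out contraction of `G`. It lives
      -- on the clusters whose favourite exceeds the level, so sparsity bounds its arcs by their
      -- number.
      cross≤m : cross ρ ≤ D * ∑ m
      cross≤m = subst (_≤ D * ∑ m) (total-weight ρ) (layer-cake D (weight ρ) m weight≤m levels)
        where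
        <ᵇ-true : ∀ {a b} → (a <ᵇ b) ≡ true → a < b
        <ᵇ-true {a} p = <ᵇ⇒< a _ (subst T (sym p) _)
        true-<ᵇ : ∀ {a b} → a < b → (a <ᵇ b) ≡ true
        true-<ᵇ {a} {b} p with a <ᵇ b | <⇒<ᵇ p
        ... | true | _ = refl
        levels : ∀ θ → arcs (λ A B → θ <ᵇ weight ρ A B) ≤ D * card (λ A → θ <ᵇ m A)
        levels θ = sparse (λ A B → θ <ᵇ weight ρ A B) (λ A → θ <ᵇ m A) ρ fibres
          (λ A B → cong (θ <ᵇ_) (weight-sym ρ A B))
          (λ { {A} r refl → n≮0 (subst (θ <_) (weight-diag ρ A) (<ᵇ-true r)) })
          (λ {A} {B} r → weight-pos {ρ} (≤-<-trans z≤n (<ᵇ-true {θ} {weight ρ A B} r)))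
          (λ {A} r → let x , _ , ρx , _ = weight-pos {ρ} (≤-<-trans z≤n (<ᵇ-true {θ} {m A} r)) in x , ρx)
          (λ {A} {B} r → true-<ᵇ (<-≤-trans (<ᵇ-true {θ} {weight ρ A B} r) (weight≤m A B)))

      -- Light favourites then carry in total at most arcs G / K, hence at most half of the lower
      -- bound cross ρ / D for the weight of all favourites, provided n ≤ E · cross ρ.
      K : ℕ
      K = 2 * (E * (D * D))

      -- The heavy favourites as a weight on ordered pairs, so that `directed-cut` selects clusters
      -- on one side whose favourites lie on the other.
      bid : V → V → ℕ
      bid A B = ⟦ favourite A == B ⟧ * (⟦ heavy K m A ⟧ * m A)

      bid-diag : ∀ A → bid A A ≡ 0
      bid-diag A with favourite A Fin.≟ A
      ... | no _ = refl
      ... | yes eq = trans (+-identityʳ _) (trans (cong (λ B → ⟦ heavy K m A ⟧ * weight ρ A B) eq)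
                       (trans (cong (⟦ heavy K m A ⟧ *_) (weight-diag ρ A)) (*-zeroʳ ⟦ heavy K m A ⟧)))

      χ : V → Bool
      χ = proj₁ (directed-cut bid bid-diag)

      opaque
        S : V → Bool
        S A = heavy K m A ∧ (χ A ∧ not (χ (favourite A)))

        S-def : ∀ A → S A ≡ heavy K m A ∧ (χ A ∧ not (χ (favourite A)))
        S-def A = refl

      S-star : ∀ A → S A ≡ true → S (favourite A) ≡ false
      S-star A p = trans (S-def (favourite A)) (trans (cong (λ b → heavy K m (favourite A) ∧ (b ∧ not (χ (favourite (favourite A)))))
          (not-true⇒false (proj₂ (∧-true {χ A} (proj₂ (∧-true {heavy K m A} (trans (sym (S-def A)) p)))))))
          (Bool.∧-zeroʳ (heavy K m (favourite A))))
        where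
        not-true⇒false : ∀ {b} → not b ≡ true → b ≡ false
        not-true⇒false {false} _ = refl

      S-heavy : ∀ A → S A ≡ true → 0 < m A × degree G A ≤ K * m A
      S-heavy A p = heavy-sound K m (proj₁ (∧-true {heavy K m A} (trans (sym (S-def A)) p)))

      heavy-total : ∑ (λ A → ⟦ heavy K m A ⟧ * m A) ≤ 4 * ∑ (λ A → ⟦ S A ⟧ * m A)
      heavy-total = begin
        ∑ (λ A → ⟦ heavy K m A ⟧ * m A)
          ≡⟨ ∑-cong (λ A → ∑-δ (favourite A) (λ _ → ⟦ heavy K m A ⟧ * m A)) ⟨
        ∑ (λ A → ∑ (bid A))
          ≤⟨ proj₂ (directed-cut bid bid-diag) ⟩
        4 * ∑ (λ A → ∑ (λ B → ⟦ χ A ∧ not (χ B) ⟧ * bid A B))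
          ≡⟨ cong (4 *_) (∑-cong (λ A → trans
               (∑-cong (λ B → *-flip ⟦ χ A ∧ not (χ B) ⟧ ⟦ favourite A == B ⟧ _))
               (∑-δ (favourite A) (λ B → ⟦ χ A ∧ not (χ B) ⟧ * (⟦ heavy K m A ⟧ * m A))))) ⟩
        4 * ∑ (λ A → ⟦ χ A ∧ not (χ (favourite A)) ⟧ * (⟦ heavy K m A ⟧ * m A))
          ≡⟨ cong (4 *_) (∑-cong (λ A → trans
               (*-flip ⟦ χ A ∧ not (χ (favourite A)) ⟧ ⟦ heavy K m A ⟧ (m A))
               (trans (sym (*-assoc ⟦ heavy K m A ⟧ _ (m A)))
                      (cong (_* m A) (trans (sym (⟦∧⟧ (heavy K m A) _)) (cong ⟦_⟧ (sym (S-def A)))))))) ⟩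
        4 * ∑ (λ A → ⟦ S A ⟧ * m A) ∎
        where
        open ≤-Reasoning

      gain : ℕ
      gain = ∑ (λ A → ⟦ S A ⟧ * m A)

      cross≤gain : suc n ≤ E * cross ρ → cross ρ ≤ 8 * D * gain
      -- The light clusters cost at most `D * D * E * cross ρ`, which is half of `K * cross ρ`;
      -- hence the doubling before the cancellation.
      cross≤gain many = *-cancelˡ-≤ K ⦃ >-nonZero 0<K ⦄ (+-cancelʳ-≤ (K * cross ρ) _ _ (begin
        K * cross ρ + K * cross ρ
          ≡⟨ double K (cross ρ) ⟩
        2 * (K * cross ρ)
          ≤⟨ *-monoʳ-≤ 2 (begin
               K * cross ρ                                              ≤⟨ *-monoʳ-≤ K cross≤m ⟩
               K * (D * ∑ m)                                            ≡⟨ *-flip K D (∑ m) ⟩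
               D * (K * ∑ m)                                            ≤⟨ *-monoʳ-≤ D (heavy-part K m) ⟩
               D * (K * ∑ (λ A → ⟦ heavy K m A ⟧ * m A) + arcs G)           ≤⟨ *-monoʳ-≤ D (+-mono-≤ (*-monoʳ-≤ K heavy-total) (arcs≤ D sparse)) ⟩
               D * (K * (4 * gain) + D * suc n)                         ≤⟨ *-monoʳ-≤ D (+-monoʳ-≤ (K * (4 * gain)) (*-monoʳ-≤ D many)) ⟩
               D * (K * (4 * gain) + D * (E * cross ρ))                 ∎) ⟩
        2 * (D * (K * (4 * gain) + D * (E * cross ρ)))
          ≡⟨ collect K D gain E (cross ρ) ⟩
        K * (8 * D * gain) + 2 * (E * (D * D)) * cross ρ ∎))
        where
        open ≤-Reasoning
        double : ∀ k c → k * c + k * c ≡ 2 * (k * c)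
        double = solve-∀
        collect : ∀ k d g e c → 2 * (d * (k * (4 * g) + d * (e * c))) ≡ k * (8 * d * g) + 2 * (e * (d * d)) * c
        collect = solve-∀
        0<E : 0 < E
        0<E = n≢0⇒n>0 λ { refl → n≮0 many }
        0<K : 0 < K
        0<K = *-mono-< {0} {2} z<s (*-mono-< 0<E (*-mono-< 0<D 0<D))

      -- The potential `8 * D * E * cross` falls by at least the number of vertices, which bounds
      -- the number of rounds.
      progress : suc n ≤ E * cross ρ →
                 suc n + 8 * D * E * cross (redirect S favourite ρ) ≤ 8 * D * E * cross ρ
      progress many = begin
        suc n + P * cross ρ′        ≤⟨ +-monoˡ-≤ _ (≤-trans many (*-monoʳ-≤ E (cross≤gain many))) ⟩
        E * (8 * D * gain) + P * cross ρ′ ≡⟨ collect E D gain (cross ρ′) ⟩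
        P * (cross ρ′ + gain)       ≤⟨ *-monoʳ-≤ P (redirect-gain S favourite ρ fibres S-star (λ A → proj₁ ∘ S-heavy A)) ⟩
        P * cross ρ                 ∎
        where
        open ≤-Reasoning
        P = 8 * D * E
        ρ′ = redirect S favourite ρ
        collect : ∀ e d g c → e * (8 * d * g) + 8 * d * e * c ≡ 8 * d * e * (c + g)
        collect = solve-∀

  -- Odd closed walks and odd cycles

  any-intro : ∀ {A : Set} {p : A → Bool} {x xs} → x ∈ xs → p x ≡ true → any p xs ≡ true
  any-intro (here refl) px = ∨-introˡ px
  any-intro {p = p} {xs = y ∷ _} (there x∈xs) px = ∨-introʳ (p y) (any-intro x∈xs px)

  any-elim : ∀ {A : Set} {p : A → Bool} xs → any p xs ≡ true → ∃ λ x → p x ≡ true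
  any-elim {p = p} (x ∷ xs) eq with ∨-true {p x} eq
  ... | inj₁ px   = x , px
  ... | inj₂ rest = any-elim xs rest

  infixr 5 _∷_

  -- The list holds the starting points of the successive steps.
  data Path {n} (E : EdgeList n) : Fin n → List (Fin n) → Fin n → Set where
    []  : ∀ {x} → Path E x [] x
    _∷_ : ∀ {x y z xs} → inE E x y ≡ true → Path E y xs z → Path E x (x ∷ xs) z

  odd-+ : ∀ a b → odd (a + b) ≡ odd a xor odd b
  odd-+ zero    b = refl
  odd-+ (suc a) b = trans (cong not (odd-+ a b)) (not-xor (odd a) (odd b))
    where
    not-xor : ∀ p q → not (p xor q) ≡ (not p xor q)
    not-xor true  q = not-involutive q
    not-xor false q = refl

  odd-split : ∀ a b c → odd (a + (b + c)) ≡ true → odd b ≡ true ⊎ odd (a + c) ≡ true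
  odd-split a b c p rewrite odd-+ a (b + c) | odd-+ b c | odd-+ a c with odd b
  ... | true  = inj₁ refl
  ... | false = inj₂ p

  module _ {n} {E : EdgeList n} where

    _+++_ : ∀ {x y z xs ys} → Path E x xs y → Path E y ys z → Path E x (xs ++ ys) z
    []      +++ q = q
    (e ∷ p) +++ q = e ∷ (p +++ q)

    split-at : ∀ x {y z zs} → Path E z zs y → All (x ≢_) zs ⊎
               ∃₂ λ as bs → Path E z as x × Path E x (x ∷ bs) y × length zs ≡ length as + suc (length bs)
    split-at x [] = inj₁ []
    split-at x {z = z} (e ∷ p) with x Fin.≟ z
    ... | yes refl = inj₂ ([] , _ , [] , e ∷ p , refl)
    ... | no x≢z with split-at x p
    ...   | inj₁ x∉ = inj₁ (x≢z ∷ x∉)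
    ...   | inj₂ (as , bs , pa , pb , eq) = inj₂ (z ∷ as , bs , e ∷ pa , pb , cong suc eq)

    -- Either no vertex is left twice, or the path splits at a repeated `z` into a closed part `bs`
    -- and the rest `as`, `cs`. That `bs` and `cs` are non-empty makes both pieces strictly shorter.
    loop-erasure : ∀ {x y xs} → Path E x xs y → Unique xs ⊎
      ∃ λ z → ∃ λ as → ∃ λ bs → ∃ λ cs → Path E x as z × Path E z bs z × Path E z cs y ×
      length xs ≡ length as + (length bs + length cs) × 0 < length bs × 0 < length cs
    loop-erasure [] = inj₁ []
    loop-erasure {x} (_∷_ {xs = zs} e p) with split-at x p
    ... | inj₂ (as , bs , pa , pb , eq) =
      inj₂ (x , [] , x ∷ as , x ∷ bs , [] , e ∷ pa , pb , cong suc eq , z<s , z<s)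
    ... | inj₁ x∉ with loop-erasure p
    ...   | inj₁ unique = inj₁ (x∉ ∷ unique)
    ...   | inj₂ (z , as , bs , cs , pa , pb , pc , eq , b , c) =
      inj₂ (z , x ∷ as , bs , cs , e ∷ pa , pb , pc , cong suc eq , b , c)

    -- When an odd closed walk is split at a repetition, the loop cut out or the closed walk that
    -- remains is odd again. `m` bounds the length for the induction.
    simple-odd : ∀ m {x xs} → length xs ≤ m → Path E x xs x → odd (length xs) ≡ true →
                 ∃₂ λ y ys → Path E y ys y × Unique ys × odd (length ys) ≡ true
    simple-odd zero {xs = []} _ p ()
    simple-odd (suc m) {x} {xs} short p od with loop-erasure p
    ... | inj₁ unique = x , xs , p , unique , od
    ... | inj₂ (z , as , bs , cs , pa , pb , pc , eq , 0<b , 0<c)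
          with odd-split (length as) (length bs) (length cs) (trans (cong odd (sym eq)) od)
    ...   | inj₁ odd-b = simple-odd m (s≤s⁻¹ (begin
              suc (length bs)                          ≡⟨ +-comm 1 (length bs) ⟩
              length bs + 1                            ≤⟨ +-monoʳ-≤ (length bs) 0<c ⟩
              length bs + length cs                    ≤⟨ m≤n+m _ (length as) ⟩
              length as + (length bs + length cs)      ≡⟨ eq ⟨
              length xs                                ≤⟨ short ⟩
              suc m                                    ∎)) pb odd-b
            where open ≤-Reasoning
    ...   | inj₂ odd-ac = simple-odd m (s≤s⁻¹ (begin
              suc (length (as ++ cs))                  ≡⟨ cong suc (length-++ as) ⟩
              suc (length as + length cs)              ≡⟨ +-suc (length as) (length cs) ⟨
              length as + suc (length cs)              ≤⟨ +-monoʳ-≤ (length as) (+-monoˡ-≤ (length cs) 0<b) ⟩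
              length as + (length bs + length cs)      ≡⟨ eq ⟨
              length xs                                ≤⟨ short ⟩
              suc m                                    ∎)) (pa +++ pc)
                (trans (cong odd (length-++ as)) odd-ac)
            where open ≤-Reasoning

    path-edges : ∀ {x y xs} → Path E x (x ∷ xs) y →
                 pathEdges E x (Vec.fromList xs) ∧ inE E (lastV x (Vec.fromList xs)) y ≡ true
    path-edges (e ∷ []) = e
    path-edges {xs = z ∷ zs} (e ∷ p@(_ ∷ _)) rewrite e = path-edges p

    all-distinct : ∀ {x : Fin n} {xs} → All (x ≢_) xs →
                   all (λ y → not (x == y)) (Vec.toList (Vec.fromList xs)) ≡ true
    all-distinct [] = refl
    all-distinct (x≢y ∷ rest) = ∧-intro (≢⇒not-== x≢y) (all-distinct rest)

    distinct : ∀ {xs : List (Fin n)} → Unique xs → distinctV (Vec.fromList xs) ≡ true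
    distinct [] = refl
    distinct (x∉ ∷ unique) = ∧-intro (all-distinct x∉) (distinct unique)

    unique-lookup : ∀ {xs : List (Fin n)} → Unique xs → ∀ {i j} →
                    List.lookup xs i ≡ List.lookup xs j → i ≡ j
    unique-lookup (x∉ ∷ u) {zero}  {zero}  eq = refl
    unique-lookup (x∉ ∷ u) {zero}  {suc j} eq = contradiction eq (All.lookup x∉ (∈-lookup j))
    unique-lookup (x∉ ∷ u) {suc i} {zero}  eq = contradiction (sym eq) (All.lookup x∉ (∈-lookup i))
    unique-lookup (x∉ ∷ u) {suc i} {suc j} eq = cong suc (unique-lookup u eq)

    ∈-allVecs : ∀ {k} (v : Vec (Fin n) k) → v ∈ allVecs n k
    ∈-allVecs []      = here refl
    ∈-allVecs (x ∷ v) = ∈-concatMap⁺ _ (Any.map (λ { refl → ∈-map⁺ _ (∈-allVecs v) }) (∈-allFin x))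

    odd-cycle : ∀ {x xs} → (∀ {a b} → inE E a b ≡ true → a ≢ b) →
                Path E x xs x → odd (length xs) ≡ true → hasOddCycle E ≡ true
    odd-cycle loopless p od with simple-odd _ ≤-refl p od
    ... | y , [] , _ , _ , ()
    -- Length one would be a loop; every other odd length is at least three, as `hasOddCycle`
    -- demands.
    ... | y , z ∷ [] , e ∷ [] , _ , _ = contradiction refl (loopless e)
    ... | y , y ∷ ys@(_ ∷ _ ∷ _) , q@(_ ∷ _) , unique , od′ =
      any-intro {p = λ k → odd k ∧ ⌊ 3 ≤? k ⌋ ∧ any (isCycle E) (allVecs n k)}
        (∈-upTo⁺ (s≤s (Fin.injective⇒≤ (unique-lookup unique))))
        (∧-intro od′ (any-intro {p = isCycle E} (∈-allVecs (Vec.fromList (y ∷ ys)))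
          (∧-intro (distinct unique) (path-edges q))))

    -- Colours alternate along the cycle. The last vertex is an even number of steps from the first
    -- and has its colour, but the two are joined.
    two-coloured : (c : Fin n → Bool) → (∀ {a b} → inE E a b ≡ true → c a ≢ c b) →
                   hasOddCycle E ≡ false
    two-coloured c proper with hasOddCycle E in eq
    ... | false = refl
    ... | true with any-elim {p = λ k → odd k ∧ ⌊ 3 ≤? k ⌋ ∧ any (isCycle E) (allVecs n k)} (upTo (suc n)) eq
    ...   | k , q with ∧-true {odd k} q
    ...   | od , r with any-elim {p = isCycle E} (allVecs n k) (proj₂ (∧-true {⌊ 3 ≤? k ⌋} r))
    two-coloured c proper | true | suc k , q | od , r | x ∷ v , cyc =
      contradiction (trans (alternate x v (proj₁ (∧-true (proj₂ (∧-true {distinctV (x ∷ v)} cyc)))))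
        (cong (_xor c x) (trans (sym (not-involutive (odd k))) (cong not od))))
        (proper (proj₂ (∧-true {pathEdges E x v} (proj₂ (∧-true {distinctV (x ∷ v)} cyc)))))
      where
      alternate : ∀ {k} x (v : Vec (Fin n) k) → pathEdges E x v ≡ true → c (lastV x v) ≡ odd k xor c x
      alternate x [] p = refl
      alternate {suc k} x (y ∷ v) p with ∧-true {inE E x y} p
      ... | e , rest = trans (alternate y v rest)
              (trans (cong (odd k xor_) (¬-not (proper e ∘ sym))) (move (odd k) (c x)))
        where
        move : ∀ a b → (a xor not b) ≡ (not a xor b)
        move true  b = not-involutive b
        move false b = refl

  import Data.Integer as ℤ
  import Data.Integer.Properties as ℤ
  import Data.Integer.Tactic.RingSolver as ℤ
  open import Data.Integer using (+_)

  -- Rational sums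

  opaque
    -- Defined by recursion and not as `+ n / 1`, so that sums and products are handled by
    -- induction, without normalising fractions.
    ι : ℕ → ℚ
    ι zero    = 0ℚ
    ι (suc n) = 1ℚ ℚ.+ ι n

    ι-zero : ι 0 ≡ 0ℚ
    ι-zero = refl

    ι-suc : ∀ n → ι (suc n) ≡ 1ℚ ℚ.+ ι n
    ι-suc n = refl

  ι-one : ι 1 ≡ 1ℚ
  ι-one = trans (ι-suc 0) (trans (cong (1ℚ ℚ.+_) ι-zero) (ℚ.+-identityʳ 1ℚ))

  ι-+ : ∀ m n → ι (m ℕ.+ n) ≡ ι m ℚ.+ ι n
  ι-+ zero    n = sym (trans (cong (ℚ._+ ι n) ι-zero) (ℚ.+-identityˡ (ι n)))
  ι-+ (suc m) n = begin
    ι (suc (m ℕ.+ n))            ≡⟨ ι-suc (m ℕ.+ n) ⟩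
    1ℚ ℚ.+ ι (m ℕ.+ n)           ≡⟨ cong (1ℚ ℚ.+_) (ι-+ m n) ⟩
    1ℚ ℚ.+ (ι m ℚ.+ ι n)         ≡⟨ ℚ.+-assoc 1ℚ (ι m) (ι n) ⟨
    1ℚ ℚ.+ ι m ℚ.+ ι n           ≡⟨ cong (ℚ._+ ι n) (ι-suc m) ⟨
    ι (suc m) ℚ.+ ι n            ∎
    where open ≡-Reasoning

  ι-* : ∀ m n → ι (m ℕ.* n) ≡ ι m ℚ.* ι n
  ι-* zero    n = trans ι-zero (sym (trans (cong (ℚ._* ι n) ι-zero) (ℚ.*-zeroˡ (ι n))))
  ι-* (suc m) n = begin
    ι (n ℕ.+ m ℕ.* n)            ≡⟨ ι-+ n (m ℕ.* n) ⟩
    ι n ℚ.+ ι (m ℕ.* n)          ≡⟨ cong₂ ℚ._+_ (sym (ℚ.*-identityˡ (ι n))) (ι-* m n) ⟩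
    1ℚ ℚ.* ι n ℚ.+ ι m ℚ.* ι n   ≡⟨ ℚ.*-distribʳ-+ (ι n) 1ℚ (ι m) ⟨
    (1ℚ ℚ.+ ι m) ℚ.* ι n         ≡⟨ cong (ℚ._* ι n) (ι-suc m) ⟨
    ι (suc m) ℚ.* ι n            ∎
    where open ≡-Reasoning

  0≤1 : 0ℚ ℚ.≤ 1ℚ
  0≤1 = ℚ.nonNegative⁻¹ 1ℚ

  0≤ι : ∀ n → 0ℚ ℚ.≤ ι n
  0≤ι zero    = ℚ.≤-reflexive (sym ι-zero)
  0≤ι (suc n) = ℚ.≤-trans (ℚ.+-mono-≤ 0≤1 (0≤ι n)) (ℚ.≤-reflexive (sym (ι-suc n)))

  ι-mono : ∀ {m n} → m ℕ.≤ n → ι m ℚ.≤ ι n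
  ι-mono {m} {n} m≤n = begin
    ι m                      ≡⟨ ℚ.+-identityʳ (ι m) ⟨
    ι m ℚ.+ 0ℚ               ≤⟨ ℚ.+-monoʳ-≤ (ι m) (0≤ι (n ℕ.∸ m)) ⟩
    ι m ℚ.+ ι (n ℕ.∸ m)      ≡⟨ ι-+ m (n ℕ.∸ m) ⟨
    ι (m ℕ.+ (n ℕ.∸ m))      ≡⟨ cong ι (ℕ.m+[n∸m]≡n m≤n) ⟩
    ι n                      ∎
    where open ℚ.≤-Reasoning

  1≤ι : ∀ {n} → 1 ℕ.≤ n → 1ℚ ℚ.≤ ι n
  1≤ι p = ℚ.≤-trans (ℚ.≤-reflexive (sym ι-one)) (ι-mono p)

  /1≡ι : ∀ n → + n / 1 ≡ ι n
  /1≡ι zero    = sym ι-zero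
  /1≡ι (suc n) = trans (ℚ.toℚᵘ-injective (begin
    toℚᵘ (+ suc n / 1)                    ≈⟨ ℚ.toℚᵘ-fromℚᵘ (ℚᵘ.mkℚᵘ (+ suc n) 0) ⟩
    ℚᵘ.mkℚᵘ (+ suc n) 0                   ≈⟨ ℚᵘ.*≡* (cross-multiplied (+ n)) ⟩
    toℚᵘ 1ℚ ℚᵘ.+ ℚᵘ.mkℚᵘ (+ n) 0          ≈⟨ ℚᵘ.+-congʳ (toℚᵘ 1ℚ) (ℚ.toℚᵘ-fromℚᵘ (ℚᵘ.mkℚᵘ (+ n) 0)) ⟨
    toℚᵘ 1ℚ ℚᵘ.+ toℚᵘ (+ n / 1)           ≈⟨ ℚ.toℚᵘ-homo-+ 1ℚ (+ n / 1) ⟨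
    toℚᵘ (1ℚ ℚ.+ (+ n / 1))               ∎))
    (trans (cong (1ℚ ℚ.+_) (/1≡ι n)) (sym (ι-suc n)))
    where
    open ℚᵘ.≃-Reasoning
    cross-multiplied : ∀ a → (+ 1 ℤ.+ a) ℤ.* + 1 ≡ (+ 1 ℤ.+ a ℤ.* + 1) ℤ.* + 1
    cross-multiplied = ℤ.solve-∀

  1/-inverse : ∀ n → (+ 1 / suc n) ℚ.* ι (suc n) ≡ 1ℚ
  1/-inverse n = trans (cong ((+ 1 / suc n) ℚ.*_) (sym (/1≡ι (suc n)))) (ℚ.toℚᵘ-injective (begin
    toℚᵘ ((+ 1 / suc n) ℚ.* (+ suc n / 1))            ≈⟨ ℚ.toℚᵘ-homo-* (+ 1 / suc n) (+ suc n / 1) ⟩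
    toℚᵘ (+ 1 / suc n) ℚᵘ.* toℚᵘ (+ suc n / 1)        ≈⟨ ℚᵘ.*-cong (ℚ.toℚᵘ-fromℚᵘ (ℚᵘ.mkℚᵘ (+ 1) n)) (ℚ.toℚᵘ-fromℚᵘ (ℚᵘ.mkℚᵘ (+ suc n) 0)) ⟩
    ℚᵘ.mkℚᵘ (+ 1) n ℚᵘ.* ℚᵘ.mkℚᵘ (+ suc n) 0          ≈⟨ ℚᵘ.*≡* (trans (ℤ.*-identityʳ _) (cong (λ k → + 1 ℤ.* + k) (sym (ℕ.*-identityʳ (suc n))))) ⟩
    toℚᵘ 1ℚ                                           ∎))
    where open ℚᵘ.≃-Reasoning

  0≤1/ : ∀ n → 0ℚ ℚ.≤ + 1 / suc n
  0≤1/ n = ℚ.nonNegative⁻¹ (+ 1 / suc n) ⦃ ℚ.normalize-nonNeg 1 (suc n) ⦄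

  ℚ-*-flip : ∀ x y z → x ℚ.* (y ℚ.* z) ≡ y ℚ.* (x ℚ.* z)
  ℚ-*-flip x y z = trans (sym (ℚ.*-assoc x y z))
    (trans (cong (ℚ._* z) (ℚ.*-comm x y)) (ℚ.*-assoc y x z))

  *-monoʳ : ∀ {r p q} → 0ℚ ℚ.≤ r → p ℚ.≤ q → r ℚ.* p ℚ.≤ r ℚ.* q
  *-monoʳ {r} 0≤r = ℚ.*-monoˡ-≤-nonNeg r ⦃ ℚ.nonNegative 0≤r ⦄

  *-monoˡ : ∀ {r p q} → 0ℚ ℚ.≤ r → p ℚ.≤ q → p ℚ.* r ℚ.≤ q ℚ.* r
  *-monoˡ {r} 0≤r = ℚ.*-monoʳ-≤-nonNeg r ⦃ ℚ.nonNegative 0≤r ⦄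

  *-mono : ∀ {p q r s} → 0ℚ ℚ.≤ r → 0ℚ ℚ.≤ q → p ℚ.≤ q → r ℚ.≤ s → p ℚ.* r ℚ.≤ q ℚ.* s
  *-mono 0≤r 0≤q p≤q r≤s = ℚ.≤-trans (*-monoˡ 0≤r p≤q) (*-monoʳ 0≤q r≤s)

  *-nonneg : ∀ {p q} → 0ℚ ℚ.≤ p → 0ℚ ℚ.≤ q → 0ℚ ℚ.≤ p ℚ.* q
  *-nonneg {p} {q} 0≤p 0≤q = subst (ℚ._≤ p ℚ.* q) (ℚ.*-zeroʳ p) (*-monoʳ 0≤p 0≤q)

  opaque
    ∑ℚ : ∀ {n} → (Fin n → ℚ) → ℚ
    ∑ℚ = ∑ℚ-Properties.sum

    ∑ℚ-empty : (f : Fin 0 → ℚ) → ∑ℚ f ≡ 0ℚ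
    ∑ℚ-empty f = refl

    ∑ℚ-suc : ∀ {n} (f : Fin (suc n) → ℚ) → ∑ℚ f ≡ f zero ℚ.+ ∑ℚ (f ∘ suc)
    ∑ℚ-suc f = refl

    ∑ℚ-cong : ∀ {n} {f g : Fin n → ℚ} → (∀ i → f i ≡ g i) → ∑ℚ f ≡ ∑ℚ g
    ∑ℚ-cong = ∑ℚ-Properties.sum-cong-≗

    ∑ℚ-swap : ∀ {m n} (f : Fin m → Fin n → ℚ) →
              ∑ℚ (λ x → ∑ℚ (λ y → f x y)) ≡ ∑ℚ (λ y → ∑ℚ (λ x → f x y))
    ∑ℚ-swap = ∑ℚ-Properties.∑-comm

    ∑ℚ-*ˡ : ∀ {n} c (f : Fin n → ℚ) → ∑ℚ (λ i → c ℚ.* f i) ≡ c ℚ.* ∑ℚ f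
    ∑ℚ-*ˡ c f = sym (∑ℚ-Properties.*-distribˡ-sum c f)

  ∑ℚ-mono : ∀ {n} {f g : Fin n → ℚ} → (∀ i → f i ℚ.≤ g i) → ∑ℚ f ℚ.≤ ∑ℚ g
  ∑ℚ-mono {zero}  {f} {g} f≤g = ℚ.≤-reflexive (trans (∑ℚ-empty f) (sym (∑ℚ-empty g)))
  ∑ℚ-mono {suc n} {f} {g} f≤g = subst₂ ℚ._≤_ (sym (∑ℚ-suc f)) (sym (∑ℚ-suc g))
    (ℚ.+-mono-≤ (f≤g zero) (∑ℚ-mono (f≤g ∘ suc)))

  ι-∑ : ∀ {n} (f : Fin n → ℕ) → ι (∑ f) ≡ ∑ℚ (ι ∘ f)
  ι-∑ {zero}  f = trans (cong ι (∑-empty f)) (trans ι-zero (sym (∑ℚ-empty (ι ∘ f))))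
  ι-∑ {suc n} f = begin
    ι (∑ f)                               ≡⟨ cong ι (∑-suc f) ⟩
    ι (f zero ℕ.+ ∑ (f ∘ suc))            ≡⟨ ι-+ (f zero) (∑ (f ∘ suc)) ⟩
    ι (f zero) ℚ.+ ι (∑ (f ∘ suc))        ≡⟨ cong (ι (f zero) ℚ.+_) (ι-∑ (f ∘ suc)) ⟩
    ι (f zero) ℚ.+ ∑ℚ (ι ∘ f ∘ suc)       ≡⟨ ∑ℚ-suc (ι ∘ f) ⟨
    ∑ℚ (ι ∘ f)                            ∎
    where open ≡-Reasoning

  ∑ℚ-zero : ∀ {n} {f : Fin n → ℚ} → (∀ i → f i ≡ 0ℚ) → ∑ℚ f ≡ 0ℚ
  ∑ℚ-zero {zero}  {f} f≡0 = ∑ℚ-empty f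
  ∑ℚ-zero {suc n} {f} f≡0 = trans (∑ℚ-suc f) (cong₂ ℚ._+_ (f≡0 zero) (∑ℚ-zero (f≡0 ∘ suc)))

  δ : ∀ {n} → Fin n → Fin n → ℚ
  δ u x = ι ⟦ u == x ⟧

  ι-true : ∀ {b} → b ≡ true → ι ⟦ b ⟧ ≡ 1ℚ
  ι-true refl = ι-one

  ι-false : ∀ {b} → b ≡ false → ι ⟦ b ⟧ ≡ 0ℚ
  ι-false refl = ι-zero

  δ-self : ∀ {n} (u : Fin n) → δ u u ≡ 1ℚ
  δ-self u = ι-true (==-refl u)

  ∑ℚ-δ : ∀ {n} (u : Fin n) (f : Fin n → ℚ) → ∑ℚ (λ x → δ u x ℚ.* f x) ≡ f u
  ∑ℚ-δ {suc n} zero f = begin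
    ∑ℚ (λ x → δ zero x ℚ.* f x)
      ≡⟨ ∑ℚ-suc _ ⟩
    ι 1 ℚ.* f zero ℚ.+ ∑ℚ (λ x → ι 0 ℚ.* f (suc x))
      ≡⟨ cong₂ ℚ._+_ (trans (cong (ℚ._* f zero) ι-one) (ℚ.*-identityˡ (f zero)))
           (∑ℚ-zero (λ x → trans (cong (ℚ._* f (suc x)) ι-zero) (ℚ.*-zeroˡ (f (suc x))))) ⟩
    f zero ℚ.+ 0ℚ
      ≡⟨ ℚ.+-identityʳ (f zero) ⟩
    f zero ∎
    where open ≡-Reasoning
  ∑ℚ-δ {suc n} (suc u) f = begin
    ∑ℚ (λ x → δ (suc u) x ℚ.* f x)
      ≡⟨ ∑ℚ-suc _ ⟩
    ι 0 ℚ.* f zero ℚ.+ ∑ℚ (λ x → δ (suc u) (suc x) ℚ.* f (suc x))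
      ≡⟨ cong₂ ℚ._+_ (trans (cong (ℚ._* f zero) ι-zero) (ℚ.*-zeroˡ (f zero)))
           (trans (∑ℚ-cong (λ x → cong (λ b → ι ⟦ b ⟧ ℚ.* f (suc x)) (==-suc u x))) (∑ℚ-δ u (f ∘ suc))) ⟩
    0ℚ ℚ.+ f (suc u)
      ≡⟨ ℚ.+-identityˡ (f (suc u)) ⟩
    f (suc u) ∎
    where open ≡-Reasoning

  -- The random walk operator

  avg : ∀ {n} → (Fin n → ℚ) → List (Fin n) → ℚ
  avg F []       = 0ℚ
  avg F (w ∷ ws) = (+ 1 / suc (length ws)) ℚ.* sumℚ (map F (w ∷ ws))

  sumℚ-mono : ∀ {n} {F F′ : Fin n → ℚ} ns → (∀ {w} → w ∈ ns → F w ℚ.≤ F′ w) →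
              sumℚ (map F ns) ℚ.≤ sumℚ (map F′ ns)
  sumℚ-mono []       F≤F′ = ℚ.≤-refl
  sumℚ-mono (w ∷ ns) F≤F′ = ℚ.+-mono-≤ (F≤F′ (here refl)) (sumℚ-mono ns (F≤F′ ∘ there))

  sumℚ-const : ∀ {n} c (ns : List (Fin n)) → sumℚ (map (λ _ → c) ns) ≡ ι (length ns) ℚ.* c
  sumℚ-const c []       = sym (trans (cong (ℚ._* c) ι-zero) (ℚ.*-zeroˡ c))
  sumℚ-const c (_ ∷ ns) = sym (begin
    ι (suc (length ns)) ℚ.* c              ≡⟨ cong (ℚ._* c) (ι-suc (length ns)) ⟩
    (1ℚ ℚ.+ ι (length ns)) ℚ.* c           ≡⟨ ℚ.*-distribʳ-+ c 1ℚ (ι (length ns)) ⟩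
    1ℚ ℚ.* c ℚ.+ ι (length ns) ℚ.* c       ≡⟨ cong₂ ℚ._+_ (ℚ.*-identityˡ c) (sym (sumℚ-const c ns)) ⟩
    c ℚ.+ sumℚ (map (λ _ → c) ns)          ∎)
    where open ≡-Reasoning

  sumℚ-*ˡ : ∀ {n} c (F : Fin n → ℚ) ns → sumℚ (map (λ w → c ℚ.* F w) ns) ≡ c ℚ.* sumℚ (map F ns)
  sumℚ-*ˡ c F []       = sym (ℚ.*-zeroʳ c)
  sumℚ-*ˡ c F (w ∷ ns) = trans (cong (c ℚ.* F w ℚ.+_) (sumℚ-*ˡ c F ns))
                               (sym (ℚ.*-distribˡ-+ c (F w) (sumℚ (map F ns))))

  avg-mono : ∀ {n} {F F′ : Fin n → ℚ} ns → (∀ {w} → w ∈ ns → F w ℚ.≤ F′ w) → avg F ns ℚ.≤ avg F′ ns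
  avg-mono []       F≤F′ = ℚ.≤-refl
  avg-mono (w ∷ ns) F≤F′ = *-monoʳ (0≤1/ (length ns)) (sumℚ-mono (w ∷ ns) F≤F′)

  avg-const : ∀ {n} c (w : Fin n) ws → avg (λ _ → c) (w ∷ ws) ≡ c
  avg-const c w ws = begin
    (+ 1 / suc k) ℚ.* sumℚ (map (λ _ → c) (w ∷ ws))   ≡⟨ cong ((+ 1 / suc k) ℚ.*_) (sumℚ-const c (w ∷ ws)) ⟩
    (+ 1 / suc k) ℚ.* (ι (suc k) ℚ.* c)               ≡⟨ ℚ.*-assoc (+ 1 / suc k) (ι (suc k)) c ⟨
    (+ 1 / suc k) ℚ.* ι (suc k) ℚ.* c                 ≡⟨ cong (ℚ._* c) (1/-inverse k) ⟩
    1ℚ ℚ.* c                                          ≡⟨ ℚ.*-identityˡ c ⟩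
    c                                                 ∎
    where open ≡-Reasoning
          k = length ws

  avg-*ˡ : ∀ {n} c (F : Fin n → ℚ) ns → avg (λ w → c ℚ.* F w) ns ≡ c ℚ.* avg F ns
  avg-*ˡ c F []       = sym (ℚ.*-zeroʳ c)
  avg-*ˡ c F (w ∷ ws) = trans (cong (k ℚ.*_) (sumℚ-*ˡ c F (w ∷ ws))) (ℚ-*-flip k c s)
    where
    k = + 1 / suc (length ws)
    s = sumℚ (map F (w ∷ ws))

  avg-cong : ∀ {n} {F F′ : Fin n → ℚ} ns → (∀ w → F w ≡ F′ w) → avg F ns ≡ avg F′ ns
  avg-cong ns F≡F′ = ℚ.≤-antisym (avg-mono ns (λ {w} _ → ℚ.≤-reflexive (F≡F′ w)))
                                 (avg-mono ns (λ {w} _ → ℚ.≤-reflexive (sym (F≡F′ w))))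

  sumℚ-filter : ∀ {m n} (p : Fin n → Bool) (F : Fin n → ℚ) (g : Fin m → Fin n) →
                sumℚ (map F (filterᵇ p (tabulate g))) ≡ ∑ℚ (λ i → ι ⟦ p (g i) ⟧ ℚ.* F (g i))
  sumℚ-filter {zero}  p F g = sym (∑ℚ-empty _)
  sumℚ-filter {suc m} p F g with p (g zero) in eq
  ... | true  = sym (trans (∑ℚ-suc _) (cong₂ ℚ._+_
                  (trans (cong (ℚ._* F (g zero)) (ι-true eq)) (ℚ.*-identityˡ (F (g zero))))
                  (sym (sumℚ-filter p F (g ∘ suc)))))
  ... | false = sym (trans (∑ℚ-suc _) (trans (cong₂ ℚ._+_
                  (trans (cong (ℚ._* F (g zero)) (ι-false eq)) (ℚ.*-zeroˡ (F (g zero))))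
                  (sym (sumℚ-filter p F (g ∘ suc)))) (ℚ.+-identityˡ _)))

  length-filter : ∀ {m n} (p : Fin n → Bool) (g : Fin m → Fin n) →
                  length (filterᵇ p (tabulate g)) ≡ ∑ (λ i → ⟦ p (g i) ⟧)
  length-filter {zero}  p g = sym (∑-empty _)
  length-filter {suc m} p g with p (g zero) in eq
  ... | true  = sym (trans (∑-suc _) (cong₂ ℕ._+_ (cong ⟦_⟧ eq) (sym (length-filter p (g ∘ suc)))))
  ... | false = sym (trans (∑-suc _) (cong₂ ℕ._+_ (cong ⟦_⟧ eq) (sym (length-filter p (g ∘ suc)))))

  module Walks {n} (G : Graph n) (simpleG : Simple G) where

    -- One step of the random walk, acting on functions; walks from isolated vertices die.
    step : (Fin n → ℚ) → Fin n → ℚ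
    step F x = avg F (neighbours G x)

    walk : ℕ → (Fin n → ℚ) → Fin n → ℚ
    walk zero    F = F
    walk (suc s) F = step (walk s F)

    deg : Fin n → ℚ
    deg x = ι (degree G x)

    -- The degree clears the denominator of the average; at an isolated vertex both sides vanish.
    deg-step : ∀ F x → deg x ℚ.* step F x ≡ ∑ℚ (λ y → ι ⟦ G x y ⟧ ℚ.* F y)
    deg-step F x = trans (scaled (neighbours G x) (length-filter (G x) (λ i → i))) (sumℚ-filter (G x) F (λ i → i))
      where
      scaled : ∀ ns → length ns ≡ degree G x → deg x ℚ.* avg F ns ≡ sumℚ (map F ns)
      scaled []       _  = ℚ.*-zeroʳ (deg x)
      scaled (w ∷ ws) eq = begin
        deg x ℚ.* (k ℚ.* s)              ≡⟨ cong (λ d → ι d ℚ.* (k ℚ.* s)) (sym eq) ⟩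
        ι (suc (length ws)) ℚ.* (k ℚ.* s) ≡⟨ ℚ.*-assoc (ι (suc (length ws))) k s ⟨
        ι (suc (length ws)) ℚ.* k ℚ.* s  ≡⟨ cong (ℚ._* s) (trans (ℚ.*-comm (ι (suc (length ws))) k) (1/-inverse (length ws))) ⟩
        1ℚ ℚ.* s                         ≡⟨ ℚ.*-identityˡ s ⟩
        s                                ∎
        where
        open ≡-Reasoning
        k = + 1 / suc (length ws)
        s = sumℚ (map F (w ∷ ws))

    step-mono : ∀ {F F′} → (∀ x → F x ℚ.≤ F′ x) → ∀ x → step F x ℚ.≤ step F′ x
    step-mono F≤F′ x = avg-mono (neighbours G x) (λ {w} _ → F≤F′ w)

    walk-mono : ∀ s {F F′} → (∀ x → F x ℚ.≤ F′ x) → ∀ x → walk s F x ℚ.≤ walk s F′ x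
    walk-mono zero    F≤F′ = F≤F′
    walk-mono (suc s) F≤F′ = step-mono (walk-mono s F≤F′)

    walk-cong : ∀ s {F F′} → (∀ x → F x ≡ F′ x) → ∀ x → walk s F x ≡ walk s F′ x
    walk-cong zero    F≡F′ = F≡F′
    walk-cong (suc s) F≡F′ x = avg-cong (neighbours G x) (walk-cong s F≡F′)

    walk-*ˡ : ∀ s c F x → walk s (λ y → c ℚ.* F y) x ≡ c ℚ.* walk s F x
    walk-*ˡ zero    c F x = refl
    walk-*ˡ (suc s) c F x = trans (avg-cong (neighbours G x) (walk-*ˡ s c F))
                                  (avg-*ˡ c (walk s F) (neighbours G x))

    walk-+ : ∀ s t F x → walk (s ℕ.+ t) F x ≡ walk s (walk t F) x
    walk-+ zero    t F x = refl
    walk-+ (suc s) t F x = avg-cong (neighbours G x) (walk-+ s t F)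

    walk-suc : ∀ s F x → walk s (step F) x ≡ step (walk s F) x
    walk-suc zero    F x = refl
    walk-suc (suc s) F x = avg-cong (neighbours G x) (walk-suc s F)

    walk-nonneg : ∀ s {F} → (∀ x → 0ℚ ℚ.≤ F x) → ∀ x → 0ℚ ℚ.≤ walk s F x
    walk-nonneg zero    0≤F x = 0≤F x
    walk-nonneg (suc s) {F} 0≤F x with neighbours G x
    ... | []     = ℚ.≤-refl
    ... | w ∷ ws = ℚ.≤-trans (ℚ.≤-reflexive (sym (avg-const 0ℚ w ws)))
                             (avg-mono (w ∷ ws) (λ {y} _ → walk-nonneg s 0≤F y))

    0≤δ : ∀ u (x : Fin n) → 0ℚ ℚ.≤ δ u x
    0≤δ u x = 0≤ι ⟦ u == x ⟧

    -- Chapman-Kolmogorov, restricted to the walks that are at `u` after `s` steps.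
    walk-via : ∀ s t {u} F → (∀ x → 0ℚ ℚ.≤ F x) → ∀ x →
               walk s (δ u) x ℚ.* walk t F u ℚ.≤ walk (s ℕ.+ t) F x
    walk-via s t {u} F 0≤F x = begin
      walk s (δ u) x ℚ.* walk t F u                  ≡⟨ ℚ.*-comm (walk s (δ u) x) (walk t F u) ⟩
      walk t F u ℚ.* walk s (δ u) x                  ≡⟨ walk-*ˡ s (walk t F u) (δ u) x ⟨
      walk s (λ y → walk t F u ℚ.* δ u y) x          ≤⟨ walk-mono s at x ⟩
      walk s (walk t F) x                            ≡⟨ walk-+ s t F x ⟨
      walk (s ℕ.+ t) F x                             ∎
      where
      open ℚ.≤-Reasoning
      at : ∀ y → walk t F u ℚ.* δ u y ℚ.≤ walk t F y
      at y with u Fin.≟ y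
      ... | yes refl = ℚ.≤-reflexive (trans (cong (walk t F u ℚ.*_) ι-one) (ℚ.*-identityʳ (walk t F u)))
      ... | no _ = ℚ.≤-trans (ℚ.≤-reflexive (trans (cong (walk t F u ℚ.*_) ι-zero) (ℚ.*-zeroʳ (walk t F u))))
                             (walk-nonneg t 0≤F y)

    -- The inner product of the degree measure, for which the random walk is reversible.
    ⟨_,_⟩ : (Fin n → ℚ) → (Fin n → ℚ) → ℚ
    ⟨ F , H ⟩ = ∑ℚ (λ x → F x ℚ.* (deg x ℚ.* H x))

    ⟨⟩-step : ∀ F H → ⟨ F , step H ⟩ ≡ ∑ℚ (λ x → ∑ℚ (λ y → F x ℚ.* (ι ⟦ G x y ⟧ ℚ.* H y)))
    ⟨⟩-step F H = ∑ℚ-cong (λ x → trans (cong (F x ℚ.*_) (deg-step H x))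
                                       (sym (∑ℚ-*ˡ (F x) (λ y → ι ⟦ G x y ⟧ ℚ.* H y))))

    ⟨⟩-sym : ∀ F H → ⟨ F , H ⟩ ≡ ⟨ H , F ⟩
    ⟨⟩-sym F H = ∑ℚ-cong (λ x → trans (ℚ-*-flip (F x) (deg x) (H x))
      (trans (cong (deg x ℚ.*_) (ℚ.*-comm (F x) (H x))) (ℚ-*-flip (deg x) (H x) (F x))))

    ⟨⟩-cong : ∀ {F F′ H H′} → (∀ x → F x ≡ F′ x) → (∀ x → H x ≡ H′ x) → ⟨ F , H ⟩ ≡ ⟨ F′ , H′ ⟩
    ⟨⟩-cong F≡ H≡ = ∑ℚ-cong (λ x → cong₂ (λ p q → p ℚ.* (deg x ℚ.* q)) (F≡ x) (H≡ x))

    step-selfAdjoint : ∀ F H → ⟨ F , step H ⟩ ≡ ⟨ step F , H ⟩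
    step-selfAdjoint F H = begin
      ⟨ F , step H ⟩
        ≡⟨ ⟨⟩-step F H ⟩
      ∑ℚ (λ x → ∑ℚ (λ y → F x ℚ.* (ι ⟦ G x y ⟧ ℚ.* H y)))
        ≡⟨ ∑ℚ-swap _ ⟩
      ∑ℚ (λ y → ∑ℚ (λ x → F x ℚ.* (ι ⟦ G x y ⟧ ℚ.* H y)))
        ≡⟨ ∑ℚ-cong (λ y → ∑ℚ-cong (λ x → trans
             (cong (λ b → F x ℚ.* (ι ⟦ b ⟧ ℚ.* H y)) (proj₁ simpleG x y))
             (trans (cong (F x ℚ.*_) (ℚ.*-comm (ι ⟦ G y x ⟧) (H y)))
               (trans (ℚ-*-flip (F x) (H y) (ι ⟦ G y x ⟧))
                 (cong (H y ℚ.*_) (ℚ.*-comm (F x) (ι ⟦ G y x ⟧))))))) ⟩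
      ∑ℚ (λ y → ∑ℚ (λ x → H y ℚ.* (ι ⟦ G y x ⟧ ℚ.* F x)))
        ≡⟨ ⟨⟩-step H F ⟨
      ⟨ H , step F ⟩
        ≡⟨ ⟨⟩-sym H (step F) ⟩
      ⟨ step F , H ⟩ ∎
      where open ≡-Reasoning

    walk-selfAdjoint : ∀ s F H → ⟨ F , walk s H ⟩ ≡ ⟨ walk s F , H ⟩
    walk-selfAdjoint zero    F H = refl
    walk-selfAdjoint (suc s) F H = begin
      ⟨ F , step (walk s H) ⟩     ≡⟨ step-selfAdjoint F (walk s H) ⟩
      ⟨ step F , walk s H ⟩       ≡⟨ walk-selfAdjoint s (step F) H ⟩
      ⟨ walk s (step F) , H ⟩     ≡⟨ ⟨⟩-cong (walk-suc s F) (λ _ → refl) ⟩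
      ⟨ walk (suc s) F , H ⟩      ∎
      where open ≡-Reasoning

    -- By reversibility the walk from A follows the ascents to A backwards; it then crosses
    -- an arc from X to Y and ascends to B.
    crossing : ∀ N i j A B (X Y : Fin n → Bool) →
      (∀ x → X x ≡ true → 1ℚ ℚ.≤ ι N ℚ.* walk i (δ A) x) →
      (∀ y → Y y ≡ true → 1ℚ ℚ.≤ ι N ℚ.* walk j (δ B) y) →
      ι (∑ (λ x → ∑ (λ y → ⟦ X x ⟧ ℕ.* (⟦ Y y ⟧ ℕ.* ⟦ G x y ⟧))))
      ℚ.≤ deg A ℚ.* (ι (N ℕ.* N) ℚ.* walk (i ℕ.+ suc j) (δ B) A)
    crossing N i j A B X Y X-up Y-up = begin
      ι (∑ (λ x → ∑ (λ y → ⟦ X x ⟧ ℕ.* (⟦ Y y ⟧ ℕ.* ⟦ G x y ⟧))))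
        ≡⟨ trans (ι-∑ _) (∑ℚ-cong (λ x → trans (ι-∑ _) (∑ℚ-cong (λ y →
             trans (ι-* ⟦ X x ⟧ _) (cong (ι ⟦ X x ⟧ ℚ.*_)
               (trans (ι-* ⟦ Y y ⟧ _) (ℚ.*-comm (ι ⟦ Y y ⟧) (ι ⟦ G x y ⟧)))))))) ⟩
      ∑ℚ (λ x → ∑ℚ (λ y → ι ⟦ X x ⟧ ℚ.* (ι ⟦ G x y ⟧ ℚ.* ι ⟦ Y y ⟧)))
        ≤⟨ ∑ℚ-mono (λ x → ∑ℚ-mono (λ y →
             *-mono (*-nonneg (0≤ι ⟦ G x y ⟧) (0≤ι ⟦ Y y ⟧))
                    (*-nonneg (0≤ι N) (walk-nonneg i (0≤δ A) x))
                    (bound (X x) i A x (X-up x))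
                    (*-monoʳ (0≤ι ⟦ G x y ⟧) (bound (Y y) j B y (Y-up y))))) ⟩
      ∑ℚ (λ x → ∑ℚ (λ y → up i A x ℚ.* (ι ⟦ G x y ⟧ ℚ.* up j B y)))
        ≡⟨ ⟨⟩-step (up i A) (up j B) ⟨
      ⟨ up i A , step (up j B) ⟩
        ≡⟨ ⟨⟩-cong (λ x → sym (walk-*ˡ i (ι N) (δ A) x))
             (λ x → trans (avg-cong (neighbours G x) (λ y → sym (walk-*ˡ j (ι N) (δ B) y)))
                          (walk-*ˡ (suc j) (ι N) (δ B) x)) ⟩
      ⟨ walk i (λ y → ι N ℚ.* δ A y) , (λ x → ι N ℚ.* walk (suc j) (δ B) x) ⟩
        ≡⟨ walk-selfAdjoint i (λ y → ι N ℚ.* δ A y) _ ⟨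
      ⟨ (λ y → ι N ℚ.* δ A y) , walk i (λ x → ι N ℚ.* walk (suc j) (δ B) x) ⟩
        ≡⟨ ∑ℚ-cong (λ y → trans (cong (λ q → ι N ℚ.* δ A y ℚ.* (deg y ℚ.* q))
              (trans (walk-*ˡ i (ι N) (walk (suc j) (δ B)) y)
                     (cong (ι N ℚ.*_) (sym (walk-+ i (suc j) (δ B) y)))))
              (regroup (ι N) (δ A y) (deg y) (walk (i ℕ.+ suc j) (δ B) y))) ⟩
      ∑ℚ (λ y → δ A y ℚ.* (deg y ℚ.* (ι N ℚ.* ι N ℚ.* walk (i ℕ.+ suc j) (δ B) y)))
        ≡⟨ ∑ℚ-δ A _ ⟩
      deg A ℚ.* (ι N ℚ.* ι N ℚ.* walk (i ℕ.+ suc j) (δ B) A)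
        ≡⟨ cong (λ q → deg A ℚ.* (q ℚ.* walk (i ℕ.+ suc j) (δ B) A)) (ι-* N N) ⟨
      deg A ℚ.* (ι (N ℕ.* N) ℚ.* walk (i ℕ.+ suc j) (δ B) A) ∎
      where
      open ℚ.≤-Reasoning
      up : ℕ → Fin n → Fin n → ℚ
      up s u x = ι N ℚ.* walk s (δ u) x
      bound : ∀ b s u x → (b ≡ true → 1ℚ ℚ.≤ up s u x) → ι ⟦ b ⟧ ℚ.≤ up s u x
      bound true  s u x p = ℚ.≤-trans (ℚ.≤-reflexive ι-one) (p refl)
      bound false s u x p = ℚ.≤-trans (ℚ.≤-reflexive ι-zero)
                                      (*-nonneg (0≤ι N) (walk-nonneg s (0≤δ u) x))
      regroup : ∀ a b c d → a ℚ.* b ℚ.* (c ℚ.* (a ℚ.* d)) ≡ b ℚ.* (c ℚ.* (a ℚ.* a ℚ.* d))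
      regroup = solve 4 (λ a b c d → a :* b :* (c :* (a :* d)) := b :* (c :* (a :* a :* d))) refl
        where open +-*-Solver

  -- Detection probability

  inE-here : ∀ {n} (E : EdgeList n) x y → inE ((x , y) ∷ E) x y ≡ true
  inE-here E x y rewrite ==-refl x | ==-refl y = refl

  inE-there : ∀ {n} (E : EdgeList n) e {x y} → inE E x y ≡ true → inE (e ∷ E) x y ≡ true
  inE-there E e {x} {y} p = ∨-introʳ ((proj₁ e == x ∧ proj₂ e == y) ∨ (proj₁ e == y ∧ proj₂ e == x)) p

  _⊆ᴱ_ : ∀ {n} → EdgeList n → EdgeList n → Set
  E ⊆ᴱ E′ = ∀ x y → inE E x y ≡ true → inE E′ x y ≡ true

  path-mono : ∀ {n} {E E′ : EdgeList n} → E ⊆ᴱ E′ → ∀ {x xs y} → Path E x xs y → Path E′ x xs y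
  path-mono E⊆E′ []      = []
  path-mono E⊆E′ (e ∷ p) = E⊆E′ _ _ e ∷ path-mono E⊆E′ p

  module Exploration {n} (G : Graph n) (simpleG : Simple G) where
    open Walks G simpleG

    InG : EdgeList n → Set
    InG E = ∀ x y → inE E x y ≡ true → G x y ≡ true

    InG-[] : InG []
    InG-[] _ _ ()

    InG-∷ : ∀ E {u v} → InG E → G u v ≡ true → InG ((u , v) ∷ E)
    InG-∷ E {u} {v} inG uv x y p with ∨-true {(u == x ∧ v == y) ∨ (u == y ∧ v == x)} p
    ... | inj₂ q = inG x y q
    ... | inj₁ q with ∨-true {u == x ∧ v == y} q
    ...   | inj₁ r = let ux , vy = ∧-true r in subst₂ (λ a b → G a b ≡ true) (==⇒≡ ux) (==⇒≡ vy) uv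
    ...   | inj₂ r = let uy , vx = ∧-true r
                     in simple⇒symmetric simpleG (subst₂ (λ a b → G a b ≡ true) (==⇒≡ uy) (==⇒≡ vx) uv)

    neighbour-sound : ∀ x {w} → w ∈ neighbours G x → G x w ≡ true
    neighbour-sound x {w} w∈ = T⇒true (proj₂ (∈-filter⁻ (λ y → T? (G x y)) {xs = allFin n} w∈))
      where
      T⇒true : ∀ {b} → T b → b ≡ true
      T⇒true {true} _ = refl

    walkProb-suc-≥ : ∀ t x E k → k ℚ.≤ walkProb G t x E →
      (∀ {w} → G x w ≡ true → k ℚ.≤ walkProb G t w ((x , w) ∷ E)) → k ℚ.≤ walkProb G (suc t) x E
    -- Soundness is abstracted together with the list of neighbours, so that it still speaks of that
    -- list after the case split.
    walkProb-suc-≥ t x E k stay move with neighbours G x | (λ {w} → neighbour-sound x {w})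
    ... | []     | _     = stay
    ... | w ∷ ws | sound = ℚ.≤-trans (ℚ.≤-reflexive (sym (avg-const k w ws)))
                                     (avg-mono (w ∷ ws) (move ∘ sound))

    walkProb-suc-≤ : ∀ t x E k → walkProb G t x E ℚ.≤ k →
      (∀ {w} → G x w ≡ true → walkProb G t w ((x , w) ∷ E) ℚ.≤ k) → walkProb G (suc t) x E ℚ.≤ k
    walkProb-suc-≤ t x E k stay move with neighbours G x | (λ {w} → neighbour-sound x {w})
    ... | []     | _     = stay
    ... | w ∷ ws | sound = ℚ.≤-trans (avg-mono (w ∷ ws) (move ∘ sound))
                                     (ℚ.≤-reflexive (avg-const k w ws))

    walkProb-nonneg : ∀ t x E → 0ℚ ℚ.≤ walkProb G t x E
    walkProb-nonneg zero x E with hasOddCycle E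
    ... | true  = 0≤1
    ... | false = ℚ.≤-refl
    walkProb-nonneg (suc t) x E = walkProb-suc-≥ t x E 0ℚ (walkProb-nonneg t x E)
      (λ {w} _ → walkProb-nonneg t w ((x , w) ∷ E))

    walkProb-≤1 : ∀ t x E → walkProb G t x E ℚ.≤ 1ℚ
    walkProb-≤1 zero x E with hasOddCycle E
    ... | true  = ℚ.≤-refl
    ... | false = 0≤1
    walkProb-≤1 (suc t) x E = walkProb-suc-≤ t x E 1ℚ (walkProb-≤1 t x E)
      (λ {w} _ → walkProb-≤1 t w ((x , w) ∷ E))

    -- The set of traversed edges only grows, so an odd cycle is never lost. `InG` excludes loops,
    -- so that an odd closed walk does contain a cycle.
    walkProb-found : ∀ t x {E u us} → InG E → Path E u us u → odd (length us) ≡ true →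
                     1ℚ ℚ.≤ walkProb G t x E
    walkProb-found zero x {E} inG p od
      rewrite odd-cycle (simple⇒irreflexive simpleG ∘ inG _ _) p od = ℚ.≤-refl
    walkProb-found (suc t) x {E} inG p od = walkProb-suc-≥ t x E 1ℚ (walkProb-found t x inG p od)
      (λ {w} xw → walkProb-found t w (InG-∷ E inG xw)
                    (path-mono (λ _ _ → inE-there E (x , w)) p) od)

    walkProb-bipartite : Bipartite G → ∀ t x {E} → InG E → walkProb G t x E ℚ.≤ 0ℚ
    walkProb-bipartite (c , proper) zero x {E} inG
      rewrite two-coloured {E = E} c (λ e → proper _ _ (inG _ _ e)) = ℚ.≤-refl
    walkProb-bipartite bip (suc t) x {E} inG = walkProb-suc-≤ t x E 0ℚ
      (walkProb-bipartite bip t x inG) (λ {w} xw → walkProb-bipartite bip t w (InG-∷ E inG xw))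

    -- `F` bounds the success probability from below for every state that `s` steps can lead to;
    -- such a state includes the traversed edges, among them the path just walked. At isolated
    -- vertices the left side is zero for `s` positive, so the staying put of `walkProb` does no
    -- harm.
    walkProb-prefix : ∀ s t x E (F : Fin n → ℚ) → InG E →
      (∀ y E′ {xs} → InG E′ → E ⊆ᴱ E′ → Path E′ x xs y → length xs ≡ s → F y ℚ.≤ walkProb G t y E′) →
      walk s F x ℚ.≤ walkProb G (s ℕ.+ t) x E
    walkProb-prefix zero    t x E F inG F≤ = F≤ x E inG (λ _ _ e → e) [] refl
    walkProb-prefix (suc s) t x E F inG F≤ with neighbours G x | (λ {w} → neighbour-sound x {w})
    ... | []     | _     = walkProb-nonneg (s ℕ.+ t) x E
    ... | w ∷ ws | sound =
      avg-mono {F = walk s F} {F′ = λ z → walkProb G (s ℕ.+ t) z ((x , z) ∷ E)} (w ∷ ws) λ {z} z∈ →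
        walkProb-prefix s t z ((x , z) ∷ E) F (InG-∷ E inG (sound z∈))
          λ y E′ inG′ E⊆E′ p eq →
            F≤ y E′ inG′ (λ a b e → E⊆E′ a b (inE-there E (x , z) e)) (E⊆E′ x z (inE-here E x z) ∷ p) (cong suc eq)

    closed-walk-found : ∀ b t u E → InG E → odd b ≡ true →
                        walk b (δ u) u ℚ.≤ walkProb G (b ℕ.+ t) u E
    closed-walk-found b t u E inG od = walkProb-prefix b t u E (δ u) inG closed
      where
      closed : ∀ y E′ {xs} → InG E′ → E ⊆ᴱ E′ → Path E′ u xs y → length xs ≡ b →
               δ u y ℚ.≤ walkProb G t y E′
      closed y E′ inG′ _ p eq with u Fin.≟ y
      ... | yes refl = ℚ.≤-trans (ℚ.≤-reflexive ι-one)
                         (walkProb-found t u inG′ p (trans (cong odd eq) od))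
      ... | no _ = ℚ.≤-trans (ℚ.≤-reflexive ι-zero) (walkProb-nonneg t y E′)

    -- First ascend from x to u, then close an odd walk at u.
    detection : ∀ a b t x u → odd b ≡ true →
                walk a (δ u) x ℚ.* walk b (δ u) u ℚ.≤ walkProb G (a ℕ.+ (b ℕ.+ t)) x []
    detection a b t x u od = begin
      walk a (δ u) x ℚ.* return                      ≡⟨ ℚ.*-comm (walk a (δ u) x) return ⟩
      return ℚ.* walk a (δ u) x                      ≡⟨ walk-*ˡ a return (δ u) x ⟨
      walk a (λ y → return ℚ.* δ u y) x              ≤⟨ walkProb-prefix a (b ℕ.+ t) x [] _ InG-[] at-u ⟩
      walkProb G (a ℕ.+ (b ℕ.+ t)) x []              ∎
      where
      open ℚ.≤-Reasoning
      return = walk b (δ u) u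
      at-u : ∀ y E′ {xs} → InG E′ → [] ⊆ᴱ E′ → Path E′ x xs y → length xs ≡ a →
             return ℚ.* δ u y ℚ.≤ walkProb G (b ℕ.+ t) y E′
      at-u y E′ inG′ _ _ _ with u Fin.≟ y
      ... | yes refl = ℚ.≤-trans (ℚ.≤-reflexive (trans (cong (return ℚ.*_) ι-one) (ℚ.*-identityʳ return)))
                         (closed-walk-found b t u E′ inG′ od)
      ... | no _ = ℚ.≤-trans (ℚ.≤-reflexive (trans (cong (return ℚ.*_) ι-zero) (ℚ.*-zeroʳ return)))
                     (walkProb-nonneg (b ℕ.+ t) y E′)

  -- Clusters whose centre is reached from everywhere

  0<ι-suc : ∀ d → 0ℚ ℚ.< ι (suc d)
  0<ι-suc d = ℚ.<-≤-trans (ℚ.positive⁻¹ 1ℚ) (1≤ι (s≤s z≤n))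

  ι-cancel-≤ : ∀ {m n} → ι m ℚ.≤ ι n → m ≤ n
  ι-cancel-≤ {m} {n} p with m ≤? n
  ... | yes m≤n = m≤n
  ... | no m≰n = contradiction (ℚ.≤-<-trans (ℚ.≤-trans (ι-mono (≰⇒> m≰n)) p)
      (ℚ.<-respˡ-≡ (ℚ.+-identityˡ (ι n)) (ℚ.<-≤-trans (ℚ.+-monoˡ-< (ι n) (ℚ.positive⁻¹ 1ℚ))
        (ℚ.≤-reflexive (sym (ι-suc n)))))) (ℚ.<-irrefl refl)

  -- For `d` the degree of a centre and `p` the probability of a crossing from it: dividing the
  -- crossing bound by `d` makes `p` at least `1 / (K * M)`. For `d` zero the bound contradicts
  -- `0 < m`.
  heavy-ratio : ∀ d m K M {p} → 0 < m → d ≤ K * m → ι m ℚ.≤ ι d ℚ.* (ι M ℚ.* p) →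
                1ℚ ℚ.≤ ι (K * M) ℚ.* p
  heavy-ratio zero m K M {p} 0<m _ m≤ = contradiction
    (ι-cancel-≤ (ℚ.≤-trans m≤ (ℚ.≤-reflexive (trans (cong (ℚ._* (ι M ℚ.* p)) ι-zero)
      (trans (ℚ.*-zeroˡ (ι M ℚ.* p)) (sym ι-zero)))))) (<⇒≱ 0<m)
  heavy-ratio (suc d) m K M {p} _ d≤Km m≤ =
    ℚ.*-cancelˡ-≤-pos (ι (suc d)) ⦃ ℚ.positive (0<ι-suc d) ⦄ (begin
      ι (suc d) ℚ.* 1ℚ                             ≡⟨ ℚ.*-identityʳ (ι (suc d)) ⟩
      ι (suc d)                                    ≤⟨ ι-mono d≤Km ⟩
      ι (K * m)                                    ≡⟨ ι-* K m ⟩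
      ι K ℚ.* ι m                                  ≤⟨ *-monoʳ (0≤ι K) m≤ ⟩
      ι K ℚ.* (ι (suc d) ℚ.* (ι M ℚ.* p))          ≡⟨ regroup (ι K) (ι (suc d)) (ι M) p ⟩
      ι (suc d) ℚ.* (ι K ℚ.* ι M ℚ.* p)            ≡⟨ cong (λ q → ι (suc d) ℚ.* (q ℚ.* p)) (ι-* K M) ⟨
      ι (suc d) ℚ.* (ι (K * M) ℚ.* p)              ∎)
    where
    open ℚ.≤-Reasoning
    regroup : ∀ a b c d → a ℚ.* (b ℚ.* (c ℚ.* d)) ≡ b ℚ.* (a ℚ.* c ℚ.* d)
    regroup = solve 4 (λ a b c d → a :* (b :* (c :* d)) := b :* (a :* c :* d)) refl
      where open +-*-Solver

  ratio-* : ∀ M N {p q} → 0ℚ ℚ.≤ q → 1ℚ ℚ.≤ ι M ℚ.* p → 1ℚ ℚ.≤ ι N ℚ.* q →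
            1ℚ ℚ.≤ ι (M * N) ℚ.* (p ℚ.* q)
  ratio-* M N {p} {q} 0≤q 1≤Mp 1≤Nq = begin
    1ℚ                             ≤⟨ 1≤Nq ⟩
    ι N ℚ.* q                      ≡⟨ ℚ.*-identityˡ (ι N ℚ.* q) ⟨
    1ℚ ℚ.* (ι N ℚ.* q)             ≤⟨ *-monoˡ (*-nonneg (0≤ι N) 0≤q) 1≤Mp ⟩
    ι M ℚ.* p ℚ.* (ι N ℚ.* q)      ≡⟨ regroup (ι M) p (ι N) q ⟩
    ι M ℚ.* ι N ℚ.* (p ℚ.* q)      ≡⟨ cong (ℚ._* (p ℚ.* q)) (ι-* M N) ⟨
    ι (M * N) ℚ.* (p ℚ.* q)        ∎
    where
    open ℚ.≤-Reasoning
    regroup : ∀ a b c d → a ℚ.* b ℚ.* (c ℚ.* d) ≡ a ℚ.* c ℚ.* (b ℚ.* d)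
    regroup = solve 4 (λ a b c d → a :* b :* (c :* d) := a :* c :* (b :* d)) refl
      where open +-*-Solver

  ratio-mono : ∀ {M N p q} → M ≤ N → 0ℚ ℚ.≤ p → p ℚ.≤ q → 1ℚ ℚ.≤ ι M ℚ.* p → 1ℚ ℚ.≤ ι N ℚ.* q
  ratio-mono {N = N} M≤N 0≤p p≤q 1≤Mp = ℚ.≤-trans 1≤Mp (*-mono 0≤p (0≤ι N) (ι-mono M≤N) p≤q)

  -- At most `L` steps up to the old centre, `L` down along a reversed ascent, one across and `L` up
  -- to the new centre. The detecting walk has the same shape inside one cluster.
  nextRadius : ℕ → ℕ
  nextRadius L = suc (3 * L)

  -- One factor `suc L` for each ascent length fixed by pigeonhole, and one factor `N` for each of
  -- the two ascents.
  crossingLoss : ℕ → ℕ → ℕ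
  crossingLoss L N = (suc L * suc L) * (N * N)

  module Clusterings {n} (G : Graph (suc n)) (simpleG : Simple G) where
    open Clusters G simpleG
    open Walks G simpleG

    -- From every x the walk is at the centre ρ x of its cluster after exactly ℓ x ≤ L steps
    -- with probability at least 1/N.
    record Clustering (L N : ℕ) : Set where
      field
        ρ      : V → V
        ℓ      : V → Fin (suc L)
        fibres : ConnectedFibres G ρ
        ascent : ∀ x → 1ℚ ℚ.≤ ι N ℚ.* walk (toℕ (ℓ x)) (δ (ρ x)) x

    singletons : Clustering 0 1
    singletons = record
      { ρ = λ x → x ; ℓ = λ _ → zero ; fibres = λ { refl → ε }
      ; ascent = λ x → ℚ.≤-reflexive (sym (trans (cong₂ ℚ._*_ ι-one (δ-self x)) (ℚ.*-identityˡ 1ℚ))) }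

    weaken : ∀ {L L′ N N′} → L ≤ L′ → N ≤ N′ → (C : Clustering L N) →
             ∃ λ (C′ : Clustering L′ N′) → Clustering.ρ C′ ≡ Clustering.ρ C
    weaken {N′ = N′} L≤L′ N≤N′ C = record
      { ρ = ρ ; ℓ = λ x → Fin.inject≤ (ℓ x) (s≤s L≤L′) ; fibres = fibres
      ; ascent = λ x → subst (λ k → 1ℚ ℚ.≤ ι N′ ℚ.* walk k (δ (ρ x)) x) (sym (Fin.toℕ-inject≤ (ℓ x) (s≤s L≤L′)))
          (ratio-mono N≤N′ (walk-nonneg (toℕ (ℓ x)) (0≤δ (ρ x)) x) ℚ.≤-refl (ascent x)) } , refl
      where open Clustering C

    module _ {L N} (C : Clustering L N) where
      open Clustering C

      -- Pigeonhole over the (L + 1)² pairs of ascent lengths.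
      popular-lengths : (g : Graph (suc n)) → (∀ {x y} → g x y ≡ true → G x y ≡ true) → ∀ A B →
        ∃₂ λ (i j : Fin (suc L)) →
          let m = ∑ (λ x → ∑ (λ y → ⟦ ρ x == A ⟧ * (⟦ ρ y == B ⟧ * ⟦ g x y ⟧))) in
          (ι m ℚ.≤ deg A ℚ.* (ι (crossingLoss L N) ℚ.* walk (toℕ i + suc (toℕ j)) (δ B) A)) ×
          (0 < m → ∃₂ λ x y → ℓ x ≡ i × ℓ y ≡ j × g x y ≡ true)
      popular-lengths g g⊆G A B = i , j , probable , witness
        where
        a : V → V → ℕ
        a x y = ⟦ ρ x == A ⟧ * (⟦ ρ y == B ⟧ * ⟦ g x y ⟧)
        first = heaviest-fibre ℓ (λ x → ∑ (a x))
        i = proj₁ first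
        second = heaviest-fibre ℓ (λ y → ∑ (λ x → ⟦ ℓ x == i ⟧ * a x y))
        j = proj₁ second
        X Y : V → Bool
        X x = (ρ x == A) ∧ (ℓ x == i)
        Y y = (ρ y == B) ∧ (ℓ y == j)
        popular : (V → V → Bool) → ℕ
        popular h = ∑ (λ x → ∑ (λ y → ⟦ X x ⟧ * (⟦ Y y ⟧ * ⟦ h x y ⟧)))
        m≤ : ∑ (λ x → ∑ (a x)) ≤ suc L * suc L * popular g
        m≤ = begin
          ∑ (λ x → ∑ (a x))
            ≤⟨ proj₂ first ⟩
          suc L * ∑ (λ x → ⟦ ℓ x == i ⟧ * ∑ (a x))
            ≡⟨ cong (suc L *_) (trans (∑-cong (λ x → sym (∑-*ˡ ⟦ ℓ x == i ⟧ (a x))))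
                                      (∑-swap (λ x y → ⟦ ℓ x == i ⟧ * a x y))) ⟩
          suc L * ∑ (λ y → ∑ (λ x → ⟦ ℓ x == i ⟧ * a x y))
            ≤⟨ *-monoʳ-≤ (suc L) (proj₂ second) ⟩
          suc L * (suc L * ∑ (λ y → ⟦ ℓ y == j ⟧ * ∑ (λ x → ⟦ ℓ x == i ⟧ * a x y)))
            ≡⟨ *-assoc (suc L) (suc L) _ ⟨
          suc L * suc L * ∑ (λ y → ⟦ ℓ y == j ⟧ * ∑ (λ x → ⟦ ℓ x == i ⟧ * a x y))
            ≡⟨ cong (suc L * suc L *_) (trans (∑-cong (λ y → sym (∑-*ˡ ⟦ ℓ y == j ⟧ (λ x → ⟦ ℓ x == i ⟧ * a x y))))
                 (trans (∑-swap (λ y x → ⟦ ℓ y == j ⟧ * (⟦ ℓ x == i ⟧ * a x y))) (∑∑-cong collect))) ⟩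
          suc L * suc L * popular g ∎
          where
          open ≤-Reasoning
          regroup : ∀ p q r s t → p * (q * (r * (s * t))) ≡ (r * q) * ((s * p) * t)
          regroup = solve-∀
          collect : ∀ x y → ⟦ ℓ y == j ⟧ * (⟦ ℓ x == i ⟧ * a x y) ≡ ⟦ X x ⟧ * (⟦ Y y ⟧ * ⟦ g x y ⟧)
          collect x y = trans
            (regroup ⟦ ℓ y == j ⟧ ⟦ ℓ x == i ⟧ ⟦ ρ x == A ⟧ ⟦ ρ y == B ⟧ ⟦ g x y ⟧)
            (sym (cong₂ (λ p q → p * (q * ⟦ g x y ⟧)) (⟦∧⟧ (ρ x == A) (ℓ x == i)) (⟦∧⟧ (ρ y == B) (ℓ y == j))))
        up : ∀ {U k} x → (ρ x == U) ∧ (ℓ x == k) ≡ true → 1ℚ ℚ.≤ ι N ℚ.* walk (toℕ k) (δ U) x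
        up {U} x p with ∧-true {ρ x == U} p
        ... | q , r = subst₂ (λ V k → 1ℚ ℚ.≤ ι N ℚ.* walk (toℕ k) (δ V) x) (==⇒≡ q) (==⇒≡ r) (ascent x)
        probable : ι (∑ (λ x → ∑ (a x)))
                   ℚ.≤ deg A ℚ.* (ι (crossingLoss L N) ℚ.* walk (toℕ i + suc (toℕ j)) (δ B) A)
        probable = begin
          ι (∑ (λ x → ∑ (a x)))
            ≤⟨ ι-mono (≤-trans m≤ (*-monoʳ-≤ (suc L * suc L) (∑∑-mono (λ x y →
                 *-monoʳ-≤ ⟦ X x ⟧ (*-monoʳ-≤ ⟦ Y y ⟧ (⟦⟧-mono g⊆G)))))) ⟩
          ι (suc L * suc L * popular G)
            ≡⟨ ι-* (suc L * suc L) (popular G) ⟩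
          ι (suc L * suc L) ℚ.* ι (popular G)
            ≤⟨ *-monoʳ (0≤ι (suc L * suc L)) (crossing N (toℕ i) (toℕ j) A B X Y up up) ⟩
          ι (suc L * suc L) ℚ.* (deg A ℚ.* (ι (N * N) ℚ.* p))
            ≡⟨ regroup (ι (suc L * suc L)) (deg A) (ι (N * N)) p ⟩
          deg A ℚ.* (ι (suc L * suc L) ℚ.* ι (N * N) ℚ.* p)
            ≡⟨ cong (λ q → deg A ℚ.* (q ℚ.* p)) (ι-* (suc L * suc L) (N * N)) ⟨
          deg A ℚ.* (ι (crossingLoss L N) ℚ.* p) ∎
          where
          open ℚ.≤-Reasoning
          p = walk (toℕ i + suc (toℕ j)) (δ B) A
          regroup : ∀ a b c d → a ℚ.* (b ℚ.* (c ℚ.* d)) ≡ b ℚ.* (a ℚ.* c ℚ.* d)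
          regroup = solve 4 (λ a b c d → a :* (b :* (c :* d)) := b :* (a :* c :* d)) refl
            where open +-*-Solver
        -- The popular lengths are realised by an arc of `g`, from which the parity of a return walk
        -- can be read off.
        witness : 0 < ∑ (λ x → ∑ (a x)) → ∃₂ λ x y → ℓ x ≡ i × ℓ y ≡ j × g x y ≡ true
        witness 0<m with ∑∑-pos (positive-factor (≤-trans 0<m m≤))
          where
          positive-factor : ∀ {q} → 0 < suc L * suc L * q → 0 < q
          positive-factor {zero}  p = contradiction (subst (0 <_) (*-zeroʳ (suc L * suc L)) p) n≮0
          positive-factor {suc q} p = z<s
        ... | x , y , p with ⟦⟧*-pos (X x) p
        ... | Xx , q with ⟦⟧*-pos (Y y) q
        ... | Yy , r = x , y , ==⇒≡ (proj₂ (∧-true {ρ x == A} Xx)) ,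
                       ==⇒≡ (proj₂ (∧-true {ρ y == B} Yy)) , ⟦⟧-pos _ r

      -- A vertex of a merged cluster ascends to its old centre and jumps from there to the new one.
      -- The length of the jump depends on the old cluster only, so the total length is again
      -- prescribed for each vertex.
      merge-clusters : ∀ K (S : V → Bool) (f : V → V) → (∀ A → S A ≡ true → S (f A) ≡ false) →
        (∀ A → S A ≡ true → 0 < weight ρ A (f A) × degree G A ≤ K * weight ρ A (f A)) →
        ∃ λ (C′ : Clustering (nextRadius L) (N * suc (K * crossingLoss L N))) →
          Clustering.ρ C′ ≡ redirect S f ρ
      merge-clusters K S f star heavy = record
        { ρ = redirect S f ρ
        ; ℓ = λ x → fromℕ< (s≤s (ℓ′-bound x))
        ; fibres = redirect-connected S f ρ fibres star (λ A p → proj₁ (heavy A p))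
        ; ascent = λ x → subst (λ k → 1ℚ ℚ.≤ ι N′ ℚ.* walk k (δ (redirect S f ρ x)) x)
            (sym (Fin.toℕ-fromℕ< (s≤s (ℓ′-bound x)))) (ascent′ x)
        } , refl
        where
        -- The `suc` keeps `N′` at least `N`, for the clusters that stay as they are.
        N′ = N * suc (K * crossingLoss L N)
        jump : V → ℕ
        jump A = let i , j , _ = popular-lengths G (λ g → g) A (f A) in toℕ i + suc (toℕ j)
        jump-probable : ∀ A → S A ≡ true →
                        1ℚ ℚ.≤ ι (K * crossingLoss L N) ℚ.* walk (jump A) (δ (f A)) A
        jump-probable A p =
          let _ , _ , probable , _ = popular-lengths G (λ g → g) A (f A)
              0<w , d≤ = heavy A p
              w≤link = ⟦⟧*-≤ (not (A == f A)) (link ρ A (f A))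
          in heavy-ratio (degree G A) (link ρ A (f A)) K (crossingLoss L N) (≤-trans 0<w w≤link)
               (≤-trans d≤ (*-monoʳ-≤ K w≤link)) probable
        ℓ′ : V → ℕ
        ℓ′ x = if S (ρ x) then toℕ (ℓ x) + jump (ρ x) else toℕ (ℓ x)
        ℓ≤L : ∀ (i : Fin (suc L)) → toℕ i ≤ L
        ℓ≤L i = s≤s⁻¹ (Fin.toℕ<n i)
        ℓ′-bound : ∀ x → ℓ′ x ≤ nextRadius L
        ℓ′-bound x with S (ρ x)
        ... | false = ≤-trans (ℓ≤L (ℓ x)) (≤-trans (m≤m+n L _) (n≤1+n (3 * L)))
        ... | true  = let i , j , _ = popular-lengths G (λ g → g) (ρ x) (f (ρ x)) in
          ≤-trans (+-mono-≤ (ℓ≤L (ℓ x)) (+-mono-≤ (ℓ≤L i) (s≤s (ℓ≤L j)))) (≤-reflexive (sum L))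
          where
          sum : ∀ L → L + (L + suc L) ≡ suc (3 * L)
          sum = solve-∀
        ascent′ : ∀ x → 1ℚ ℚ.≤ ι N′ ℚ.* walk (ℓ′ x) (δ (redirect S f ρ x)) x
        ascent′ x with S (ρ x) in eq
        ... | false = ratio-mono (m≤m*n N (suc (K * crossingLoss L N)))
                        (walk-nonneg (toℕ (ℓ x)) (0≤δ (ρ x)) x) ℚ.≤-refl (ascent x)
        ... | true  = ratio-mono (*-monoʳ-≤ N (n≤1+n (K * crossingLoss L N)))
                        (*-nonneg (walk-nonneg (toℕ (ℓ x)) (0≤δ (ρ x)) x) 0≤jump)
                        (walk-via (toℕ (ℓ x)) (jump (ρ x)) (δ (f (ρ x))) (0≤δ (f (ρ x))) x)
                        (ratio-* N (K * crossingLoss L N) 0≤jump (ascent x) (jump-probable (ρ x) eq))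
          where 0≤jump = walk-nonneg (jump (ρ x)) (0≤δ (f (ρ x))) (ρ x)

  -- Few arcs between clusters

  -- The constant `K` of `Round`, restated so that `loss` depends on `D`, `E` and the number of
  -- rounds alone.
  contractionLoss : ℕ → ℕ → ℕ
  contractionLoss D E = 2 * (E * (D * D))

  radius : ℕ → ℕ
  radius zero    = 0
  radius (suc r) = nextRadius (radius r)

  loss : ℕ → ℕ → ℕ → ℕ
  loss D E zero    = 1
  loss D E (suc r) = loss D E r * suc (contractionLoss D E * crossingLoss (radius r) (loss D E r))

  -- The potential starts at no more than `8 * D * E * D` times the number of vertices and falls by
  -- that number in each round, so one further round is impossible.
  rounds : ℕ → ℕ → ℕ
  rounds D E = suc (8 * D * E * D)

  module Partition {n} (G : Graph (suc n)) (simpleG : Simple G) {D E : ℕ}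
                   (sparse : HereditarilySparse D G) (0<D : 0 < D) where
    open Clusters G simpleG
    open Clusterings G simpleG
    open Walks G simpleG

    potential : ℕ
    potential = 8 * D * E

    -- Once few arcs cross, the partition is carried along unchanged, so that the constants depend
    -- on the number of rounds and not on when this happens.
    Progress : ℕ → Set
    Progress r = ∃ λ (C : Clustering (radius r) (loss D E r)) →
      E * cross (Clustering.ρ C) < suc n ⊎
      r * suc n + potential * cross (Clustering.ρ C) ≤ potential * (D * suc n)

    carry : ∀ {r} (C : Clustering (radius r) (loss D E r)) → E * cross (Clustering.ρ C) < suc n →
            Progress (suc r)
    carry {r} C few = proj₁ C′ , inj₁ (subst (λ ρ → E * cross ρ < suc n) (sym (proj₂ C′)) few)
      where
      C′ : ∃ λ (C′ : Clustering (radius (suc r)) (loss D E (suc r))) → Clustering.ρ C′ ≡ Clustering.ρ C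
      C′ = weaken (≤-trans (m≤m+n (radius r) _) (n≤1+n (3 * radius r))) (m≤m*n (loss D E r) _) C

    advance : ∀ {r} (C : Clustering (radius r) (loss D E r)) →
      suc n ≤ E * cross (Clustering.ρ C) →
      r * suc n + potential * cross (Clustering.ρ C) ≤ potential * (D * suc n) → Progress (suc r)
    advance {r} C many p = proj₁ C′ , inj₂ (begin
        suc r * suc n + potential * cross (Clustering.ρ (proj₁ C′))
          ≡⟨ cong (λ ρ′ → suc r * suc n + potential * cross ρ′) (proj₂ C′) ⟩
        suc n + r * suc n + potential * cross (redirect S favourite ρ)
          ≡⟨ rearrange (suc n) (r * suc n) (potential * cross (redirect S favourite ρ)) ⟩
        r * suc n + (suc n + potential * cross (redirect S favourite ρ))
          ≤⟨ +-monoʳ-≤ (r * suc n) (progress many) ⟩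
        r * suc n + potential * cross ρ
          ≤⟨ p ⟩
        potential * (D * suc n) ∎)
      where
      open ≤-Reasoning
      open Clustering C
      open Round {D} {E} sparse 0<D ρ fibres
      C′ : ∃ λ (C′ : Clustering (radius (suc r)) (loss D E (suc r))) →
           Clustering.ρ C′ ≡ redirect S favourite ρ
      C′ = merge-clusters C K S favourite S-star S-heavy
      rearrange : ∀ a b c → a + b + c ≡ b + (a + c)
      rearrange = solve-∀

    progress-at : ∀ r → Progress r
    progress-at zero = singletons , inj₂ (*-monoʳ-≤ potential (≤-trans
      (∑∑-mono (λ x y → ⟦⟧*-≤ (not (x == y)) ⟦ G x y ⟧)) (arcs≤ D sparse)))
    progress-at (suc r) = next (progress-at r)
      where
      next : Progress r → Progress (suc r)
      next (C , inj₁ few) = carry C few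
      next (C , inj₂ p)   = decide (suc n ≤? E * cross (Clustering.ρ C))
        where
        decide : Dec (suc n ≤ E * cross (Clustering.ρ C)) → Progress (suc r)
        decide (yes many) = advance C many p
        decide (no few)   = carry C (≰⇒> few)

    finished : ∀ {r} → r ≡ rounds D E → Progress r →
               ∃ λ (C : Clustering (radius r) (loss D E r)) → E * cross (Clustering.ρ C) < suc n
    finished r≡ (C , inj₁ few) = C , few
    finished {r} r≡ (C , inj₂ p) = contradiction (begin-strict
      potential * (D * suc n)              <⟨ m<n+m (potential * (D * suc n)) z<s ⟩
      suc n + potential * (D * suc n)      ≡⟨ cong (_+_ (suc n)) (*-assoc potential D (suc n)) ⟨
      rounds D E * suc n                   ≡⟨ cong (_* suc n) r≡ ⟨
      r * suc n                            ≤⟨ m≤m+n _ _ ⟩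
      r * suc n + potential * cross (Clustering.ρ C) ≤⟨ p ⟩
      potential * (D * suc n)              ∎) (<-irrefl refl)
      where open ≤-Reasoning

    low-diameter : ∃ λ (C : Clustering (radius (rounds D E)) (loss D E (rounds D E))) →
                   E * cross (Clustering.ρ C) < suc n
    low-diameter = finished refl (progress-at (rounds D E))

  -- Odd closed walks at the centres

  detectionLoss : ℕ → ℕ → ℕ → ℕ → ℕ
  detectionLoss D E L N = N * (2 * (E * D) * crossingLoss L N)

  module Detection {n} (G : Graph (suc n)) (simpleG : Simple G) {D E L N : ℕ}
                   (sparse : HereditarilySparse D G) (0<D : 0 < D)
                   (C : Clusterings.Clustering G simpleG L N) where
    open Clusters G simpleG
    open Clusterings G simpleG
    open Walks G simpleG
    open Exploration G simpleG
    open Clustering C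

    -- A walk of exactly `ℓ x` steps leads from `x` to the centre of its cluster. So within a
    -- cluster this is, up to exchanging the colours, the only restriction that a proper 2-colouring
    -- of `G` could have.
    side : V → Bool
    side x = odd (toℕ (ℓ x))

    monochromatic : Graph (suc n)
    monochromatic x y = G x y ∧ not (side x xor side y)

    violations : V → ℕ
    violations U = ∑ (λ x → ∑ (λ y → ⟦ ρ x == U ⟧ * (⟦ ρ y == U ⟧ * ⟦ monochromatic x y ⟧)))

    K : ℕ
    K = 2 * (E * D)

    good : V → Bool
    good = heavy K violations

    live : V → Bool
    live x = good (ρ x)

    violations-by-arc : ∀ (c : V → Bool) →
      ∑ (λ U → ⟦ c U ⟧ * violations U)
      ≡ ∑ (λ x → ∑ (λ y → ⟦ c (ρ x) ⟧ * (⟦ ρ y == ρ x ⟧ * ⟦ monochromatic x y ⟧)))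
    violations-by-arc c = trans (∑-cong (λ U →
        trans (sym (∑∑-*ˡ ⟦ c U ⟧ (λ x y → ⟦ ρ x == U ⟧ * (⟦ ρ y == U ⟧ * ⟦ monochromatic x y ⟧))))
        (trans (∑∑-cong (λ x y → *-flip ⟦ c U ⟧ ⟦ ρ x == U ⟧ (⟦ ρ y == U ⟧ * ⟦ monochromatic x y ⟧)))
               (∑-cong (λ x → ∑-*ˡ ⟦ ρ x == U ⟧ (λ y → ⟦ c U ⟧ * (⟦ ρ y == U ⟧ * ⟦ monochromatic x y ⟧)))))))
      (∑-fibre ρ (λ x U → ∑ (λ y → ⟦ c U ⟧ * (⟦ ρ y == U ⟧ * ⟦ monochromatic x y ⟧))))

    -- A violation stays inside one cluster, so those of good clusters are arcs of the subgraph
    -- induced by the live vertices, which is sparse.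
    good-violations : ∑ (λ U → ⟦ good U ⟧ * violations U) ≤ D * card live
    good-violations = begin
      ∑ (λ U → ⟦ good U ⟧ * violations U)
        ≡⟨ violations-by-arc good ⟩
      ∑ (λ x → ∑ (λ y → ⟦ live x ⟧ * (⟦ ρ y == ρ x ⟧ * ⟦ monochromatic x y ⟧)))
        ≤⟨ ∑∑-mono pointwise ⟩
      arcs R
        ≤⟨ sparse-subgraph D sparse R live R-sym (λ {x} {y} r → proj₁ (∧-true {G x y} r))
             (λ {x} {y} r → proj₁ (∧-true (proj₂ (∧-true {G x y} r)))) ⟩
      D * card live ∎
      where
      open ≤-Reasoning
      R : Graph (suc n)
      R x y = G x y ∧ (live x ∧ live y)
      R-sym : ∀ x y → R x y ≡ R y x
      R-sym x y = cong₂ _∧_ (proj₁ simpleG x y) (Bool.∧-comm (live x) (live y))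
        where import Data.Bool.Properties as Bool
      pointwise : ∀ x y → ⟦ live x ⟧ * (⟦ ρ y == ρ x ⟧ * ⟦ monochromatic x y ⟧) ≤ ⟦ R x y ⟧
      pointwise x y = subst (_≤ ⟦ R x y ⟧)
        (trans (⟦∧⟧ (live x) _) (cong (⟦ live x ⟧ *_) (⟦∧⟧ (ρ y == ρ x) (monochromatic x y))))
        (⟦⟧-mono {live x ∧ ((ρ y == ρ x) ∧ monochromatic x y)} λ p →
          let lx , q = ∧-true {live x} p
              same , r = ∧-true {ρ y == ρ x} q
          in ∧-intro (proj₁ (∧-true {G x y} r)) (∧-intro lx (trans (cong good (==⇒≡ same)) lx)))

    -- By the choice of `K`, clusters that are not good hold at most half of the violations; the
    -- good ones hold at most `D` per live vertex.
    many-live : suc n ≤ E * ∑ violations → suc n ≤ K * card live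
    many-live many = ≤-trans many (≤-trans (*-monoʳ-≤ E viol≤) (≤-reflexive (assoc E D (card live))))
      where
      assoc : ∀ e d c → e * (2 * (d * c)) ≡ 2 * (e * d) * c
      assoc = solve-∀
      0<E : 0 < E
      0<E = n≢0⇒n>0 λ { refl → n≮0 many }
      viol≤ : ∑ violations ≤ 2 * (D * card live)
      viol≤ = *-cancelˡ-≤ K ⦃ >-nonZero (*-mono-< {0} {2} z<s (*-mono-< 0<E 0<D)) ⦄
        (+-cancelʳ-≤ (K * ∑ violations) _ _ (begin
          K * ∑ violations + K * ∑ violations
            ≡⟨ double (K * ∑ violations) ⟩
          2 * (K * ∑ violations)
            ≤⟨ *-monoʳ-≤ 2 (≤-trans (heavy-part K violations)
                 (+-mono-≤ (*-monoʳ-≤ K good-violations) (≤-trans (arcs≤ D sparse) (*-monoʳ-≤ D many)))) ⟩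
          2 * (K * (D * card live) + D * (E * ∑ violations))
            ≡⟨ collect K D (card live) E (∑ violations) ⟩
          K * (2 * (D * card live)) + 2 * (E * D) * ∑ violations ∎))
        where
        open ≤-Reasoning
        double : ∀ x → x + x ≡ 2 * x
        double = solve-∀
        collect : ∀ k d c e v → 2 * (k * (d * c) + d * (e * v)) ≡ k * (2 * (d * c)) + 2 * (e * d) * v
        collect = solve-∀

    ascend-and-return : ∀ x (i j : Fin (suc L)) → odd (toℕ i + suc (toℕ j)) ≡ true →
      1ℚ ℚ.≤ ι (K * crossingLoss L N) ℚ.* walk (toℕ i + suc (toℕ j)) (δ (ρ x)) (ρ x) →
      1ℚ ℚ.≤ ι (detectionLoss D E L N) ℚ.* walkProb G (nextRadius L) x []
    ascend-and-return x i j odd-return returning =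
      ratio-mono ≤-refl
        (*-nonneg (walk-nonneg (toℕ (ℓ x)) (0≤δ (ρ x)) x) 0≤return)
        (subst (λ T → walk (toℕ (ℓ x)) (δ (ρ x)) x ℚ.* walk s (δ (ρ x)) (ρ x) ℚ.≤ walkProb G T x [])
          length-eq (detection (toℕ (ℓ x)) s slack x (ρ x) odd-return))
        (ratio-* N (K * crossingLoss L N) 0≤return (ascent x) returning)
      where
      s = toℕ i + suc (toℕ j)
      0≤return : 0ℚ ℚ.≤ walk s (δ (ρ x)) (ρ x)
      0≤return = walk-nonneg s (0≤δ (ρ x)) (ρ x)
      ℓ≤L : ∀ (i : Fin (suc L)) → toℕ i ≤ L
      ℓ≤L i = s≤s⁻¹ (Fin.toℕ<n i)
      -- The remaining steps are arbitrary, since what has been found stays found.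
      slack = nextRadius L ∸ (toℕ (ℓ x) + s)
      used≤ : toℕ (ℓ x) + s ≤ nextRadius L
      used≤ = ≤-trans (+-mono-≤ (ℓ≤L (ℓ x)) (+-mono-≤ (ℓ≤L i) (s≤s (ℓ≤L j)))) (≤-reflexive (total L))
        where
        total : ∀ L → L + (L + suc L) ≡ suc (3 * L)
        total = solve-∀
      length-eq : toℕ (ℓ x) + (s + slack) ≡ nextRadius L
      length-eq = trans (sym (+-assoc (toℕ (ℓ x)) s slack)) (m+[n∸m]≡n used≤)

    -- The crossing itself is the extra step that turns two ascents of equal parity into an odd
    -- closed walk.
    odd-closure : ∀ {a b} → monochromatic a b ≡ true → odd (toℕ (ℓ a) + suc (toℕ (ℓ b))) ≡ true
    odd-closure {a} {b} mono = trans (odd-+ (toℕ (ℓ a)) (suc (toℕ (ℓ b))))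
                               (trans (xor-not (side a) (side b)) (proj₂ (∧-true {G a b} mono)))
      where
      xor-not : ∀ p q → (p xor not q) ≡ not (p xor q)
      xor-not true  q = refl
      xor-not false q = refl

    live-detects : ∀ x → live x ≡ true →
      1ℚ ℚ.≤ ι (detectionLoss D E L N) ℚ.* walkProb G (nextRadius L) x []
    live-detects x lx =
      let i , j , probable , witness =
            popular-lengths C monochromatic (λ {a} {b} r → proj₁ (∧-true {G a b} r)) (ρ x) (ρ x)
          0<v , d≤ = heavy-sound K violations {ρ x} lx
          a , b , ℓa , ℓb , mono = witness 0<v
      in ascend-and-return x i j
           (subst₂ (λ i j → odd (toℕ i + suc (toℕ j)) ≡ true) ℓa ℓb (odd-closure mono))
           (heavy-ratio (degree G (ρ x)) (violations (ρ x)) K (crossingLoss L N) 0<v d≤ probable)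

    trial-detects : suc n ≤ E * ∑ violations →
      1ℚ ℚ.≤ ι (K * detectionLoss D E L N) ℚ.* trialProb G (nextRadius L)
    trial-detects many = begin
      1ℚ
        ≡⟨ 1/-inverse n ⟨
      k ℚ.* ι (suc n)
        ≤⟨ *-monoʳ (0≤1/ n) (ι-mono (many-live many)) ⟩
      k ℚ.* ι (K * card live)
        ≡⟨ cong (k ℚ.*_) (ι-* K (card live)) ⟩
      k ℚ.* (ι K ℚ.* ι (card live))
        ≤⟨ *-monoʳ (0≤1/ n) (*-monoʳ (0≤ι K) live≤) ⟩
      k ℚ.* (ι K ℚ.* (ι Q ℚ.* s))
        ≡⟨ regroup k (ι K) (ι Q) s ⟩
      ι K ℚ.* ι Q ℚ.* (k ℚ.* s)
        ≡⟨ cong₂ (λ p q → p ℚ.* (k ℚ.* q)) (ι-* K Q) (sumℚ-tabulate f (λ x → x)) ⟨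
      ι (K * Q) ℚ.* trialProb G (nextRadius L) ∎
      where
      open ℚ.≤-Reasoning
      k = + 1 / suc n
      Q = detectionLoss D E L N
      f : V → ℚ
      f x = walkProb G (nextRadius L) x []
      s = ∑ℚ f
      sumℚ-tabulate : ∀ {m} (f : V → ℚ) (g : Fin m → V) → sumℚ (map f (tabulate g)) ≡ ∑ℚ (f ∘ g)
      sumℚ-tabulate {zero}  f g = sym (∑ℚ-empty (f ∘ g))
      sumℚ-tabulate {suc m} f g = trans (cong (f (g zero) ℚ.+_) (sumℚ-tabulate f (g ∘ suc)))
                                        (sym (∑ℚ-suc (f ∘ g)))
      regroup : ∀ a b c d → a ℚ.* (b ℚ.* (c ℚ.* d)) ≡ b ℚ.* c ℚ.* (a ℚ.* d)
      regroup = solve 4 (λ a b c d → a :* (b :* (c :* d)) := b :* c :* (a :* d)) refl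
        where open +-*-Solver
      bound : ∀ x b → live x ≡ b → ι ⟦ b ⟧ ℚ.≤ ι Q ℚ.* f x
      bound x true  lx = ℚ.≤-trans (ℚ.≤-reflexive ι-one) (live-detects x lx)
      bound x false _  = ℚ.≤-trans (ℚ.≤-reflexive ι-zero)
                           (*-nonneg (0≤ι Q) (walkProb-nonneg (nextRadius L) x []))
      live≤ : ι (card live) ℚ.≤ ι Q ℚ.* s
      live≤ = begin
        ι (card live)                ≡⟨ ι-∑ (λ x → ⟦ live x ⟧) ⟩
        ∑ℚ (λ x → ι ⟦ live x ⟧)      ≤⟨ ∑ℚ-mono (λ x → bound x (live x) refl) ⟩
        ∑ℚ (λ x → ι Q ℚ.* f x)       ≡⟨ ∑ℚ-*ˡ (ι Q) f ⟩
        ι Q ℚ.* s                    ∎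

    -- The bipartite subgraph given by the ascent parities

    coloured : Graph (suc n)
    coloured x y = G x y ∧ ((ρ x == ρ y) ∧ (side x xor side y))

    xor-≢ : ∀ {p q} → (p xor q) ≡ true → p ≢ q
    xor-≢ {true}  {false} _ ()
    xor-≢ {false} {true}  _ ()

    coloured-bipartite : Bipartite coloured
    coloured-bipartite = side , λ x y r → xor-≢ (proj₂ (∧-true {ρ x == ρ y} (proj₂ (∧-true {G x y} r))))

    coloured-spanning : SpanningSubgraph coloured G
    coloured-spanning = symmetric , λ x y r → proj₁ (∧-true {G x y} r)
      where
      xor-comm : ∀ p q → (p xor q) ≡ (q xor p)
      xor-comm true  true  = refl
      xor-comm true  false = refl
      xor-comm false true  = refl
      xor-comm false false = refl
      symmetric : ∀ x y → coloured x y ≡ coloured y x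
      symmetric x y = cong₂ _∧_ (proj₁ simpleG x y)
        (cong₂ _∧_ (==-sym (ρ x) (ρ y)) (xor-comm (side x) (side y)))

    edgeCount-∑ : ∀ (R : Graph (suc n)) →
      edgeCount R ≡ ∑ (λ x → ∑ (λ y → ⟦ R x y ∧ ⌊ toℕ x ℕ.<? toℕ y ⌋ ⟧))
    edgeCount-∑ R = trans (sum-tabulate (λ x → x))
      (∑-cong (λ x → length-filter (λ y → R x y ∧ ⌊ toℕ x ℕ.<? toℕ y ⌋) (λ y → y)))
      where
      h : V → ℕ
      h x = count (λ y → R x y ∧ ⌊ toℕ x ℕ.<? toℕ y ⌋) (allFin (suc n))
      sum-tabulate : ∀ {m} (g : Fin m → V) → ListAction.sum (map h (tabulate g)) ≡ ∑ (h ∘ g)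
      sum-tabulate {zero}  g = sym (∑-empty (h ∘ g))
      sum-tabulate {suc m} g = trans (cong (_+_ (h (g zero))) (sum-tabulate (g ∘ suc))) (sym (∑-suc (h ∘ g)))

    -- An edge missing from `coloured` joins two clusters or is a violation. The left side counts it
    -- once, the right side in both orientations, which only helps.
    deleted-edges : edgeCount G ∸ edgeCount coloured ≤ cross ρ + ∑ violations
    deleted-edges = m≤n+o⇒m∸n≤o (edgeCount G) (edgeCount coloured) (begin
      edgeCount G
        ≡⟨ edgeCount-∑ G ⟩
      ∑ (λ x → ∑ (λ y → ⟦ G x y ∧ ⌊ toℕ x ℕ.<? toℕ y ⌋ ⟧))
        ≤⟨ ∑∑-mono pointwise ⟩
      ∑ (λ x → ∑ (λ y → c x y + (⟦ not (ρ x == ρ y) ⟧ * ⟦ G x y ⟧ + w x y)))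
        ≡⟨ trans (∑∑-+ c _) (cong₂ _+_ (sym (edgeCount-∑ coloured))
             (trans (∑∑-+ (λ x y → ⟦ not (ρ x == ρ y) ⟧ * ⟦ G x y ⟧) w) (cong (_+_ (cross ρ)) all-violations))) ⟩
      edgeCount coloured + (cross ρ + ∑ violations) ∎)
      where
      open ≤-Reasoning
      c w : V → V → ℕ
      c x y = ⟦ coloured x y ∧ ⌊ toℕ x ℕ.<? toℕ y ⌋ ⟧
      -- The factor `1` is `⟦ true ⟧`, left by `violations-by-arc` when all clusters are selected.
      w x y = 1 * (⟦ ρ y == ρ x ⟧ * ⟦ monochromatic x y ⟧)
      all-violations : ∑ (λ x → ∑ (w x)) ≡ ∑ violations
      all-violations = sym (trans (∑-cong (λ U → sym (*-identityˡ (violations U))))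
                                  (violations-by-arc (λ _ → true)))
      pointwise : ∀ x y → ⟦ G x y ∧ ⌊ toℕ x ℕ.<? toℕ y ⌋ ⟧ ≤ c x y + (⟦ not (ρ x == ρ y) ⟧ * ⟦ G x y ⟧ + w x y)
      pointwise x y rewrite ==-sym (ρ y) (ρ x) =
        case (G x y) (ρ x == ρ y) (side x xor side y) ⌊ toℕ x ℕ.<? toℕ y ⌋
        where
        case : ∀ g s p l → ⟦ g ∧ l ⟧ ≤ ⟦ (g ∧ (s ∧ p)) ∧ l ⟧ + (⟦ not s ⟧ * ⟦ g ⟧ + 1 * (⟦ s ⟧ * ⟦ g ∧ not p ⟧))
        case false s     p     l     = z≤n
        case true  s     p     false = z≤n
        case true  false p     true  = s≤s z≤n
        case true  true  false true  = s≤s z≤n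
        case true  true  true  true  = s≤s z≤n

open Lemmas
import Data.Integer as ℤ
import Data.Integer.Properties as ℤ
open import Data.Integer using (+_)
open import Data.Rational using (_<_; _≤_)

-- Amplification

0≤p∸q : ∀ {p q} → q ≤ p → 0ℚ ≤ p ℚ.- q
0≤p∸q {p} {q} q≤p = subst (_≤ p ℚ.- q) (ℚ.+-inverseʳ q) (ℚ.+-monoˡ-≤ (ℚ.- q) q≤p)

-- Bernoulli: (1 − τ)(1 + (r + 1) τ) ≤ 1 + r τ.
powℚ-bernoulli : ∀ τ r → 0ℚ ≤ τ → τ ≤ 1ℚ → powℚ (1ℚ ℚ.- τ) r ℚ.* (1ℚ ℚ.+ ι r ℚ.* τ) ≤ 1ℚ
powℚ-bernoulli τ zero    0≤τ τ≤1 = ℚ.≤-reflexive (trans (ℚ.*-identityˡ _)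
  (trans (cong (λ z → 1ℚ ℚ.+ z ℚ.* τ) ι-zero) (trans (cong (1ℚ ℚ.+_) (ℚ.*-zeroˡ τ)) (ℚ.+-identityʳ 1ℚ))))
powℚ-bernoulli τ (suc r) 0≤τ τ≤1 = begin
  q ℚ.* powℚ q r ℚ.* (1ℚ ℚ.+ ι (suc r) ℚ.* τ)
    ≡⟨ cong (λ z → q ℚ.* powℚ q r ℚ.* (1ℚ ℚ.+ z ℚ.* τ)) (ι-suc r) ⟩
  q ℚ.* powℚ q r ℚ.* (1ℚ ℚ.+ (1ℚ ℚ.+ ι r) ℚ.* τ)
    ≡⟨ expand (powℚ q r) (ι r) τ ⟩
  powℚ q r ℚ.* (1ℚ ℚ.+ ι r ℚ.* τ ℚ.+ ℚ.- ((1ℚ ℚ.+ ι r) ℚ.* (τ ℚ.* τ)))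
    ≤⟨ *-monoʳ (powℚ-nonneg r) (ℚ.≤-trans (ℚ.+-monoʳ-≤ (1ℚ ℚ.+ ι r ℚ.* τ) (ℚ.neg-antimono-≤ 0≤sq))
         (ℚ.≤-reflexive (ℚ.+-identityʳ (1ℚ ℚ.+ ι r ℚ.* τ)))) ⟩
  powℚ q r ℚ.* (1ℚ ℚ.+ ι r ℚ.* τ)
    ≤⟨ powℚ-bernoulli τ r 0≤τ τ≤1 ⟩
  1ℚ ∎
  where
  open ℚ.≤-Reasoning
  q = 1ℚ ℚ.- τ
  powℚ-nonneg : ∀ r → 0ℚ ≤ powℚ q r
  powℚ-nonneg zero    = 0≤1
  powℚ-nonneg (suc r) = *-nonneg (0≤p∸q τ≤1) (powℚ-nonneg r)
  0≤sq : 0ℚ ≤ (1ℚ ℚ.+ ι r) ℚ.* (τ ℚ.* τ)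
  0≤sq = *-nonneg (ℚ.≤-trans (0≤ι (suc r)) (ℚ.≤-reflexive (ι-suc r))) (*-nonneg 0≤τ 0≤τ)
  expand : ∀ p r τ → (1ℚ ℚ.- τ) ℚ.* p ℚ.* (1ℚ ℚ.+ (1ℚ ℚ.+ r) ℚ.* τ)
                   ≡ p ℚ.* (1ℚ ℚ.+ r ℚ.* τ ℚ.+ ℚ.- ((1ℚ ℚ.+ r) ℚ.* (τ ℚ.* τ)))
  expand = solve 3 (λ p r τ → (con 1ℚ :- τ) :* p :* (con 1ℚ :+ (con 1ℚ :+ r) :* τ)
                    := p :* (con 1ℚ :+ r :* τ :+ :- ((con 1ℚ :+ r) :* (τ :* τ)))) refl
    where open +-*-Solver

-- By Bernoulli all `99 * Q` repetitions fail with probability at most 1 / (1 + 99), since `Q` times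
-- the success probability is at least one.
amplify : ∀ {n} (G : Graph n) t Q → 0ℚ ≤ trialProb G t → trialProb G t ≤ 1ℚ →
          1ℚ ≤ ι Q ℚ.* trialProb G t → + 99 / 100 ≤ rejectProb G (99 * Q) t
amplify G t Q 0≤τ τ≤1 1≤Qτ = ℚ.+-monoʳ-≤ 1ℚ (ℚ.neg-antimono-≤ miss≤)
  where
  open ℚ.≤-Reasoning
  τ = trialProb G t
  miss = powℚ (1ℚ ℚ.- τ) (99 * Q)
  0≤miss : ∀ r → 0ℚ ≤ powℚ (1ℚ ℚ.- τ) r
  0≤miss zero    = 0≤1
  0≤miss (suc r) = *-nonneg (0≤p∸q τ≤1) (0≤miss r)
  hundred : ι 100 ≤ 1ℚ ℚ.+ ι (99 * Q) ℚ.* τ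
  hundred = begin
    ι 100                             ≡⟨ ι-suc 99 ⟩
    1ℚ ℚ.+ ι 99                       ≡⟨ cong (1ℚ ℚ.+_) (ℚ.*-identityʳ (ι 99)) ⟨
    1ℚ ℚ.+ ι 99 ℚ.* 1ℚ                ≤⟨ ℚ.+-monoʳ-≤ 1ℚ (*-monoʳ (0≤ι 99) 1≤Qτ) ⟩
    1ℚ ℚ.+ ι 99 ℚ.* (ι Q ℚ.* τ)       ≡⟨ cong (1ℚ ℚ.+_) (ℚ.*-assoc (ι 99) (ι Q) τ) ⟨
    1ℚ ℚ.+ ι 99 ℚ.* ι Q ℚ.* τ         ≡⟨ cong (λ q → 1ℚ ℚ.+ q ℚ.* τ) (ι-* 99 Q) ⟨
    1ℚ ℚ.+ ι (99 * Q) ℚ.* τ           ∎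
  miss≤ : miss ≤ + 1 / 100
  miss≤ = begin
    miss                                    ≡⟨ ℚ.*-identityˡ miss ⟨
    1ℚ ℚ.* miss                             ≡⟨ cong (ℚ._* miss) (1/-inverse 99) ⟨
    (+ 1 / 100) ℚ.* ι 100 ℚ.* miss          ≡⟨ ℚ.*-assoc (+ 1 / 100) (ι 100) miss ⟩
    (+ 1 / 100) ℚ.* (ι 100 ℚ.* miss)        ≡⟨ cong ((+ 1 / 100) ℚ.*_) (ℚ.*-comm (ι 100) miss) ⟩
    (+ 1 / 100) ℚ.* (miss ℚ.* ι 100)        ≤⟨ *-monoʳ (0≤1/ 99) (ℚ.≤-trans (*-monoʳ (0≤miss (99 * Q)) hundred)
                                                 (powℚ-bernoulli τ (99 * Q) 0≤τ τ≤1)) ⟩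
    (+ 1 / 100) ℚ.* 1ℚ                      ≡⟨ ℚ.*-identityʳ (+ 1 / 100) ⟩
    + 1 / 100                               ∎

reject-0 : ∀ {n} (G : Graph n) r t → trialProb G t ≡ 0ℚ → rejectProb G r t ≡ 0ℚ
reject-0 G r t eq rewrite eq = trans (cong (λ p → 1ℚ ℚ.- p) (pow-1 r)) (ℚ.+-inverseʳ 1ℚ)
  where
  pow-1 : ∀ r → powℚ (1ℚ ℚ.- 0ℚ) r ≡ 1ℚ
  pow-1 zero    = refl
  pow-1 (suc r) = trans (cong₂ ℚ._*_ (ℚ.+-identityʳ 1ℚ) (pow-1 r)) (ℚ.*-identityˡ 1ℚ)

module _ {n} (G : Graph (suc n)) (simpleG : Simple G) (t : ℕ) where
  open Exploration G simpleG

  private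
    found : Fin (suc n) → ℚ
    found x = walkProb G t x []

    others : List (Fin (suc n))
    others = tabulate (λ x → Fin.suc x)

    trialProb-avg : trialProb G t ≡ avg found (zero ∷ others)
    trialProb-avg = cong (λ k → (+ 1 / suc k) ℚ.* sumℚ (List.map found (zero ∷ others)))
                         (sym (List.length-tabulate {n = n} (λ x → Fin.suc x)))

  trialProb-nonneg : 0ℚ ≤ trialProb G t
  trialProb-nonneg = subst₂ _≤_ (avg-const 0ℚ zero others) (sym trialProb-avg)
    (avg-mono {F = λ _ → 0ℚ} {F′ = found} (zero ∷ others) (λ {x} _ → walkProb-nonneg t x []))

  trialProb-≤1 : trialProb G t ≤ 1ℚ
  trialProb-≤1 = subst₂ _≤_ (sym trialProb-avg) (avg-const 1ℚ zero others)
    (avg-mono {F = found} {F′ = λ _ → 1ℚ} (zero ∷ others) (λ {x} _ → walkProb-≤1 t x []))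

  trialProb-bipartite : Bipartite G → trialProb G t ≡ 0ℚ
  trialProb-bipartite bip = ℚ.≤-antisym
    (subst₂ _≤_ (sym trialProb-avg) (avg-const 0ℚ zero others)
      (avg-mono {F = found} {F′ = λ _ → 0ℚ} (zero ∷ others) (λ {x} _ → walkProb-bipartite bip t x InG-[])))
    trialProb-nonneg

-- Passing from ε to natural numbers

denominator-bound : ∀ ε → 0ℚ < ε → 1ℚ ≤ ι (ℚ.↧ₙ ε) ℚ.* ε
denominator-bound ε 0<ε = begin
  1ℚ                              ≡⟨ ι-one ⟨
  ι 1                             ≤⟨ ι-mono (numerator ε 0<ε) ⟩
  ι ℤ.∣ ℚ.↥ ε ∣                   ≡⟨ /1≡ι ℤ.∣ ℚ.↥ ε ∣ ⟨
  + ℤ.∣ ℚ.↥ ε ∣ / 1               ≡⟨ cleared ε 0<ε ⟨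
  (+ ℚ.↧ₙ ε / 1) ℚ.* ε            ≡⟨ cong (ℚ._* ε) (/1≡ι (ℚ.↧ₙ ε)) ⟩
  ι (ℚ.↧ₙ ε) ℚ.* ε                ∎
  where
  open ℚ.≤-Reasoning
  numerator : ∀ ε → 0ℚ < ε → 1 ℕ.≤ ℤ.∣ ℚ.↥ ε ∣
  numerator (ℚ.mkℚ (+ suc a) d c) _ = s≤s z≤n
  numerator (ℚ.mkℚ (+ 0) d c) (ℚ.*<* (ℤ.+<+ ()))
  numerator (ℚ.mkℚ ℤ.-[1+ a ] d c) (ℚ.*<* ())
  cleared : ∀ ε → 0ℚ < ε → (+ ℚ.↧ₙ ε / 1) ℚ.* ε ≡ + ℤ.∣ ℚ.↥ ε ∣ / 1
  cleared (ℚ.mkℚ ℤ.-[1+ a ] d c) (ℚ.*<* ())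
  cleared ε@(ℚ.mkℚ (+ a) d c) _ = ℚ.toℚᵘ-injective (≃.begin
    toℚᵘ ((+ suc d / 1) ℚ.* ε)                       ≃.≈⟨ ℚ.toℚᵘ-homo-* (+ suc d / 1) ε ⟩
    toℚᵘ (+ suc d / 1) ℚᵘ.* ℚᵘ.mkℚᵘ (+ a) d          ≃.≈⟨ ℚᵘ.*-congʳ {ℚᵘ.mkℚᵘ (+ a) d} (ℚ.toℚᵘ-fromℚᵘ (ℚᵘ.mkℚᵘ (+ suc d) 0)) ⟩
    ℚᵘ.mkℚᵘ (+ suc d) 0 ℚᵘ.* ℚᵘ.mkℚᵘ (+ a) d         ≃.≈⟨ ℚᵘ.*≡* (trans (ℤ.*-identityʳ _)
                                                           (trans (ℤ.*-comm (+ suc d) (+ a))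
                                                             (cong (λ k → + a ℤ.* + k) (sym (ℕ.+-identityʳ (suc d)))))) ⟩
    ℚᵘ.mkℚᵘ (+ a) 0                                  ≃.≈⟨ ℚ.toℚᵘ-fromℚᵘ (ℚᵘ.mkℚᵘ (+ a) 0) ⟨
    toℚᵘ (+ a / 1)                                   ≃.∎)
    where module ≃ = ℚᵘ.≃-Reasoning

-- Replacing `ε` by the reciprocal of its denominator, which is no larger, turns the distance into
-- an inequality between natural numbers.
far-bound : ∀ ε → 0ℚ < ε → ∀ n d → ε ℚ.* (+ n / 1) < + d / 1 → n ℕ.≤ ℚ.↧ₙ ε * d
far-bound ε 0<ε n d far = ι-cancel-≤ (begin
  ι n                                  ≡⟨ ℚ.*-identityˡ (ι n) ⟨
  1ℚ ℚ.* ι n                           ≤⟨ *-monoˡ (0≤ι n) (denominator-bound ε 0<ε) ⟩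
  ι (ℚ.↧ₙ ε) ℚ.* ε ℚ.* ι n             ≡⟨ ℚ.*-assoc (ι (ℚ.↧ₙ ε)) ε (ι n) ⟩
  ι (ℚ.↧ₙ ε) ℚ.* (ε ℚ.* ι n)           ≤⟨ *-monoʳ (0≤ι (ℚ.↧ₙ ε)) (ℚ.<⇒≤ far′) ⟩
  ι (ℚ.↧ₙ ε) ℚ.* ι d                   ≡⟨ ι-* (ℚ.↧ₙ ε) d ⟨
  ι (ℚ.↧ₙ ε * d)                       ∎)
  where
  open ℚ.≤-Reasoning
  far′ : ε ℚ.* ι n < ι d
  far′ = subst₂ (λ a b → ε ℚ.* a < b) (/1≡ι n) (/1≡ι d) far

theorem2 : ∀ {k} (H : Graph k) → Simple H →
    Σ (ℚ → ℕ) λ f → Σ (ℚ → ℕ) λ g →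
    (∀ ε → 0ℚ < ε → (0 Data.Nat.< f ε) × (0 Data.Nat.< g ε)) ×
    (∀ ε → 0ℚ < ε → ∀ {n} (G : Graph n) → Simple G → MinorFree H G →
    (Bipartite G → rejectProb G (f ε) (g ε) ≡ 0ℚ) ×
    (FarFromBipartite ε G → (+ 99 / 100) ≤ rejectProb G (f ε) (g ε)))
theorem2 {k} H simpleH = f , g , (λ ε _ → z<s , z<s) , λ ε 0<ε G simpleG free →
    (λ bip → accepts ε G simpleG bip) , rejects ε 0<ε G simpleG free
  where
  -- The `suc` makes `D` positive even when `H` has no vertices and its density is zero.
  D : ℕ
  D = suc (density k)

  -- Half of the ε n far edges are allowed to run between the clusters.
  E R L N Q f g : ℚ → ℕ
  E ε = 2 * ℚ.↧ₙ ε
  R ε = rounds D (E ε)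
  L ε = radius (R ε)
  N ε = loss D (E ε) (R ε)
  Q ε = suc (2 * (E ε * D) * detectionLoss D (E ε) (L ε) (N ε))
  f ε = 99 * Q ε
  g ε = nextRadius (L ε)

  accepts : ∀ ε {n} (G : Graph n) → Simple G → Bipartite G → rejectProb G (f ε) (g ε) ≡ 0ℚ
  accepts ε {zero}  G simpleG bip = reject-0 G (f ε) (g ε) refl
  accepts ε {suc n} G simpleG bip = reject-0 G (f ε) (g ε) (trialProb-bipartite G simpleG (g ε) bip)

  rejects : ∀ ε → 0ℚ < ε → ∀ {n} (G : Graph n) → Simple G → MinorFree H G →
            FarFromBipartite ε G → + 99 / 100 ≤ rejectProb G (f ε) (g ε)
  -- Without vertices the distance condition would read `0 < 0`.
  rejects ε 0<ε {zero} G simpleG free far =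
    contradiction (far G (proj₁ simpleG , λ _ _ r → r) ((λ ()) , λ ()))
      (λ p → ℚ.<-irrefl (ℚ.*-zeroʳ ε) p)
  rejects ε 0<ε {suc n} G simpleG free far =
    amplify G (g ε) (Q ε) (trialProb-nonneg G simpleG (g ε)) (trialProb-≤1 G simpleG (g ε))
      (ratio-mono (n≤1+n _) (trialProb-nonneg G simpleG (g ε)) ℚ.≤-refl (trial-detects many))
    where
    sparse : HereditarilySparse D G
    sparse R′ α ρ fibres sy ir lift inhabited live = ≤-trans
      (minorFree⇒sparse simpleH simpleG free R′ α ρ fibres sy ir lift inhabited live)
      (*-monoˡ-≤ (card α) (n≤1+n (density k)))
    partition = Partition.low-diameter G simpleG {D} {E ε} sparse z<s
    C = proj₁ partition
    open Detection G simpleG {D} {E ε} sparse z<s C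
    open Clusters G simpleG using (cross)
    ρ = Clusterings.Clustering.ρ C
    many : suc n ℕ.≤ E ε * ∑ violations
    -- The distance bound is added to itself because `E ε` is twice the denominator; the crossing
    -- arcs use up only one of the two copies of `suc n`.
    many = +-cancelˡ-≤ (suc n) _ _ (begin
      suc n + suc n                                      ≤⟨ +-mono-≤ n≤ n≤ ⟩
      d * (cross ρ + v) + d * (cross ρ + v)              ≡⟨ double d (cross ρ) v ⟩
      E ε * cross ρ + E ε * v                            ≤⟨ +-monoˡ-≤ (E ε * v) (<⇒≤ (proj₂ partition)) ⟩
      suc n + E ε * v                                    ∎)
      where
      open ℕ.≤-Reasoning
      d = ℚ.↧ₙ ε
      v = ∑ violations
      n≤ : suc n ℕ.≤ d * (cross ρ + v)
      n≤ = ≤-trans (far-bound ε 0<ε (suc n) _ (far coloured coloured-spanning coloured-bipartite))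
                   (*-monoʳ-≤ d deleted-edges)
      double : ∀ d c v → d * (c + v) + d * (c + v) ≡ 2 * d * c + 2 * d * v
      double = solve-∀
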